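{- Let $\ell,m$ be integers with $1\le\ell<m$ and let $I=\{\ell,m\}$. Then every complex root of $d(I;z)$ lies in the union of the discs $\mathcal D_k=\{z\in\mathbb C\mid |z-k|\le m\}$ for $k=0,1,\dots,m-1$.
   Context: $d(I;z)$ is the descent polynomial: the unique polynomial whose value at each integer $n>\max(I\cup\{0\})$ is the number of permutations $\pi\in\mathfrak S_n$ with $\{j\mid\pi_j>\pi_{j+1}\}=I$, evaluated at complex $z$. -}

module Defs where

open import Data.Fin as Fin using (Fin; toℕ)
open import Data.Fin.Permutation as Perm using (Permutation′; _⟨$⟩ʳ_)
open import Data.Integer as ℤ using (+_)
import Data.Integer.Properties as ℤₚ
open import Data.List using (List; foldr)
open import Data.List.Extrema.Nat using (max)
open import Data.List.Membership.Propositional using (_∈_)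
open import Data.Nat as ℕ using (ℕ; zero; suc; z≤n; s≤s)
import Data.Nat.Properties as ℕₚ
import Data.Nat.Tactic.RingSolver as ℕSolver
open import Data.Product using (Σ; Σ-syntax; ∃-syntax; _×_; _,_; proj₁; proj₂)
open import Data.Rational as ℚ using (ℚ; mkℚ; 0ℚ; 1ℚ; ½)
import Data.Rational.Properties as ℚₚ
import Data.Rational.Unnormalised as ℚᵘ
import Data.Rational.Unnormalised.Properties as ℚᵘₚ
open import Data.Sum using (inj₁; inj₂)
open import Function.Bundles using (_⇔_; Inverse)
open import Level using (0ℓ)
open import Relation.Binary using (Setoid)
import Relation.Binary.Construct.On as On
open import Relation.Binary.PropositionalEquality
  using (_≡_; refl; sym; trans; cong; cong₂; subst; subst₂; setoid)
open import Relation.Nullary using (yes; no)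
open import Relation.Nullary.Decidable using (dec⇒maybe)
open import Tactic.RingSolver using (solve-∀)
open import Tactic.RingSolver.Core.AlmostCommutativeRing
  using (AlmostCommutativeRing; fromCommutativeRing)

IsCauchy : (ℕ → ℚ) → Set
IsCauchy x = ∀ ε → 0ℚ ℚ.< ε →
  ∃[ N ] (∀ i j → N ℕ.≤ i → N ℕ.≤ j → ℚ.∣ x i ℚ.- x j ∣ ℚ.< ε)

record ℝ : Set where
  constructor mkℝ
  field
    seq    : ℕ → ℚ
    cauchy : IsCauchy seq

open ℝ public

infix 4 _≈ᴿ_ _≤ᴿ_

_≈ᴿ_ : ℝ → ℝ → Set
x ≈ᴿ y = ∀ ε → 0ℚ ℚ.< ε →
  ∃[ N ] (∀ i → N ℕ.≤ i → ℚ.∣ seq x i ℚ.- seq y i ∣ ℚ.< ε)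

_≤ᴿ_ : ℝ → ℝ → Set
x ≤ᴿ y = ∀ ε → 0ℚ ℚ.< ε →
  ∃[ N ] (∀ i → N ℕ.≤ i → seq x i ℚ.< seq y i ℚ.+ ε)

module CauchyLemmas where
  ℚ-ring : AlmostCommutativeRing 0ℓ 0ℓ
  ℚ-ring = fromCommutativeRing ℚₚ.+-*-commutativeRing λ p → dec⇒maybe (0ℚ ℚₚ.≟ p)

  sum-diff : ∀ a b c d → (a ℚ.+ b) ℚ.- (c ℚ.+ d) ≡ (a ℚ.- c) ℚ.+ (b ℚ.- d)
  sum-diff = solve-∀ ℚ-ring

  add-diff : ∀ a b → a ≡ b ℚ.+ (a ℚ.- b)
  add-diff = solve-∀ ℚ-ring

  prod-diff : ∀ a b c d → a ℚ.* b ℚ.- c ℚ.* d ≡ a ℚ.* (b ℚ.- d) ℚ.+ d ℚ.* (a ℚ.- c)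
  prod-diff = solve-∀ ℚ-ring

  half-pos : ∀ {ε} → 0ℚ ℚ.< ε → 0ℚ ℚ.< ½ ℚ.* ε
  half-pos {ε} 0<ε = subst (ℚ._< ½ ℚ.* ε) (ℚₚ.*-zeroʳ ½) (ℚₚ.*-monoʳ-<-pos ½ 0<ε)

  half+half : ∀ ε → ½ ℚ.* ε ℚ.+ ½ ℚ.* ε ≡ ε
  half+half ε = trans (sym (ℚₚ.*-distribʳ-+ ε ½ ½)) (ℚₚ.*-identityˡ ε)

  ∣0∣<ε : ∀ p {ε} → 0ℚ ℚ.< ε → ℚ.∣ p ℚ.- p ∣ ℚ.< ε
  ∣0∣<ε p {ε} = subst (λ t → ℚ.∣ t ∣ ℚ.< ε) (sym (ℚₚ.+-inverseʳ p))

  *-pos : ∀ {p q} → 0ℚ ℚ.< p → 0ℚ ℚ.< q → 0ℚ ℚ.< p ℚ.* q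
  *-pos {p} {q} 0<p 0<q = ℚₚ.positive⁻¹ (p ℚ.* q)
    {{ℚₚ.pos*pos⇒pos p {{ℚ.positive 0<p}} q {{ℚ.positive 0<q}}}}

  *-nonNeg : ∀ {p q} → 0ℚ ℚ.≤ p → 0ℚ ℚ.≤ q → 0ℚ ℚ.≤ p ℚ.* q
  *-nonNeg {p} {q} 0≤p 0≤q = ℚₚ.nonNegative⁻¹ (p ℚ.* q)
    {{ℚₚ.nonNeg*nonNeg⇒nonNeg p {{ℚ.nonNegative 0≤p}} q {{ℚ.nonNegative 0≤q}}}}

  +-cauchy : ∀ x y → IsCauchy x → IsCauchy y → IsCauchy (λ i → x i ℚ.+ y i)
  +-cauchy x y cx cy ε 0<ε
    with cx (½ ℚ.* ε) (half-pos 0<ε) | cy (½ ℚ.* ε) (half-pos 0<ε)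
  ... | M , hM | N , hN = M ℕ.⊔ N , λ i j hi hj → begin-strict
      ℚ.∣ (x i ℚ.+ y i) ℚ.- (x j ℚ.+ y j) ∣
        ≡⟨ cong ℚ.∣_∣ (sum-diff (x i) (y i) (x j) (y j)) ⟩
      ℚ.∣ (x i ℚ.- x j) ℚ.+ (y i ℚ.- y j) ∣
        ≤⟨ ℚₚ.∣p+q∣≤∣p∣+∣q∣ (x i ℚ.- x j) (y i ℚ.- y j) ⟩
      ℚ.∣ x i ℚ.- x j ∣ ℚ.+ ℚ.∣ y i ℚ.- y j ∣
        <⟨ ℚₚ.+-mono-< (hM i j (ℕₚ.m⊔n≤o⇒m≤o M N hi) (ℕₚ.m⊔n≤o⇒m≤o M N hj))
                       (hN i j (ℕₚ.m⊔n≤o⇒n≤o M N hi) (ℕₚ.m⊔n≤o⇒n≤o M N hj)) ⟩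
      ½ ℚ.* ε ℚ.+ ½ ℚ.* ε
        ≡⟨ half+half ε ⟩
      ε ∎
    where open ℚₚ.≤-Reasoning

  neg-cauchy : ∀ x → IsCauchy x → IsCauchy (λ i → ℚ.- x i)
  neg-cauchy x cx ε 0<ε with cx ε 0<ε
  ... | N , h = N , λ i j hi hj →
    subst (ℚ._< ε) (trans (sym (ℚₚ.∣-p∣≡∣p∣ (x i ℚ.- x j)))
                          (cong ℚ.∣_∣ (ℚₚ.neg-distrib-+ (x i) (ℚ.- x j))))
          (h i j hi hj)

  EventuallyBounded : (ℕ → ℚ) → Set
  EventuallyBounded x =
    ∃[ B ] (0ℚ ℚ.< B × ∃[ N ] (∀ i → N ℕ.≤ i → ℚ.∣ x i ∣ ℚ.≤ B))

  cauchy⇒bounded : ∀ x → IsCauchy x → EventuallyBounded x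
  cauchy⇒bounded x cx with cx 1ℚ (ℚₚ.positive⁻¹ 1ℚ)
  ... | N , h = ℚ.∣ x N ∣ ℚ.+ 1ℚ
    , ℚₚ.+-mono-≤-< (ℚₚ.0≤∣p∣ (x N)) (ℚₚ.positive⁻¹ 1ℚ)
    , N , λ i hi → begin
      ℚ.∣ x i ∣
        ≡⟨ cong ℚ.∣_∣ (add-diff (x i) (x N)) ⟩
      ℚ.∣ x N ℚ.+ (x i ℚ.- x N) ∣
        ≤⟨ ℚₚ.∣p+q∣≤∣p∣+∣q∣ (x N) (x i ℚ.- x N) ⟩
      ℚ.∣ x N ∣ ℚ.+ ℚ.∣ x i ℚ.- x N ∣
        ≤⟨ ℚₚ.+-monoʳ-≤ ℚ.∣ x N ∣ (ℚₚ.<⇒≤ (h i N hi ℕₚ.≤-refl)) ⟩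
      ℚ.∣ x N ∣ ℚ.+ 1ℚ ∎
    where open ℚₚ.≤-Reasoning

  ∣p∣∣q∣<Bδ : ∀ p q {B δ} → 0ℚ ℚ.< B → ℚ.∣ p ∣ ℚ.≤ B → ℚ.∣ q ∣ ℚ.< δ →
              ℚ.∣ p ℚ.* q ∣ ℚ.< B ℚ.* δ
  ∣p∣∣q∣<Bδ p q {B} {δ} 0<B p≤B q<δ = begin-strict
    ℚ.∣ p ℚ.* q ∣          ≡⟨ ℚₚ.∣p*q∣≡∣p∣*∣q∣ p q ⟩
    ℚ.∣ p ∣ ℚ.* ℚ.∣ q ∣    ≤⟨ ℚₚ.*-monoʳ-≤-nonNeg ℚ.∣ q ∣ {{ℚₚ.∣-∣-nonNeg q}} p≤B ⟩
    B ℚ.* ℚ.∣ q ∣          <⟨ ℚₚ.*-monoʳ-<-pos B {{ℚ.positive 0<B}} q<δ ⟩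
    B ℚ.* δ                ∎
    where open ℚₚ.≤-Reasoning

  divide : ∀ {B ε} → 0ℚ ℚ.< B → 0ℚ ℚ.< ε → Σ[ δ ∈ ℚ ] (0ℚ ℚ.< δ × B ℚ.* δ ≡ ε)
  divide {B} {ε} 0<B 0<ε = 1/B ℚ.* ε
    , *-pos (ℚₚ.positive⁻¹ 1/B {{ℚₚ.1/pos⇒pos B {{ℚ.positive 0<B}}}}) 0<ε
    , trans (sym (ℚₚ.*-assoc B 1/B ε))
        (trans (cong (ℚ._* ε) (ℚₚ.*-inverseʳ B {{B≢0}})) (ℚₚ.*-identityˡ ε))
    where
    B≢0 : ℚ.NonZero B
    B≢0 = ℚₚ.pos⇒nonZero B {{ℚ.positive 0<B}}
    1/B : ℚ
    1/B = ℚ.1/_ B {{B≢0}}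

  product-close : ∀ {A B δ ε a b c d} → 0ℚ ℚ.< A → 0ℚ ℚ.< B → (A ℚ.+ B) ℚ.* δ ≡ ε →
    ℚ.∣ a ∣ ℚ.≤ A → ℚ.∣ d ∣ ℚ.≤ B → ℚ.∣ a ℚ.- c ∣ ℚ.< δ → ℚ.∣ b ℚ.- d ∣ ℚ.< δ →
    ℚ.∣ a ℚ.* b ℚ.- c ℚ.* d ∣ ℚ.< ε
  product-close {A} {B} {δ} {ε} {a} {b} {c} {d} 0<A 0<B [A+B]δ≡ε a≤A d≤B ac bd = begin-strict
    ℚ.∣ a ℚ.* b ℚ.- c ℚ.* d ∣
      ≡⟨ cong ℚ.∣_∣ (prod-diff a b c d) ⟩
    ℚ.∣ a ℚ.* (b ℚ.- d) ℚ.+ d ℚ.* (a ℚ.- c) ∣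
      ≤⟨ ℚₚ.∣p+q∣≤∣p∣+∣q∣ (a ℚ.* (b ℚ.- d)) (d ℚ.* (a ℚ.- c)) ⟩
    ℚ.∣ a ℚ.* (b ℚ.- d) ∣ ℚ.+ ℚ.∣ d ℚ.* (a ℚ.- c) ∣
      <⟨ ℚₚ.+-mono-< (∣p∣∣q∣<Bδ a (b ℚ.- d) 0<A a≤A bd) (∣p∣∣q∣<Bδ d (a ℚ.- c) 0<B d≤B ac) ⟩
    A ℚ.* δ ℚ.+ B ℚ.* δ
      ≡⟨ sym (ℚₚ.*-distribʳ-+ δ A B) ⟩
    (A ℚ.+ B) ℚ.* δ
      ≡⟨ [A+B]δ≡ε ⟩
    ε ∎
    where open ℚₚ.≤-Reasoning

  *-cauchy : ∀ x y → IsCauchy x → IsCauchy y → IsCauchy (λ i → x i ℚ.* y i)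
  *-cauchy x y cx cy ε 0<ε =
    let A , 0<A , K , hK = cauchy⇒bounded x cx
        B , 0<B , L , hL = cauchy⇒bounded y cy
        δ , 0<δ , Bδ≡ε = divide {A ℚ.+ B} (ℚₚ.+-mono-< 0<A 0<B) 0<ε
        M , hM = cx δ 0<δ
        N , hN = cy δ 0<δ
    in (K ℕ.⊔ L) ℕ.⊔ (M ℕ.⊔ N) , λ i j hi hj →
        let KLi = ℕₚ.m⊔n≤o⇒m≤o (K ℕ.⊔ L) (M ℕ.⊔ N) hi
            MNi = ℕₚ.m⊔n≤o⇒n≤o (K ℕ.⊔ L) (M ℕ.⊔ N) hi
            KLj = ℕₚ.m⊔n≤o⇒m≤o (K ℕ.⊔ L) (M ℕ.⊔ N) hj
            MNj = ℕₚ.m⊔n≤o⇒n≤o (K ℕ.⊔ L) (M ℕ.⊔ N) hj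
        in product-close 0<A 0<B Bδ≡ε
             (hK i (ℕₚ.m⊔n≤o⇒m≤o K L KLi)) (hL j (ℕₚ.m⊔n≤o⇒n≤o K L KLj))
             (hM i j (ℕₚ.m⊔n≤o⇒m≤o M N MNi) (ℕₚ.m⊔n≤o⇒m≤o M N MNj))
             (hN i j (ℕₚ.m⊔n≤o⇒n≤o M N MNi) (ℕₚ.m⊔n≤o⇒n≤o M N MNj))

open CauchyLemmas

infixl 6 _+ᴿ_
infixl 7 _*ᴿ_
infix  8 -ᴿ_

fromℚ : ℚ → ℝ
fromℚ q = mkℝ (λ _ → q) (λ ε 0<ε → 0 , λ _ _ _ _ → ∣0∣<ε q 0<ε)

fromℕ : ℕ → ℝ
fromℕ n = fromℚ (+ n ℚ./ 1)

_+ᴿ_ : ℝ → ℝ → ℝ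
x +ᴿ y = mkℝ (λ i → seq x i ℚ.+ seq y i) (+-cauchy (seq x) (seq y) (cauchy x) (cauchy y))

-ᴿ_ : ℝ → ℝ
-ᴿ x = mkℝ (λ i → ℚ.- seq x i) (neg-cauchy (seq x) (cauchy x))

_*ᴿ_ : ℝ → ℝ → ℝ
x *ᴿ y = mkℝ (λ i → seq x i ℚ.* seq y i) (*-cauchy (seq x) (seq y) (cauchy x) (cauchy y))

⌊√_⌋ : ℕ → ℕ
⌊√ zero ⌋  = 0
⌊√ suc n ⌋ with suc ⌊√ n ⌋ ℕ.* suc ⌊√ n ⌋ ℕ.≤? suc n
... | yes _ = suc ⌊√ n ⌋
... | no  _ = ⌊√ n ⌋

⌊√⌋-lower : ∀ n → ⌊√ n ⌋ ℕ.* ⌊√ n ⌋ ℕ.≤ n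
⌊√⌋-lower zero = z≤n
⌊√⌋-lower (suc n) with suc ⌊√ n ⌋ ℕ.* suc ⌊√ n ⌋ ℕ.≤? suc n
... | yes p = p
... | no  _ = ℕₚ.m≤n⇒m≤1+n (⌊√⌋-lower n)

⌊√⌋-upper : ∀ n → n ℕ.< suc ⌊√ n ⌋ ℕ.* suc ⌊√ n ⌋
⌊√⌋-upper zero = s≤s z≤n
⌊√⌋-upper (suc n) with suc ⌊√ n ⌋ ℕ.* suc ⌊√ n ⌋ ℕ.≤? suc n
... | yes _ = ℕₚ.≤-<-trans (⌊√⌋-upper n)
                (ℕₚ.*-mono-< (ℕₚ.n<1+n (suc ⌊√ n ⌋)) (ℕₚ.n<1+n (suc ⌊√ n ⌋)))
... | no ¬p = ℕₚ.≰⇒> ¬p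

-- With ∣q∣ = p/d in lowest terms, √∣q∣ = √(p·d·s²)/(d·s) for every s; taking
-- s = n + 1, the integer part of the numerator yields an approximation of
-- √∣q∣ from below with error less than 1/(n + 1).
√≈ : ℚ → ℕ → ℚ
√≈ (mkℚ i d-1 _) n =
  + ⌊√ ℤ.∣ i ∣ ℕ.* suc d-1 ℕ.* (suc n ℕ.* suc n) ⌋ ℚ./ (suc d-1 ℕ.* suc n)

module SquareRootLemmas where
  toℚᵘ-/ : ∀ k m → ℚ.toℚᵘ (+ k ℚ./ suc m) ℚᵘ.≃ ℚᵘ.mkℚᵘ (+ k) m
  toℚᵘ-/ k m = ℚₚ.toℚᵘ-fromℚᵘ (ℚᵘ.mkℚᵘ (+ k) m)

  0≤/ : ∀ k m → 0ℚ ℚ.≤ + k ℚ./ suc m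
  0≤/ k m = ℚₚ.nonNegative⁻¹ (+ k ℚ./ suc m) {{ℚₚ.normalize-nonNeg k (suc m)}}

  ≤ᵘ-intro : ∀ a b m n → a ℕ.* suc n ℕ.≤ b ℕ.* suc m →
             ℚᵘ.mkℚᵘ (+ a) m ℚᵘ.≤ ℚᵘ.mkℚᵘ (+ b) n
  ≤ᵘ-intro a b m n h =
    ℚᵘ.*≤* (subst₂ ℤ._≤_ (ℤₚ.pos-* a (suc n)) (ℤₚ.pos-* b (suc m)) (ℤ.+≤+ h))

  <ᵘ-intro : ∀ a b m n → a ℕ.* suc n ℕ.< b ℕ.* suc m →
             ℚᵘ.mkℚᵘ (+ a) m ℚᵘ.< ℚᵘ.mkℚᵘ (+ b) n
  <ᵘ-intro a b m n h =
    ℚᵘ.*<* (subst₂ ℤ._<_ (ℤₚ.pos-* a (suc n)) (ℤₚ.pos-* b (suc m)) (ℤ.+<+ h))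

  toℚᵘ-square : ∀ k m → ℚ.toℚᵘ ((+ k ℚ./ suc m) ℚ.* (+ k ℚ./ suc m))
                        ℚᵘ.≃ ℚᵘ.mkℚᵘ (+ (k ℕ.* k)) (m ℕ.+ m ℕ.* suc m)
  toℚᵘ-square k m = ℚᵘₚ.≃-trans (ℚₚ.toℚᵘ-homo-* (+ k ℚ./ suc m) (+ k ℚ./ suc m))
    (ℚᵘₚ.≃-trans (ℚᵘₚ.*-cong (toℚᵘ-/ k m) (toℚᵘ-/ k m))
      (ℚᵘₚ.≃-reflexive (cong (λ i → ℚᵘ.mkℚᵘ i (m ℕ.+ m ℕ.* suc m)) (sym (ℤₚ.pos-* k k)))))

  rearrange : ∀ p d s → (p ℕ.* d ℕ.* (s ℕ.* s)) ℕ.* d ≡ p ℕ.* ((d ℕ.* s) ℕ.* (d ℕ.* s))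
  rearrange = ℕSolver.solve-∀

  √≈-nonNeg : ∀ q n → 0ℚ ℚ.≤ √≈ q n
  √≈-nonNeg (mkℚ i d _) n =
    0≤/ ⌊√ ℤ.∣ i ∣ ℕ.* suc d ℕ.* (suc n ℕ.* suc n) ⌋ (n ℕ.+ d ℕ.* suc n)

  √≈-lower : ∀ q n → √≈ q n ℚ.* √≈ q n ℚ.≤ ℚ.∣ q ∣
  √≈-lower (mkℚ i d _) n = ℚₚ.toℚᵘ-cancel-≤
    (ℚᵘₚ.≤-respˡ-≃ (ℚᵘₚ.≃-sym (toℚᵘ-square k m))
      (≤ᵘ-intro (k ℕ.* k) p (m ℕ.+ m ℕ.* suc m) d
        (subst (k ℕ.* k ℕ.* suc d ℕ.≤_) (rearrange p (suc d) (suc n))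
          (ℕₚ.*-monoˡ-≤ (suc d) (⌊√⌋-lower (p ℕ.* suc d ℕ.* (suc n ℕ.* suc n)))))))
    where
    p k m : ℕ
    p = ℤ.∣ i ∣
    k = ⌊√ p ℕ.* suc d ℕ.* (suc n ℕ.* suc n) ⌋
    m = n ℕ.+ d ℕ.* suc n

  √≈-upper : ∀ q n → ∃[ r ] (0ℚ ℚ.≤ r × ℚ.∣ q ∣ ℚ.< r ℚ.* r × r ℚ.≤ √≈ q n ℚ.+ + 1 ℚ./ suc n)
  √≈-upper (mkℚ i d _) n = + suc k ℚ./ suc m , 0≤/ (suc k) m
    , ℚₚ.toℚᵘ-cancel-<
        (ℚᵘₚ.<-respʳ-≃ (ℚᵘₚ.≃-sym (toℚᵘ-square (suc k) m))
          (<ᵘ-intro p (suc k ℕ.* suc k) d (m ℕ.+ m ℕ.* suc m)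
            (subst (ℕ._< suc k ℕ.* suc k ℕ.* suc d) (rearrange p (suc d) (suc n))
              (ℕₚ.*-monoˡ-< (suc d) (⌊√⌋-upper (p ℕ.* suc d ℕ.* (suc n ℕ.* suc n)))))))
    , ℚₚ.toℚᵘ-cancel-≤
        (ℚᵘₚ.≤-respʳ-≃ (ℚᵘₚ.≃-sym sum-eq)
          (ℚᵘₚ.≤-respˡ-≃ (ℚᵘₚ.≃-sym (toℚᵘ-/ (suc k) m))
            (≤ᵘ-intro (suc k) (k ℕ.* suc n ℕ.+ 1 ℕ.* suc m) m (n ℕ.+ m ℕ.* suc n) cross)))
    where
    p k m : ℕ
    p = ℤ.∣ i ∣
    k = ⌊√ p ℕ.* suc d ℕ.* (suc n ℕ.* suc n) ⌋
    m = n ℕ.+ d ℕ.* suc n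
    sum-eq : ℚ.toℚᵘ ((+ k ℚ./ suc m) ℚ.+ (+ 1 ℚ./ suc n))
             ℚᵘ.≃ ℚᵘ.mkℚᵘ (+ (k ℕ.* suc n ℕ.+ 1 ℕ.* suc m)) (n ℕ.+ m ℕ.* suc n)
    sum-eq = ℚᵘₚ.≃-trans (ℚₚ.toℚᵘ-homo-+ (+ k ℚ./ suc m) (+ 1 ℚ./ suc n))
      (ℚᵘₚ.≃-trans (ℚᵘₚ.+-cong (toℚᵘ-/ k m) (toℚᵘ-/ 1 n))
        (ℚᵘₚ.≃-reflexive (cong (λ j → ℚᵘ.mkℚᵘ j (n ℕ.+ m ℕ.* suc n))
          (cong₂ ℤ._+_ (sym (ℤₚ.pos-* k (suc n))) (sym (ℤₚ.pos-* 1 (suc m)))))))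
    expandˡ : ∀ k s M → k ℕ.* s ℕ.* M ℕ.+ s ℕ.* M ≡ (1 ℕ.+ k) ℕ.* (M ℕ.* s)
    expandˡ = ℕSolver.solve-∀
    expandʳ : ∀ k s M → k ℕ.* s ℕ.* M ℕ.+ M ℕ.* M ≡ (k ℕ.* s ℕ.+ 1 ℕ.* M) ℕ.* M
    expandʳ = ℕSolver.solve-∀
    cross : suc k ℕ.* (suc m ℕ.* suc n) ℕ.≤ (k ℕ.* suc n ℕ.+ 1 ℕ.* suc m) ℕ.* suc m
    cross = subst₂ ℕ._≤_ (expandˡ k (suc n) (suc m)) (expandʳ k (suc n) (suc m))
      (ℕₚ.+-monoʳ-≤ (k ℕ.* suc n ℕ.* suc m)
        (ℕₚ.*-monoˡ-≤ (suc m) (ℕₚ.m≤m+n (suc n) (d ℕ.* suc n))))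

  1/suc-small : ∀ ε → 0ℚ ℚ.< ε → ∃[ N ] (∀ n → N ℕ.≤ n → + 1 ℚ./ suc n ℚ.≤ ε)
  1/suc-small ε@(mkℚ (+ suc p) d _) _ = d , λ n d≤n → ℚₚ.toℚᵘ-cancel-≤
    (ℚᵘₚ.≤-respˡ-≃ (ℚᵘₚ.≃-sym (toℚᵘ-/ 1 n))
      (≤ᵘ-intro 1 (suc p) n d
        (ℕₚ.*-mono-≤ {1} {suc p} (s≤s z≤n) (s≤s d≤n))))
  1/suc-small (mkℚ (+ zero) d _) 0<ε with ℚ.positive 0<ε
  ... | ()
  1/suc-small (mkℚ ℤ.-[1+ p ] d _) 0<ε with ℚ.positive 0<ε
  ... | ()

  square-mono-≤ : ∀ {a b} → 0ℚ ℚ.≤ a → a ℚ.≤ b → a ℚ.* a ℚ.≤ b ℚ.* b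
  square-mono-≤ {a} {b} 0≤a a≤b = ℚₚ.≤-trans
    (ℚₚ.*-monoˡ-≤-nonNeg a {{ℚ.nonNegative 0≤a}} a≤b)
    (ℚₚ.*-monoʳ-≤-nonNeg b {{ℚ.nonNegative (ℚₚ.≤-trans 0≤a a≤b)}} a≤b)

  p≤p+q : ∀ {p q} → 0ℚ ℚ.≤ q → p ℚ.≤ p ℚ.+ q
  p≤p+q {p} {q} 0≤q = subst (ℚ._≤ p ℚ.+ q) (ℚₚ.+-identityʳ p) (ℚₚ.+-monoʳ-≤ p 0≤q)

  square-slack : ∀ b h → (b ℚ.+ (h ℚ.+ h)) ℚ.* (b ℚ.+ (h ℚ.+ h)) ≡
    ((b ℚ.+ h) ℚ.* (b ℚ.+ h) ℚ.+ h ℚ.* (h ℚ.+ h)) ℚ.+ ((b ℚ.* h ℚ.+ b ℚ.* h) ℚ.+ h ℚ.* h)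
  square-slack = solve-∀ ℚ-ring

  -- Used with h = ε/2.
  √≈-diff : ∀ p q i j {h} → 0ℚ ℚ.< h → + 1 ℚ./ suc j ℚ.≤ h →
    ℚ.∣ p ℚ.- q ∣ ℚ.< h ℚ.* (h ℚ.+ h) → √≈ p i ℚ.< √≈ q j ℚ.+ (h ℚ.+ h)
  √≈-diff p q i j {h} 0<h δ≤h p-q<h² = ℚₚ.≰⇒> λ b+2h≤a → ℚₚ.<-irrefl refl (begin-strict
      ℚ.∣ p ∣
        ≡⟨ cong ℚ.∣_∣ (add-diff p q) ⟩
      ℚ.∣ q ℚ.+ (p ℚ.- q) ∣
        ≤⟨ ℚₚ.∣p+q∣≤∣p∣+∣q∣ q (p ℚ.- q) ⟩
      ℚ.∣ q ∣ ℚ.+ ℚ.∣ p ℚ.- q ∣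
        <⟨ ℚₚ.+-mono-< (ℚₚ.<-≤-trans q<r² (square-mono-≤ 0≤r r≤b+h)) p-q<h² ⟩
      (b ℚ.+ h) ℚ.* (b ℚ.+ h) ℚ.+ h ℚ.* (h ℚ.+ h)
        ≤⟨ p≤p+q 0≤slack ⟩
      ((b ℚ.+ h) ℚ.* (b ℚ.+ h) ℚ.+ h ℚ.* (h ℚ.+ h)) ℚ.+ ((b ℚ.* h ℚ.+ b ℚ.* h) ℚ.+ h ℚ.* h)
        ≡⟨ sym (square-slack b h) ⟩
      (b ℚ.+ (h ℚ.+ h)) ℚ.* (b ℚ.+ (h ℚ.+ h))
        ≤⟨ square-mono-≤ (ℚₚ.+-mono-≤ 0≤b (ℚₚ.+-mono-≤ 0≤h 0≤h)) b+2h≤a ⟩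
      √≈ p i ℚ.* √≈ p i
        ≤⟨ √≈-lower p i ⟩
      ℚ.∣ p ∣ ∎)
    where
    open ℚₚ.≤-Reasoning
    b r : ℚ
    b = √≈ q j
    r = proj₁ (√≈-upper q j)
    0≤b = √≈-nonNeg q j
    0≤h = ℚₚ.<⇒≤ 0<h
    0≤r = proj₁ (proj₂ (√≈-upper q j))
    q<r² = proj₁ (proj₂ (proj₂ (√≈-upper q j)))
    r≤b+h : r ℚ.≤ b ℚ.+ h
    r≤b+h = ℚₚ.≤-trans (proj₂ (proj₂ (proj₂ (√≈-upper q j)))) (ℚₚ.+-monoʳ-≤ b δ≤h)
    0≤slack : 0ℚ ℚ.≤ (b ℚ.* h ℚ.+ b ℚ.* h) ℚ.+ h ℚ.* h
    0≤slack = ℚₚ.+-mono-≤ (ℚₚ.+-mono-≤ (*-nonNeg 0≤b 0≤h) (*-nonNeg 0≤b 0≤h)) (*-nonNeg 0≤h 0≤h)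

  move : ∀ {a b e} → a ℚ.< b ℚ.+ e → a ℚ.- b ℚ.< e
  move {a} {b} {e} a<b+e = subst (a ℚ.- b ℚ.<_) (cancel b e) (ℚₚ.+-monoˡ-< (ℚ.- b) a<b+e)
    where
    cancel : ∀ b e → b ℚ.+ e ℚ.- b ≡ e
    cancel = solve-∀ ℚ-ring

  neg-diff : ∀ a b → ℚ.- (a ℚ.- b) ≡ b ℚ.- a
  neg-diff = solve-∀ ℚ-ring

  ∣a-b∣<ε : ∀ {a b ε} → a ℚ.< b ℚ.+ ε → b ℚ.< a ℚ.+ ε → ℚ.∣ a ℚ.- b ∣ ℚ.< ε
  ∣a-b∣<ε {a} {b} {ε} a<b+ε b<a+ε with ℚₚ.∣p∣≡p∨∣p∣≡-p (a ℚ.- b)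
  ... | inj₁ eq = subst (ℚ._< ε) (sym eq) (move a<b+ε)
  ... | inj₂ eq = subst (ℚ._< ε) (sym (trans eq (neg-diff a b))) (move b<a+ε)

  √-cauchy : ∀ x → IsCauchy x → IsCauchy (λ i → √≈ (x i) i)
  √-cauchy x cx ε 0<ε =
    let h = ½ ℚ.* ε
        0<h = half-pos 0<ε
        M , hM = 1/suc-small h 0<h
        N , hN = cx (h ℚ.* (h ℚ.+ h)) (*-pos 0<h (ℚₚ.+-mono-< 0<h 0<h))
        bound = λ i j (hi : M ℕ.⊔ N ℕ.≤ i) (hj : M ℕ.⊔ N ℕ.≤ j) →
          subst (λ e → √≈ (x i) i ℚ.< √≈ (x j) j ℚ.+ e) (half+half ε)
            (√≈-diff (x i) (x j) i j 0<h (hM j (ℕₚ.m⊔n≤o⇒m≤o M N hj))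
              (hN i j (ℕₚ.m⊔n≤o⇒n≤o M N hi) (ℕₚ.m⊔n≤o⇒n≤o M N hj)))
    in M ℕ.⊔ N , λ i j hi hj → ∣a-b∣<ε (bound i j hi hj) (bound j i hj hi)

open SquareRootLemmas

-- Since √≈ ignores signs, this is √∣x∣; it is only applied to x ≥ 0.
√_ : ℝ → ℝ
√ x = mkℝ (λ i → √≈ (seq x i) i) (√-cauchy (seq x) (cauchy x))

record ℂ : Set where
  constructor _+i_
  field
    re im : ℝ

open ℂ public

infix  4 _≈ᶜ_
infixl 6 _+ᶜ_ _-ᶜ_
infixl 7 _*ᶜ_

_≈ᶜ_ : ℂ → ℂ → Set
z ≈ᶜ w = re z ≈ᴿ re w × im z ≈ᴿ im w

natᶜ : ℕ → ℂ
natᶜ n = fromℕ n +i fromℕ 0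

0ᶜ : ℂ
0ᶜ = natᶜ 0

_+ᶜ_ : ℂ → ℂ → ℂ
z +ᶜ w = (re z +ᴿ re w) +i (im z +ᴿ im w)

_-ᶜ_ : ℂ → ℂ → ℂ
z -ᶜ w = (re z +ᴿ -ᴿ re w) +i (im z +ᴿ -ᴿ im w)

_*ᶜ_ : ℂ → ℂ → ℂ
z *ᶜ w = (re z *ᴿ re w +ᴿ -ᴿ (im z *ᴿ im w)) +i (re z *ᴿ im w +ᴿ im z *ᴿ re w)

∣_∣ᶜ : ℂ → ℝ
∣ z ∣ᶜ = √ (re z *ᴿ re z +ᴿ im z *ᴿ im z)

𝒟 : ℕ → ℕ → ℂ → Set
𝒟 m k z = ∣ z -ᶜ natᶜ k ∣ᶜ ≤ᴿ fromℕ m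

-- Coefficients, constant term first.
Polynomial : Set
Polynomial = List ℂ

eval : Polynomial → ℂ → ℂ
eval p z = foldr (λ a s → a +ᶜ z *ᶜ s) 0ᶜ p

IsRoot : Polynomial → ℂ → Set
IsRoot p z = eval p z ≈ᶜ 0ᶜ

-- Positions are numbered from 1, while elements of Fin n are numbered from 0:
-- a and b are the positions j and j + 1.  The values of π are likewise shifted
-- by one, which does not affect their comparison.
IsDescent : ∀ {n} → Permutation′ n → ℕ → Set
IsDescent {n} π j =
  Σ[ a ∈ Fin n ] Σ[ b ∈ Fin n ]
    (suc (toℕ a) ≡ j × toℕ b ≡ j × (π ⟨$⟩ʳ b) Fin.< (π ⟨$⟩ʳ a))

-- A list stands for the finite set of its elements.
HasDescentSet : List ℕ → ∀ {n} → Permutation′ n → Set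
HasDescentSet I π = ∀ j → IsDescent π j ⇔ j ∈ I

Permutationₛ : ℕ → Setoid 0ℓ 0ℓ
Permutationₛ n = record
  { Carrier       = Permutation′ n
  ; _≈_           = Perm._≈_
  ; isEquivalence = record
    { refl  = λ _ → refl
    ; sym   = λ π≈ρ i → sym (π≈ρ i)
    ; trans = λ π≈ρ ρ≈σ i → trans (π≈ρ i) (ρ≈σ i)
    }
  }

DescentClass : List ℕ → ℕ → Setoid 0ℓ 0ℓ
DescentClass I n =
  On.setoid {B = Σ (Permutation′ n) (HasDescentSet I)} (Permutationₛ n) proj₁

HasCardinality : Setoid 0ℓ 0ℓ → ℕ → Set
HasCardinality S N = Inverse (setoid (Fin N)) S

-- p is the polynomial z ↦ d(I; z).  At most one polynomial function satisfies
-- this, as its values at infinitely many integers are prescribed.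
IsDescentPolynomial : List ℕ → Polynomial → Set
IsDescentPolynomial I p = ∀ n → max 0 I ℕ.< n →
  ∃[ N ] (HasCardinality (DescentClass I n) N × eval p (natᶜ n) ≈ᶜ natᶜ N)

{-# OPTIONS --safe #-}
-- Counting permutations through the words that record in which block of
-- positions each value lies, inclusion–exclusion gives
--   d(z) = (C(m,ℓ) − 1) C(z,m) − C(z,ℓ) + 1.
-- If |z − k|² ≥ m² − 1 for all k < m and m ≥ 3, comparing the two products
-- factor by factor yields |(C(m,ℓ) − 1) C(z,m)|² ≥ 3 |C(z,ℓ)|² and
-- |C(z,ℓ)|² ≥ 8, which is incompatible with d(z) = 0; m = 2 is done by hand.
-- The slack between m² − 1 and m² lets one find the disc constructively: each
-- |z − k|² is eventually at most m² or eventually at least m² − 1.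
module Submission where

open import Defs
open import Data.List using ([]; _∷_)
open import Data.Nat using (ℕ; _≤_; _<_)
open import Data.Product using (_×_; ∃-syntax)

open import Algebra.Bundles using (CommutativeRing)
open import Data.Bool using (Bool; true; false; not; _∧_; T; T?)
open import Data.Bool.Properties using (∧-zeroʳ; T-∧)
open import Data.Empty using (⊥; ⊥-elim)
open import Data.Fin as Fin using (Fin; zero; suc; toℕ; _↑ˡ_; _↑ʳ_; splitAt; join; cast)
open import Data.Fin.Permutation as Perm using (Permutation′; _⟨$⟩ʳ_; _⟨$⟩ˡ_)
import Data.Fin.Properties as Finₚ
import Data.Integer as ℤ
import Data.Integer.Properties as ℤₚ
open import Data.List using (List; _++_; map; filterᵇ; foldr; length; lookup)
open import Data.List.Extrema.Nat using (max; max<v⁺)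
open import Data.List.Membership.Propositional using (_∈_)
open import Data.List.Membership.Propositional.Properties
  using (∈-++⁺ˡ; ∈-++⁺ʳ; ∈-++⁻; ∈-map⁺; ∈-map⁻; ∈-filter⁺; ∈-filter⁻; ∈-lookup)
open import Data.List.Properties using (length-++; filter-++)
open import Data.List.Relation.Unary.All as All using ([]; _∷_)
open import Data.List.Relation.Unary.AllPairs using ([]; _∷_)
open import Data.List.Relation.Unary.Any as Any using (here; there)
import Data.List.Relation.Unary.Any.Properties as Anyₚ
open import Data.List.Relation.Unary.Unique.Propositional using (Unique)
import Data.List.Relation.Unary.Unique.Propositional.Properties as Unique
open import Data.Maybe using (nothing)
open import Data.Nat as ℕ using (zero; suc; _!; z≤n; s≤s; _<ᵇ_)
open import Data.Nat.Properties as ℕₚ using (_!≢0)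
open import Data.Nat.Tactic.RingSolver using (solve-∀)
open import Data.Product using (Σ; _,_; proj₁; proj₂)
open import Data.Rational as ℚ using (ℚ; 0ℚ; 1ℚ; ½)
import Data.Rational.Properties as ℚₚ
import Data.Rational.Unnormalised as ℚᵘ
import Data.Rational.Unnormalised.Properties as ℚᵘₚ
open import Data.Sum as Sum using (_⊎_; inj₁; inj₂)
open import Function using (_∘_; const)
open import Function.Bundles using (Equivalence; Inverse; mk⇔)
open import Level using (0ℓ)
open import Relation.Binary using (tri<; tri≈; tri>)
import Relation.Binary.PropositionalEquality as ≡
open import Relation.Nullary using (¬_; contradiction)
open import Relation.Nullary.Decidable using (from-yes)
open import Tactic.RingSolver renaming (solve-∀ to solveᵣ-∀)
open import Tactic.RingSolver.Core.AlmostCommutativeRing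
  using (AlmostCommutativeRing; fromCommutativeRing)

open CauchyLemmas
open SquareRootLemmas hiding (rearrange)
open ≡ using (_≡_)

-- Polynomial functions over a commutative ring

-- Complex numbers are pairs of Cauchy sequences with termwise operations, so at a fixed index `i`
-- everything is an exact Gaussian rational, and the estimates are inequalities between the
-- rationals `normAt _ i`; no limit and no square root enters them. Only the equation of a root
-- fails termwise: it holds up to a defect e whose squared norm is eventually below 1/2. The factors
-- 3 and 8 in the estimates leave room for e, and clearing denominators turns the constant term into
-- a positive integer, too large to be balanced by such a defect. The counting yields the values of
-- d only at integers n > m, while `d` is an arbitrary list of coefficients that cannot be tested
-- for zero. Divided differences give an identity theorem that relies on degree bounds and on the
-- invertibility of positive integers. The counting relations are kept free of subtraction, so that
-- they live in ℕ until they are carried over to ℂ.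

fall : ℕ → ℕ → ℕ
fall n zero    = 1
fall n (suc j) = fall n j ℕ.* (n ℕ.∸ j)

module RingIdentities {c ℓ} (R : CommutativeRing c ℓ) where
  private
    solverRing : AlmostCommutativeRing c ℓ
    solverRing = fromCommutativeRing R λ _ → nothing

  open AlmostCommutativeRing solverRing

  +-quotient : ∀ u v d s t → (u + d * s) + (v + d * t) ≈ (u + v) + d * (s + t)
  +-quotient = solveᵣ-∀ solverRing
  scale-quotient : ∀ k u d s → k * (u + d * s) ≈ k * u + d * (k * s)
  scale-quotient = solveᵣ-∀ solverRing
  linear-quotient : ∀ e u d s → (e + d) * (u + d * s) ≈ e * u + d * ((u + d * s) + e * s)
  linear-quotient = solveᵣ-∀ solverRing
  interchange : ∀ a b c d → (a + b) + (c + d) ≈ (a + (b + c)) + d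
  interchange = solveᵣ-∀ solverRing

module PolynomialFunctions {c ℓ} (R : CommutativeRing c ℓ) where
  open CommutativeRing R
  open RingIdentities R
  open import Algebra.Properties.AbelianGroup +-abelianGroup using (xyx⁻¹≈y; x∙y⁻¹≈ε⇒x≈y)
  open import Algebra.Properties.Ring ring using (-0#≈0#; -1*x≈-x)
  open import Relation.Binary.Reasoning.Setoid setoid

  -- By divided differences with an arbitrary first node a.
  DegreeBelow : ℕ → (Carrier → Carrier) → Set (c Level.⊔ ℓ)
  DegreeBelow zero    f = ∀ z → f z ≈ 0#
  DegreeBelow (suc n) f = ∀ a → ∃[ g ] (DegreeBelow n g × ∀ z → f z ≈ f a + (z + - a) * g z)

  constant-quotient : ∀ u d → u ≈ u + d * 0#
  constant-quotient u d = sym (trans (+-congˡ (zeroʳ d)) (+-identityʳ u))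

  telescope : ∀ a k z → z + - k ≈ (a + - k) + (z + - a)
  telescope a k z = sym (trans (interchange a (- k) z (- a)) (trans (xyx⁻¹≈y a (- k + z)) (+-comm (- k) z)))

  degree-constant : ∀ u → DegreeBelow 1 (λ _ → u)
  degree-constant u a = (λ _ → 0#) , (λ _ → refl) , λ z → constant-quotient u (z + - a)

  degree-suc : ∀ n {f} → DegreeBelow n f → DegreeBelow (suc n) f
  degree-suc zero {f} f≈0 a = (λ _ → 0#) , (λ _ → refl) , λ z →
    trans (trans (f≈0 z) (sym (f≈0 a))) (constant-quotient (f a) (z + - a))
  degree-suc (suc n) {f} df a with df a
  ... | g , dg , f≈ = g , degree-suc n dg , f≈

  degree-cong : ∀ n {f g} → (∀ z → f z ≈ g z) → DegreeBelow n f → DegreeBelow n g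
  degree-cong zero    f≈g f≈0 z = trans (sym (f≈g z)) (f≈0 z)
  degree-cong (suc n) f≈g df a with df a
  ... | h , dh , f≈ = h , dh , λ z → trans (sym (f≈g z)) (trans (f≈ z) (+-congʳ (f≈g a)))

  degree-+ : ∀ n {f g} → DegreeBelow n f → DegreeBelow n g → DegreeBelow n (λ z → f z + g z)
  degree-+ zero    f≈0 g≈0 z = trans (+-cong (f≈0 z) (g≈0 z)) (+-identityˡ 0#)
  degree-+ (suc n) {f} {g} df dg a with df a | dg a
  ... | s , ds , f≈ | t , dt , g≈ = (λ z → s z + t z) , degree-+ n ds dt , λ z →
    trans (+-cong (f≈ z) (g≈ z)) (+-quotient (f a) (g a) (z + - a) (s z) (t z))

  degree-scale : ∀ n k {f} → DegreeBelow n f → DegreeBelow n (λ z → k * f z)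
  degree-scale zero    k f≈0 z = trans (*-congˡ (f≈0 z)) (zeroʳ k)
  degree-scale (suc n) k {f} df a with df a
  ... | s , ds , f≈ = (λ z → k * s z) , degree-scale n k ds , λ z →
    trans (*-congˡ (f≈ z)) (scale-quotient k (f a) (z + - a) (s z))

  degree-neg : ∀ n {f} → DegreeBelow n f → DegreeBelow n (λ z → - f z)
  degree-neg n {f} df = degree-cong n (λ z → -1*x≈-x (f z)) (degree-scale n (- 1#) df)

  -- Since z - k = (a - k) + (z - a), the divided difference of the product at `a` is f + (a - k) s,
  -- where s is that of f.
  degree-linear : ∀ n k {f} → DegreeBelow n f → DegreeBelow (suc n) (λ z → (z + - k) * f z)
  degree-linear zero k {f} f≈0 = degree-suc 0 λ z → trans (*-congˡ (f≈0 z)) (zeroʳ (z + - k))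
  degree-linear (suc n) k {f} df a with df a
  ... | s , ds , f≈ = (λ z → f z + (a + - k) * s z)
    , degree-+ (suc n) df (degree-scale (suc n) (a + - k) (degree-suc n ds))
    , λ z → trans (*-cong (telescope a k z) (f≈ z)) (trans (linear-quotient (a + - k) (f a) (z + - a) (s z))
        (+-congˡ (*-congˡ (+-congʳ (sym (f≈ z))))))

  degree-weaken : ∀ m n {f} → DegreeBelow n f → DegreeBelow (m ℕ.+ n) f
  degree-weaken zero    n df = df
  degree-weaken (suc m) n df = degree-suc (m ℕ.+ n) (degree-weaken m n df)

  horner : List Carrier → Carrier → Carrier
  horner p z = foldr (λ a s → a + z * s) 0# p

  degree-horner : ∀ (p : List Carrier) →
    DegreeBelow (suc (length p)) (horner p)
  degree-horner []      = degree-constant 0#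
  degree-horner (u ∷ p) = degree-+ (suc (suc k))
    (≡.subst (λ n → DegreeBelow n (λ _ → u)) (ℕₚ.+-comm (suc k) 1) (degree-weaken (suc k) 1 (degree-constant u)))
    -- Multiplication by z is the linear factor z - 0.
    (degree-cong (suc (suc k)) (λ z → *-congʳ (trans (+-congˡ -0#≈0#) (+-identityʳ z)))
      (degree-linear (suc k) 0# (degree-horner p)))
    where k = length p

  module _ (ν : ℕ → Carrier) (ν-+ : ∀ m n → ν (m ℕ.+ n) ≈ ν m + ν n)
           (ν-* : ∀ m n → ν (m ℕ.* n) ≈ ν m * ν n)
           (inverse : ∀ n → ∃[ u ] u * ν (suc n) ≈ 1#) where

    cancel : ∀ n x → ν (suc n) * x ≈ 0# → x ≈ 0#
    cancel n x νx≈0 with inverse n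
    ... | u , uν≈1 = begin
      x                     ≈⟨ *-identityˡ x ⟨
      1# * x                ≈⟨ *-congʳ uν≈1 ⟨
      u * ν (suc n) * x     ≈⟨ *-assoc u (ν (suc n)) x ⟩
      u * (ν (suc n) * x)   ≈⟨ *-congˡ νx≈0 ⟩
      u * 0#                ≈⟨ zeroʳ u ⟩
      0#                    ∎

    -- Take the divided difference g at the node ν K. For k > K the factor ν k - ν K = ν (k - K) is
    -- invertible, so g vanishes at all later nodes and, by induction on the degree bound,
    -- everywhere.
    vanishes : ∀ n {f} → DegreeBelow n f → ∀ K → (∀ k → K ℕ.≤ k → f (ν k) ≈ 0#) → ∀ z → f z ≈ 0#
    vanishes zero    f≈0 K fν≈0 = f≈0
    vanishes (suc n) {f} df K fν≈0 z with df (ν K)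
    ... | g , dg , f≈ = begin
      f z                             ≈⟨ f≈ z ⟩
      f (ν K) + (z + - ν K) * g z     ≈⟨ +-cong (fν≈0 K ℕₚ.≤-refl) (*-congˡ (vanishes n dg (suc K) gν≈0 z)) ⟩
      0# + (z + - ν K) * 0#           ≈⟨ +-identityˡ _ ⟩
      (z + - ν K) * 0#                ≈⟨ zeroʳ _ ⟩
      0#                              ∎
      where
      gν≈0 : ∀ k → suc K ℕ.≤ k → g (ν k) ≈ 0#
      gν≈0 k K<k with ℕₚ.m≤n⇒∃[o]m+o≡n K<k
      ... | j , ≡.refl = cancel j (g (ν k)) (begin
        ν (suc j) * g (ν k)               ≈⟨ *-congʳ (xyx⁻¹≈y (ν K) (ν (suc j))) ⟨
        (ν K + ν (suc j) + - ν K) * g (ν k) ≈⟨ *-congʳ (+-congʳ (sym (ν-+ K (suc j)))) ⟩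
        (ν (K ℕ.+ suc j) + - ν K) * g (ν k) ≈⟨ *-congʳ (+-congʳ (reflexive (≡.cong ν (ℕₚ.+-suc K j)))) ⟩
        (ν k + - ν K) * g (ν k)           ≈⟨ +-identityˡ _ ⟨
        0# + (ν k + - ν K) * g (ν k)      ≈⟨ +-congʳ (fν≈0 K ℕₚ.≤-refl) ⟨
        f (ν K) + (ν k + - ν K) * g (ν k) ≈⟨ f≈ (ν k) ⟨
        f (ν k)                           ≈⟨ fν≈0 k (ℕₚ.<⇒≤ K<k) ⟩
        0#                                ∎)

    -- The empty product is `ν 1` rather than `1#`, so that in `falling-ν` both sides are images of
    -- natural numbers from the start.
    falling : ℕ → Carrier → Carrier
    falling zero    z = ν 1
    falling (suc j) z = (z + - ν j) * falling j z

    degree-falling : ∀ j → DegreeBelow (suc j) (falling j)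
    degree-falling zero    = degree-constant (ν 1)
    degree-falling (suc j) = degree-linear (suc j) (ν j) (degree-falling j)

    falling-ν : ∀ j {n} → j ℕ.≤ n → falling j (ν n) ≈ ν (fall n j)
    falling-ν zero    _ = refl
    falling-ν (suc j) {n} j<n = begin
      (ν n + - ν j) * falling j (ν n)   ≈⟨ *-cong difference (falling-ν j (ℕₚ.<⇒≤ j<n)) ⟩
      ν (n ℕ.∸ j) * ν (fall n j)        ≈⟨ *-comm _ _ ⟩
      ν (fall n j) * ν (n ℕ.∸ j)        ≈⟨ ν-* _ _ ⟨
      ν (fall n j ℕ.* (n ℕ.∸ j))        ∎
      where
      difference : ν n + - ν j ≈ ν (n ℕ.∸ j)
      difference = begin
        ν n + - ν j                   ≡⟨ ≡.cong (λ k → ν k + - ν j) (ℕₚ.m+[n∸m]≡n (ℕₚ.<⇒≤ j<n)) ⟨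
        ν (j ℕ.+ (n ℕ.∸ j)) + - ν j   ≈⟨ +-congʳ (ν-+ j (n ℕ.∸ j)) ⟩
        ν j + ν (n ℕ.∸ j) + - ν j     ≈⟨ xyx⁻¹≈y (ν j) (ν (n ℕ.∸ j)) ⟩
        ν (n ℕ.∸ j)                   ∎

    -- The difference of the two sides is a polynomial function that vanishes at every ν n with n >
    -- m. The hypothesis on the values is an equation in ℕ with every term on the side where its
    -- sign is positive.
    interpolation : ∀ p a b c {l m} → l ℕ.≤ m →
      (∀ n → m ℕ.< n → ∃[ N ] (horner p (ν n) ≈ ν N ×
        c ℕ.* N ℕ.+ b ℕ.* fall n l ≡ a ℕ.* fall n m ℕ.+ c)) →
      ∀ z → ν c * horner p z + ν b * falling l z ≈ ν a * falling m z + ν c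
    interpolation p a b c {l} {m} l≤m values z =
      x∙y⁻¹≈ε⇒x≈y _ _ (vanishes D degree (suc m) zeros z)
      where
      -- The sum of all four degree bounds: each term can be raised to it without comparing
      -- `length p`, `l` and `m`.
      D = suc (length p) ℕ.+ (suc l ℕ.+ (suc m ℕ.+ 1))
      raise : ∀ i j {k f} → i ℕ.+ (j ℕ.+ k) ≡ D → DegreeBelow j f → DegreeBelow D f
      raise i j {k} {f} eq df = ≡.subst (λ n → DegreeBelow n f)
        (≡.trans (≡.cong (i ℕ.+_) (ℕₚ.+-comm k j)) eq)
        (degree-weaken i (k ℕ.+ j) (degree-weaken k j df))
      degree : DegreeBelow D (λ z → (ν c * horner p z + ν b * falling l z) + - (ν a * falling m z + ν c))
      degree = degree-+ D
        (degree-+ D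
          (raise 0 (suc (length p)) ≡.refl (degree-scale (suc (length p)) (ν c) (degree-horner p)))
          (raise (suc (length p)) (suc l) ≡.refl (degree-scale (suc l) (ν b) (degree-falling l))))
        (degree-neg D (degree-+ D
          (raise (suc (length p) ℕ.+ suc l) (suc m) (ℕₚ.+-assoc (suc (length p)) (suc l) _)
            (degree-scale (suc m) (ν a) (degree-falling m)))
          (raise (suc (length p) ℕ.+ (suc l ℕ.+ suc m)) 1 {0}
            (≡.trans (ℕₚ.+-assoc (suc (length p)) _ _) (≡.cong (suc (length p) ℕ.+_) (ℕₚ.+-assoc (suc l) (suc m) 1)))
            (degree-constant (ν c)))))
      zeros : ∀ n → suc m ℕ.≤ n →
        (ν c * horner p (ν n) + ν b * falling l (ν n)) + - (ν a * falling m (ν n) + ν c) ≈ 0#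
      zeros n m<n with values n m<n
      ... | N , pn≈N , eq = trans (+-cong lhs (-‿cong rhs)) (-‿inverseʳ _)
        where
        lhs : ν c * horner p (ν n) + ν b * falling l (ν n) ≈ ν (a ℕ.* fall n m ℕ.+ c)
        lhs = begin
          ν c * horner p (ν n) + ν b * falling l (ν n)
            ≈⟨ +-cong (*-congˡ pn≈N) (*-congˡ (falling-ν l (ℕₚ.≤-trans l≤m (ℕₚ.<⇒≤ m<n)))) ⟩
          ν c * ν N + ν b * ν (fall n l)
            ≈⟨ +-cong (ν-* c N) (ν-* b (fall n l)) ⟨
          ν (c ℕ.* N) + ν (b ℕ.* fall n l)
            ≈⟨ ν-+ _ _ ⟨
          ν (c ℕ.* N ℕ.+ b ℕ.* fall n l)
            ≡⟨ ≡.cong ν eq ⟩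
          ν (a ℕ.* fall n m ℕ.+ c) ∎
        rhs : ν a * falling m (ν n) + ν c ≈ ν (a ℕ.* fall n m ℕ.+ c)
        rhs = begin
          ν a * falling m (ν n) + ν c
            ≈⟨ +-congʳ (*-congˡ (falling-ν m (ℕₚ.<⇒≤ m<n))) ⟩
          ν a * ν (fall n m) + ν c
            ≈⟨ +-congʳ (ν-* a (fall n m)) ⟨
          ν (a ℕ.* fall n m) + ν c
            ≈⟨ ν-+ _ _ ⟨
          ν (a ℕ.* fall n m ℕ.+ c) ∎

open ≡ using (_≢_; refl; sym; trans; cong; cong₂; subst; subst₂; module ≡-Reasoning)

-- The ring of complex numbers

ι : ℕ → ℚ
ι n = ℤ.+ n ℚ./ 1

ι-+ : ∀ m n → ι (m ℕ.+ n) ≡ ι m ℚ.+ ι n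
ι-+ m n = ℚₚ.toℚᵘ-injective (ℚᵘₚ.≃-trans (toℚᵘ-/ (m ℕ.+ n) 0)
  (ℚᵘₚ.≃-trans (ℚᵘₚ.≃-reflexive (cong (λ i → ℚᵘ.mkℚᵘ i 0)
      (trans (ℤₚ.pos-+ m n) (sym (cong₂ ℤ._+_ (ℤₚ.*-identityʳ (ℤ.+ m)) (ℤₚ.*-identityʳ (ℤ.+ n)))))))
    (ℚᵘₚ.≃-sym (ℚᵘₚ.≃-trans (ℚₚ.toℚᵘ-homo-+ (ι m) (ι n)) (ℚᵘₚ.+-cong (toℚᵘ-/ m 0) (toℚᵘ-/ n 0))))))

ι-* : ∀ m n → ι (m ℕ.* n) ≡ ι m ℚ.* ι n
ι-* m n = ℚₚ.toℚᵘ-injective (ℚᵘₚ.≃-trans (toℚᵘ-/ (m ℕ.* n) 0)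
  (ℚᵘₚ.≃-trans (ℚᵘₚ.≃-reflexive (cong (λ i → ℚᵘ.mkℚᵘ i 0) (ℤₚ.pos-* m n)))
    (ℚᵘₚ.≃-sym (ℚᵘₚ.≃-trans (ℚₚ.toℚᵘ-homo-* (ι m) (ι n)) (ℚᵘₚ.*-cong (toℚᵘ-/ m 0) (toℚᵘ-/ n 0))))))

0≤ι : ∀ n → 0ℚ ℚ.≤ ι n
0≤ι n = 0≤/ n 0

ι-mono-≤ : ∀ {m n} → m ℕ.≤ n → ι m ℚ.≤ ι n
ι-mono-≤ {m} {n} m≤n = subst (ι m ℚ.≤_) (trans (sym (ι-+ m (n ℕ.∸ m))) (cong ι (ℕₚ.m+[n∸m]≡n m≤n)))
  (p≤p+q (0≤ι (n ℕ.∸ m)))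

0<ι : ∀ n → 0ℚ ℚ.< ι (suc n)
0<ι n = ℚₚ.positive⁻¹ (ι (suc n)) {{ℚₚ.normalize-pos (suc n) 1}}

pointwise : ∀ {x y} → (∀ i → seq x i ≡ seq y i) → x ≈ᴿ y
pointwise {x} {y} x≗y ε 0<ε = 0 , λ i _ →
  subst (λ t → ℚ.∣ seq x i ℚ.- t ∣ ℚ.< ε) (x≗y i) (∣0∣<ε (seq x i) 0<ε)

≈ᴿ-sym : ∀ {x y} → x ≈ᴿ y → y ≈ᴿ x
≈ᴿ-sym {x} {y} x≈y ε 0<ε with x≈y ε 0<ε
... | N , h = N , λ i hi → subst (ℚ._< ε)
  (trans (sym (ℚₚ.∣-p∣≡∣p∣ (seq x i ℚ.- seq y i))) (cong ℚ.∣_∣ (neg-diff (seq x i) (seq y i)))) (h i hi)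

difference-chain : ∀ a b c → a ℚ.- c ≡ (a ℚ.- b) ℚ.+ (b ℚ.- c)
difference-chain = solveᵣ-∀ ℚ-ring

≈ᴿ-trans : ∀ {x y z} → x ≈ᴿ y → y ≈ᴿ z → x ≈ᴿ z
≈ᴿ-trans {x} {y} {z} x≈y y≈z ε 0<ε
  with x≈y (½ ℚ.* ε) (half-pos 0<ε) | y≈z (½ ℚ.* ε) (half-pos 0<ε)
... | M , hM | N , hN = M ℕ.⊔ N , λ i hi → begin-strict
    ℚ.∣ seq x i ℚ.- seq z i ∣
      ≡⟨ cong ℚ.∣_∣ (difference-chain (seq x i) (seq y i) (seq z i)) ⟩
    ℚ.∣ (seq x i ℚ.- seq y i) ℚ.+ (seq y i ℚ.- seq z i) ∣
      ≤⟨ ℚₚ.∣p+q∣≤∣p∣+∣q∣ (seq x i ℚ.- seq y i) (seq y i ℚ.- seq z i) ⟩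
    ℚ.∣ seq x i ℚ.- seq y i ∣ ℚ.+ ℚ.∣ seq y i ℚ.- seq z i ∣
      <⟨ ℚₚ.+-mono-< (hM i (ℕₚ.m⊔n≤o⇒m≤o M N hi)) (hN i (ℕₚ.m⊔n≤o⇒n≤o M N hi)) ⟩
    ½ ℚ.* ε ℚ.+ ½ ℚ.* ε
      ≡⟨ half+half ε ⟩
    ε ∎
  where open ℚₚ.≤-Reasoning

+ᴿ-cong : ∀ {x x′ y y′} → x ≈ᴿ x′ → y ≈ᴿ y′ → x +ᴿ y ≈ᴿ x′ +ᴿ y′
+ᴿ-cong {x} {x′} {y} {y′} x≈ y≈ ε 0<ε
  with x≈ (½ ℚ.* ε) (half-pos 0<ε) | y≈ (½ ℚ.* ε) (half-pos 0<ε)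
... | M , hM | N , hN = M ℕ.⊔ N , λ i hi → begin-strict
    ℚ.∣ (seq x i ℚ.+ seq y i) ℚ.- (seq x′ i ℚ.+ seq y′ i) ∣
      ≡⟨ cong ℚ.∣_∣ (sum-diff (seq x i) (seq y i) (seq x′ i) (seq y′ i)) ⟩
    ℚ.∣ (seq x i ℚ.- seq x′ i) ℚ.+ (seq y i ℚ.- seq y′ i) ∣
      ≤⟨ ℚₚ.∣p+q∣≤∣p∣+∣q∣ (seq x i ℚ.- seq x′ i) (seq y i ℚ.- seq y′ i) ⟩
    ℚ.∣ seq x i ℚ.- seq x′ i ∣ ℚ.+ ℚ.∣ seq y i ℚ.- seq y′ i ∣
      <⟨ ℚₚ.+-mono-< (hM i (ℕₚ.m⊔n≤o⇒m≤o M N hi)) (hN i (ℕₚ.m⊔n≤o⇒n≤o M N hi)) ⟩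
    ½ ℚ.* ε ℚ.+ ½ ℚ.* ε
      ≡⟨ half+half ε ⟩
    ε ∎
  where open ℚₚ.≤-Reasoning

-ᴿ-cong : ∀ {x x′} → x ≈ᴿ x′ → -ᴿ x ≈ᴿ -ᴿ x′
-ᴿ-cong {x} {x′} x≈ ε 0<ε with x≈ ε 0<ε
... | N , h = N , λ i hi → subst (ℚ._< ε)
  (trans (sym (ℚₚ.∣-p∣≡∣p∣ (seq x i ℚ.- seq x′ i)))
    (cong ℚ.∣_∣ (ℚₚ.neg-distrib-+ (seq x i) (ℚ.- seq x′ i)))) (h i hi)

*ᴿ-cong : ∀ {x x′ y y′} → x ≈ᴿ x′ → y ≈ᴿ y′ → x *ᴿ y ≈ᴿ x′ *ᴿ y′
*ᴿ-cong {x} {x′} {y} {y′} x≈ y≈ ε 0<ε =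
  let bx , 0<bx , K , hK = cauchy⇒bounded (seq x) (cauchy x)
      by , 0<by , L , hL = cauchy⇒bounded (seq y′) (cauchy y′)
      δ , 0<δ , eq = divide {bx ℚ.+ by} (ℚₚ.+-mono-< 0<bx 0<by) 0<ε
      M , hM = x≈ δ 0<δ
      N , hN = y≈ δ 0<δ
  in (K ℕ.⊔ L) ℕ.⊔ (M ℕ.⊔ N) , λ i hi →
      let KL = ℕₚ.m⊔n≤o⇒m≤o (K ℕ.⊔ L) (M ℕ.⊔ N) hi
          MN = ℕₚ.m⊔n≤o⇒n≤o (K ℕ.⊔ L) (M ℕ.⊔ N) hi
      in product-close {a = seq x i} {b = seq y i} {c = seq x′ i} {d = seq y′ i} 0<bx 0<by eq
           (hK i (ℕₚ.m⊔n≤o⇒m≤o K L KL)) (hL i (ℕₚ.m⊔n≤o⇒n≤o K L KL))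
           (hM i (ℕₚ.m⊔n≤o⇒m≤o M N MN)) (hN i (ℕₚ.m⊔n≤o⇒n≤o M N MN))

infix 8 -ᶜ_

-ᶜ_ : ℂ → ℂ
-ᶜ z = (-ᴿ re z) +i (-ᴿ im z)

1ᶜ : ℂ
1ᶜ = natᶜ 1

module ComplexIdentities where
  *-assoc-re : ∀ a b c d e f →
    (a ℚ.* c ℚ.+ ℚ.- (b ℚ.* d)) ℚ.* e ℚ.+ ℚ.- ((a ℚ.* d ℚ.+ b ℚ.* c) ℚ.* f) ≡
    a ℚ.* (c ℚ.* e ℚ.+ ℚ.- (d ℚ.* f)) ℚ.+ ℚ.- (b ℚ.* (c ℚ.* f ℚ.+ d ℚ.* e))
  *-assoc-re = solveᵣ-∀ ℚ-ring
  *-assoc-im : ∀ a b c d e f →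
    (a ℚ.* c ℚ.+ ℚ.- (b ℚ.* d)) ℚ.* f ℚ.+ (a ℚ.* d ℚ.+ b ℚ.* c) ℚ.* e ≡
    a ℚ.* (c ℚ.* f ℚ.+ d ℚ.* e) ℚ.+ b ℚ.* (c ℚ.* e ℚ.+ ℚ.- (d ℚ.* f))
  *-assoc-im = solveᵣ-∀ ℚ-ring
  *-comm-re : ∀ a b c d → a ℚ.* c ℚ.+ ℚ.- (b ℚ.* d) ≡ c ℚ.* a ℚ.+ ℚ.- (d ℚ.* b)
  *-comm-re = solveᵣ-∀ ℚ-ring
  *-comm-im : ∀ a b c d → a ℚ.* d ℚ.+ b ℚ.* c ≡ c ℚ.* b ℚ.+ d ℚ.* a
  *-comm-im = solveᵣ-∀ ℚ-ring
  *-identityˡ-re : ∀ a b → 1ℚ ℚ.* a ℚ.+ ℚ.- (0ℚ ℚ.* b) ≡ a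
  *-identityˡ-re = solveᵣ-∀ ℚ-ring
  *-identityˡ-im : ∀ a b → 1ℚ ℚ.* b ℚ.+ 0ℚ ℚ.* a ≡ b
  *-identityˡ-im = solveᵣ-∀ ℚ-ring
  distribˡ-re : ∀ a b c d e f → a ℚ.* (c ℚ.+ e) ℚ.+ ℚ.- (b ℚ.* (d ℚ.+ f)) ≡
    (a ℚ.* c ℚ.+ ℚ.- (b ℚ.* d)) ℚ.+ (a ℚ.* e ℚ.+ ℚ.- (b ℚ.* f))
  distribˡ-re = solveᵣ-∀ ℚ-ring
  distribˡ-im : ∀ a b c d e f → a ℚ.* (d ℚ.+ f) ℚ.+ b ℚ.* (c ℚ.+ e) ≡
    (a ℚ.* d ℚ.+ b ℚ.* c) ℚ.+ (a ℚ.* f ℚ.+ b ℚ.* e)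
  distribˡ-im = solveᵣ-∀ ℚ-ring

-- This reduces each ring law of ℂ to rational identities between the terms at one index.
≈ᶜ-pointwise : ∀ {z w} → (∀ i → seq (re z) i ≡ seq (re w) i) → (∀ i → seq (im z) i ≡ seq (im w) i) → z ≈ᶜ w
≈ᶜ-pointwise {z} {w} h k = pointwise {re z} {re w} h , pointwise {im z} {im w} k

≈ᶜ-refl : ∀ {z} → z ≈ᶜ z
≈ᶜ-refl {z} = ≈ᶜ-pointwise {z} {z} (λ _ → refl) (λ _ → refl)

≈ᶜ-sym : ∀ {z w} → z ≈ᶜ w → w ≈ᶜ z
≈ᶜ-sym {z} {w} (h , k) = ≈ᴿ-sym {re z} {re w} h , ≈ᴿ-sym {im z} {im w} k

≈ᶜ-trans : ∀ {z w v} → z ≈ᶜ w → w ≈ᶜ v → z ≈ᶜ v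
≈ᶜ-trans {z} {w} {v} (h , k) (h′ , k′) =
  ≈ᴿ-trans {re z} {re w} {re v} h h′ , ≈ᴿ-trans {im z} {im w} {im v} k k′

+ᶜ-cong : ∀ {z z′ w w′} → z ≈ᶜ z′ → w ≈ᶜ w′ → z +ᶜ w ≈ᶜ z′ +ᶜ w′
+ᶜ-cong {z} {z′} {w} {w′} (h , k) (h′ , k′) =
  +ᴿ-cong {re z} {re z′} {re w} {re w′} h h′ , +ᴿ-cong {im z} {im z′} {im w} {im w′} k k′

-ᶜ-cong : ∀ {z z′} → z ≈ᶜ z′ → -ᶜ z ≈ᶜ -ᶜ z′
-ᶜ-cong {z} {z′} (h , k) = -ᴿ-cong {re z} {re z′} h , -ᴿ-cong {im z} {im z′} k

*ᶜ-cong : ∀ {z z′ w w′} → z ≈ᶜ z′ → w ≈ᶜ w′ → z *ᶜ w ≈ᶜ z′ *ᶜ w′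
*ᶜ-cong {x +i y} {x′ +i y′} {u +i v} {u′ +i v′} (h , k) (h′ , k′) =
    +ᴿ-cong {x *ᴿ u} {x′ *ᴿ u′} { -ᴿ (y *ᴿ v)} { -ᴿ (y′ *ᴿ v′)} (*ᴿ-cong {x} {x′} {u} {u′} h h′)
      (-ᴿ-cong {y *ᴿ v} {y′ *ᴿ v′} (*ᴿ-cong {y} {y′} {v} {v′} k k′))
  , +ᴿ-cong {x *ᴿ v} {x′ *ᴿ v′} {y *ᴿ u} {y′ *ᴿ u′} (*ᴿ-cong {x} {x′} {v} {v′} h k′)
      (*ᴿ-cong {y} {y′} {u} {u′} k h′)

module _ where
  open ComplexIdentities
  open import Algebra.Structures _≈ᶜ_ using (IsCommutativeRing)

  *ᶜ-comm : ∀ z w → z *ᶜ w ≈ᶜ w *ᶜ z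
  *ᶜ-comm z w = ≈ᶜ-pointwise {z *ᶜ w} {w *ᶜ z}
    (λ i → *-comm-re (seq (re z) i) (seq (im z) i) (seq (re w) i) (seq (im w) i))
    (λ i → *-comm-im (seq (re z) i) (seq (im z) i) (seq (re w) i) (seq (im w) i))

  +ᶜ-comm : ∀ z w → z +ᶜ w ≈ᶜ w +ᶜ z
  +ᶜ-comm z w = ≈ᶜ-pointwise {z +ᶜ w} {w +ᶜ z}
    (λ i → ℚₚ.+-comm (seq (re z) i) (seq (re w) i)) (λ i → ℚₚ.+-comm (seq (im z) i) (seq (im w) i))

  +ᶜ-identityˡ : ∀ z → 0ᶜ +ᶜ z ≈ᶜ z
  +ᶜ-identityˡ z = ≈ᶜ-pointwise {0ᶜ +ᶜ z} {z}
    (λ i → ℚₚ.+-identityˡ (seq (re z) i)) (λ i → ℚₚ.+-identityˡ (seq (im z) i))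

  +ᶜ-identityʳ : ∀ z → z +ᶜ 0ᶜ ≈ᶜ z
  +ᶜ-identityʳ z = ≈ᶜ-pointwise {z +ᶜ 0ᶜ} {z}
    (λ i → ℚₚ.+-identityʳ (seq (re z) i)) (λ i → ℚₚ.+-identityʳ (seq (im z) i))

  -ᶜ-inverseˡ : ∀ z → (-ᶜ z) +ᶜ z ≈ᶜ 0ᶜ
  -ᶜ-inverseˡ z = ≈ᶜ-pointwise {(-ᶜ z) +ᶜ z} {0ᶜ}
    (λ i → ℚₚ.+-inverseˡ (seq (re z) i)) (λ i → ℚₚ.+-inverseˡ (seq (im z) i))

  -ᶜ-inverseʳ : ∀ z → z +ᶜ (-ᶜ z) ≈ᶜ 0ᶜ
  -ᶜ-inverseʳ z = ≈ᶜ-pointwise {z +ᶜ (-ᶜ z)} {0ᶜ}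
    (λ i → ℚₚ.+-inverseʳ (seq (re z) i)) (λ i → ℚₚ.+-inverseʳ (seq (im z) i))

  *ᶜ-identityˡ : ∀ z → 1ᶜ *ᶜ z ≈ᶜ z
  *ᶜ-identityˡ z = ≈ᶜ-pointwise {1ᶜ *ᶜ z} {z}
    (λ i → *-identityˡ-re (seq (re z) i) (seq (im z) i))
    (λ i → *-identityˡ-im (seq (re z) i) (seq (im z) i))

  distribˡᶜ : ∀ z w v → z *ᶜ (w +ᶜ v) ≈ᶜ z *ᶜ w +ᶜ z *ᶜ v
  distribˡᶜ z w v = ≈ᶜ-pointwise {z *ᶜ (w +ᶜ v)} {z *ᶜ w +ᶜ z *ᶜ v}
    (λ i → distribˡ-re (seq (re z) i) (seq (im z) i) (seq (re w) i) (seq (im w) i) (seq (re v) i) (seq (im v) i))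
    (λ i → distribˡ-im (seq (re z) i) (seq (im z) i) (seq (re w) i) (seq (im w) i) (seq (re v) i) (seq (im v) i))

  ℂ-isCommutativeRing : IsCommutativeRing _+ᶜ_ _*ᶜ_ -ᶜ_ 0ᶜ 1ᶜ
  ℂ-isCommutativeRing = record
    { isRing = record
      { +-isAbelianGroup = record
        { isGroup = record
          { isMonoid = record
            { isSemigroup = record
              { isMagma = record
                { isEquivalence = record
                  { refl  = λ {z} → ≈ᶜ-refl {z}
                  ; sym   = λ {z} {w} → ≈ᶜ-sym {z} {w}
                  ; trans = λ {z} {w} {v} → ≈ᶜ-trans {z} {w} {v}
                  }
                ; ∙-cong = λ {z} {z′} {w} {w′} → +ᶜ-cong {z} {z′} {w} {w′}
                }
              ; assoc = λ z w v → ≈ᶜ-pointwise {(z +ᶜ w) +ᶜ v} {z +ᶜ (w +ᶜ v)}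
                  (λ i → ℚₚ.+-assoc (seq (re z) i) (seq (re w) i) (seq (re v) i))
                  (λ i → ℚₚ.+-assoc (seq (im z) i) (seq (im w) i) (seq (im v) i))
              }
            ; identity = +ᶜ-identityˡ , +ᶜ-identityʳ
            }
          ; inverse = -ᶜ-inverseˡ , -ᶜ-inverseʳ
          ; ⁻¹-cong = λ {z} {z′} → -ᶜ-cong {z} {z′}
          }
        ; comm = +ᶜ-comm
        }
      ; *-cong = λ {z} {z′} {w} {w′} → *ᶜ-cong {z} {z′} {w} {w′}
      ; *-assoc = λ z w v → ≈ᶜ-pointwise {(z *ᶜ w) *ᶜ v} {z *ᶜ (w *ᶜ v)}
          (λ i → *-assoc-re (seq (re z) i) (seq (im z) i) (seq (re w) i) (seq (im w) i) (seq (re v) i) (seq (im v) i))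
          (λ i → *-assoc-im (seq (re z) i) (seq (im z) i) (seq (re w) i) (seq (im w) i) (seq (re v) i) (seq (im v) i))
      ; *-identity = *ᶜ-identityˡ
          , λ z → ≈ᶜ-trans {z *ᶜ 1ᶜ} {1ᶜ *ᶜ z} {z} (*ᶜ-comm z 1ᶜ) (*ᶜ-identityˡ z)
      ; distrib = distribˡᶜ
          , λ z w v → ≈ᶜ-trans {(w +ᶜ v) *ᶜ z} {z *ᶜ (w +ᶜ v)} {w *ᶜ z +ᶜ v *ᶜ z} (*ᶜ-comm (w +ᶜ v) z)
              (≈ᶜ-trans {z *ᶜ (w +ᶜ v)} {z *ᶜ w +ᶜ z *ᶜ v} {w *ᶜ z +ᶜ v *ᶜ z} (distribˡᶜ z w v)
                (+ᶜ-cong {z *ᶜ w} {w *ᶜ z} {z *ᶜ v} {v *ᶜ z} (*ᶜ-comm z w) (*ᶜ-comm z v)))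
      }
    ; *-comm = *ᶜ-comm
    }

natᶜ-+ : ∀ m n → natᶜ (m ℕ.+ n) ≈ᶜ natᶜ m +ᶜ natᶜ n
natᶜ-+ m n = ≈ᶜ-pointwise {natᶜ (m ℕ.+ n)} {natᶜ m +ᶜ natᶜ n} (λ _ → ι-+ m n) (λ _ → refl)

natᶜ-* : ∀ m n → natᶜ (m ℕ.* n) ≈ᶜ natᶜ m *ᶜ natᶜ n
natᶜ-* m n = ≈ᶜ-pointwise {natᶜ (m ℕ.* n)} {natᶜ m *ᶜ natᶜ n}
  (λ _ → trans (ι-* m n) (sym (trans (cong (λ t → ι m ℚ.* ι n ℚ.+ ℚ.- t) (ℚₚ.*-zeroˡ 0ℚ)) (ℚₚ.+-identityʳ _))))
  (λ _ → sym (trans (cong₂ ℚ._+_ (ℚₚ.*-zeroʳ (ι m)) (ℚₚ.*-zeroˡ (ι n))) (ℚₚ.+-identityʳ 0ℚ)))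

natᶜ-inverse : ∀ n → ∃[ u ] u *ᶜ natᶜ (suc n) ≈ᶜ 1ᶜ
natᶜ-inverse n = u , ≈ᶜ-pointwise {u *ᶜ natᶜ (suc n)} {1ᶜ}
  (λ _ → trans (cong₂ (λ s t → s ℚ.+ ℚ.- t) (ℚₚ.*-inverseˡ (ι (suc n)) {{ι≢0}}) (ℚₚ.*-zeroˡ 0ℚ)) (ℚₚ.+-identityʳ 1ℚ))
  (λ _ → trans (cong₂ ℚ._+_ (ℚₚ.*-zeroʳ 1/ι) (ℚₚ.*-zeroˡ (ι (suc n)))) (ℚₚ.+-identityʳ 0ℚ))
  where
  ι≢0 : ℚ.NonZero (ι (suc n))
  ι≢0 = ℚₚ.pos⇒nonZero (ι (suc n)) {{ℚ.positive (0<ι n)}}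
  1/ι : ℚ
  1/ι = ℚ.1/_ (ι (suc n)) {{ι≢0}}
  u : ℂ
  u = fromℚ 1/ι +i fromℕ 0

infix  4 _≃_
infixl 6 _⊕_
infixl 7 _⊗_
infix  8 ⊖_

-- Opaque copies of the complex operations: otherwise conversion checking
-- compares the Cauchy proofs inside real numbers.
opaque
  _≃_ : ℂ → ℂ → Set
  _≃_ = _≈ᶜ_

  _⊕_ _⊗_ : ℂ → ℂ → ℂ
  _⊕_ = _+ᶜ_
  _⊗_ = _*ᶜ_

  ⊖_ : ℂ → ℂ
  ⊖_ = -ᶜ_

  ν : ℕ → ℂ
  ν = natᶜ

  open import Algebra.Structures using (IsCommutativeRing)

  ⊕-⊗-isCommutativeRing : IsCommutativeRing _≃_ _⊕_ _⊗_ ⊖_ (ν 0) (ν 1)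
  ⊕-⊗-isCommutativeRing = ℂ-isCommutativeRing

  ν-+ : ∀ m n → ν (m ℕ.+ n) ≃ ν m ⊕ ν n
  ν-+ = natᶜ-+

  ν-* : ∀ m n → ν (m ℕ.* n) ≃ ν m ⊗ ν n
  ν-* = natᶜ-*

  ν-inverse : ∀ n → ∃[ u ] u ⊗ ν (suc n) ≃ ν 1
  ν-inverse = natᶜ-inverse

  +ᶜ≡⊕ : _+ᶜ_ ≡ _⊕_
  +ᶜ≡⊕ = refl

  *ᶜ≡⊗ : _*ᶜ_ ≡ _⊗_
  *ᶜ≡⊗ = refl

  ν-unfold : ∀ n → natᶜ n ≡ ν n
  ν-unfold n = refl

  ≈ᶜ⇒≃ : ∀ {z w} → z ≈ᶜ w → z ≃ w
  ≈ᶜ⇒≃ h = h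

ℂ-commutativeRing : CommutativeRing 0ℓ 0ℓ
ℂ-commutativeRing = record { isCommutativeRing = ⊕-⊗-isCommutativeRing }

-- Counting permutations by words

open import Data.Nat using (_+_; _*_)

private variable
  p q r p′ q′ r′ : ℕ

-- The letter at index v is the block of positions (before the first descent,
-- between the two descents, after the second) at which the value v occurs.
data Word : ℕ → ℕ → ℕ → Set where
  []  : Word 0 0 0
  A_ : Word p q r → Word (suc p) q r
  B_ : Word p q r → Word p (suc q) r
  C_ : Word p q r → Word p q (suc r)

infixr 5 A_ B_ C_

Pos : ℕ → ℕ → ℕ → Set
Pos p q r = Fin p ⊎ (Fin q ⊎ Fin r)

pattern inA i = inj₁ i
pattern inB i = inj₂ (inj₁ i)
pattern inC i = inj₂ (inj₂ i)

data _≺_ : Pos p q r → Pos p q r → Set where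
  a≺ : ∀ {i j : Fin p} → i Fin.< j → _≺_ {p} {q} {r} (inA i) (inA j)
  b≺ : ∀ {i j : Fin q} → i Fin.< j → _≺_ {p} {q} {r} (inB i) (inB j)
  c≺ : ∀ {i j : Fin r} → i Fin.< j → _≺_ {p} {q} {r} (inC i) (inC j)

sucA : Pos p q r → Pos (suc p) q r
sucA (inA i) = inA (suc i)
sucA (inB i) = inB i
sucA (inC i) = inC i

sucB : Pos p q r → Pos p (suc q) r
sucB (inA i) = inA i
sucB (inB i) = inB (suc i)
sucB (inC i) = inC i

sucC : Pos p q r → Pos p q (suc r)
sucC (inA i) = inA i
sucC (inB i) = inB i
sucC (inC i) = inC (suc i)

size : Word p q r → ℕ
size []    = 0
size (A w) = suc (size w)
size (B w) = suc (size w)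
size (C w) = suc (size w)

size≡ : (w : Word p q r) → size w ≡ p + (q + r)
size≡ [] = refl
size≡ (A w) = cong suc (size≡ w)
size≡ {p} {suc q} {r} (B w) = trans (cong suc (size≡ w)) (sym (ℕₚ.+-suc p (q + r)))
size≡ {p} {q} {suc r} (C w) = trans (cong suc (size≡ w))
  (sym (trans (cong (p +_) (ℕₚ.+-suc q r)) (ℕₚ.+-suc p (q + r))))

val : (w : Word p q r) → Pos p q r → Fin (size w)
val (A w) (inA zero)    = zero
val (A w) (inA (suc i)) = suc (val w (inA i))
val (A w) (inB i)       = suc (val w (inB i))
val (A w) (inC i)       = suc (val w (inC i))
val (B w) (inA i)       = suc (val w (inA i))
val (B w) (inB zero)    = zero
val (B w) (inB (suc i)) = suc (val w (inB i))
val (B w) (inC i)       = suc (val w (inC i))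
val (C w) (inA i)       = suc (val w (inA i))
val (C w) (inB i)       = suc (val w (inB i))
val (C w) (inC zero)    = zero
val (C w) (inC (suc i)) = suc (val w (inC i))

pos : (w : Word p q r) → Fin (size w) → Pos p q r
pos (A w) zero    = inA zero
pos (A w) (suc v) = sucA (pos w v)
pos (B w) zero    = inB zero
pos (B w) (suc v) = sucB (pos w v)
pos (C w) zero    = inC zero
pos (C w) (suc v) = sucC (pos w v)

val-sucA : (w : Word p q r) (x : Pos p q r) → val (A w) (sucA x) ≡ suc (val w x)
val-sucA w (inA _) = refl
val-sucA w (inB _) = refl
val-sucA w (inC _) = refl

val-sucB : (w : Word p q r) (x : Pos p q r) → val (B w) (sucB x) ≡ suc (val w x)
val-sucB w (inA _) = refl
val-sucB w (inB _) = refl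
val-sucB w (inC _) = refl

val-sucC : (w : Word p q r) (x : Pos p q r) → val (C w) (sucC x) ≡ suc (val w x)
val-sucC w (inA _) = refl
val-sucC w (inB _) = refl
val-sucC w (inC _) = refl

val-pos : (w : Word p q r) (v : Fin (size w)) → val w (pos w v) ≡ v
val-pos (A w) zero    = refl
val-pos (A w) (suc v) = trans (val-sucA w (pos w v)) (cong suc (val-pos w v))
val-pos (B w) zero    = refl
val-pos (B w) (suc v) = trans (val-sucB w (pos w v)) (cong suc (val-pos w v))
val-pos (C w) zero    = refl
val-pos (C w) (suc v) = trans (val-sucC w (pos w v)) (cong suc (val-pos w v))

pos-val : (w : Word p q r) (x : Pos p q r) → pos w (val w x) ≡ x
pos-val [] (inA ())
pos-val [] (inB ())
pos-val [] (inC ())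
pos-val (A w) (inA zero)    = refl
pos-val (A w) (inA (suc i)) = cong sucA (pos-val w (inA i))
pos-val (A w) (inB i)       = cong sucA (pos-val w (inB i))
pos-val (A w) (inC i)       = cong sucA (pos-val w (inC i))
pos-val (B w) (inA i)       = cong sucB (pos-val w (inA i))
pos-val (B w) (inB zero)    = refl
pos-val (B w) (inB (suc i)) = cong sucB (pos-val w (inB i))
pos-val (B w) (inC i)       = cong sucB (pos-val w (inC i))
pos-val (C w) (inA i)       = cong sucC (pos-val w (inA i))
pos-val (C w) (inB i)       = cong sucC (pos-val w (inB i))
pos-val (C w) (inC zero)    = refl
pos-val (C w) (inC (suc i)) = cong sucC (pos-val w (inC i))

val-mono : (w : Word p q r) {x y : Pos p q r} → x ≺ y → val w x Fin.< val w y
val-mono (A w) (a≺ {i = zero} {suc j} _) = s≤s z≤n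
val-mono (A w) (a≺ {i = suc i} {suc j} (s≤s h)) = s≤s (val-mono w (a≺ h))
val-mono (A w) (b≺ h) = s≤s (val-mono w (b≺ h))
val-mono (A w) (c≺ h) = s≤s (val-mono w (c≺ h))
val-mono (B w) (a≺ h) = s≤s (val-mono w (a≺ h))
val-mono (B w) (b≺ {i = zero} {suc j} _) = s≤s z≤n
val-mono (B w) (b≺ {i = suc i} {suc j} (s≤s h)) = s≤s (val-mono w (b≺ h))
val-mono (B w) (c≺ h) = s≤s (val-mono w (c≺ h))
val-mono (C w) (a≺ h) = s≤s (val-mono w (a≺ h))
val-mono (C w) (b≺ h) = s≤s (val-mono w (b≺ h))
val-mono (C w) (c≺ {i = zero} {suc j} _) = s≤s z≤n
val-mono (C w) (c≺ {i = suc i} {suc j} (s≤s h)) = s≤s (val-mono w (c≺ h))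

valℕ : Word p q r → Pos p q r → ℕ
valℕ w x = toℕ (val w x)

-- If the first letters differ, the first position of the block named by one of them has value 0 for
-- that word and a positive value for the other. Values are compared in ℕ because the types of
-- `val w` and `val w′` involve different sizes.
valℕ-injective : (w w′ : Word p q r) → (∀ x → valℕ w x ≡ valℕ w′ x) → w ≡ w′
valℕ-injective [] [] _ = refl
valℕ-injective (A w) (A w′) h = cong A_ (valℕ-injective w w′ λ x →
  ℕₚ.suc-injective (subst₂ _≡_ (cong toℕ (val-sucA w x)) (cong toℕ (val-sucA w′ x)) (h (sucA x))))
valℕ-injective (B w) (B w′) h = cong B_ (valℕ-injective w w′ λ x →
  ℕₚ.suc-injective (subst₂ _≡_ (cong toℕ (val-sucB w x)) (cong toℕ (val-sucB w′ x)) (h (sucB x))))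
valℕ-injective (C w) (C w′) h = cong C_ (valℕ-injective w w′ λ x →
  ℕₚ.suc-injective (subst₂ _≡_ (cong toℕ (val-sucC w x)) (cong toℕ (val-sucC w′ x)) (h (sucC x))))
valℕ-injective (A _) (B _) h with () ← h (inA zero)
valℕ-injective (A _) (C _) h with () ← h (inA zero)
valℕ-injective (B _) (A _) h with () ← h (inB zero)
valℕ-injective (B _) (C _) h with () ← h (inB zero)
valℕ-injective (C _) (A _) h with () ← h (inC zero)
valℕ-injective (C _) (B _) h with () ← h (inC zero)

-- A bijection onto the interval from `s` to s + n - 1, increasing on each block. The offset lets
-- the least value be removed without renumbering the others.
record Numbering (s n : ℕ) (F : Pos p q r → ℕ) : Set where
  field
    injective : ∀ {x y} → F x ≡ F y → x ≡ y
    monotone  : ∀ {x y} → x ≺ y → F x < F y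
    lower     : ∀ x → s ≤ F x
    upper     : ∀ x → F x < s + n
    onto      : ∀ v → s ≤ v → v < s + n → ∃[ x ] F x ≡ v

-- What `sucA`, `sucB` and `sucC` have in common: each makes room for a new first position `x₀` in
-- one block. The removal of the least value is then argued once for all three letters.
record Insertion {p q r p′ q′ r′ : ℕ} (x₀ : Pos p′ q′ r′)
                 (σ : Pos p q r → Pos p′ q′ r′) : Set where
  field
    σ-injective : ∀ {x y} → σ x ≡ σ y → x ≡ y
    σ-monotone  : ∀ {x y} → x ≺ y → σ x ≺ σ y
    misses      : ∀ {x} → σ x ≢ x₀
    covers      : ∀ y → y ≡ x₀ ⊎ ∃[ x ] σ x ≡ y

insertionA : Insertion {p} {q} {r} (inA zero) sucA
insertionA = record
  { σ-injective = λ { {inA _} {inA _} refl → refl ; {inB _} {inB _} refl → refl ; {inC _} {inC _} refl → refl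
                    ; {inA _} {inB _} () ; {inA _} {inC _} () ; {inB _} {inA _} () ; {inB _} {inC _} ()
                    ; {inC _} {inA _} () ; {inC _} {inB _} () }
  ; σ-monotone = λ { (a≺ h) → a≺ (s≤s h) ; (b≺ h) → b≺ h ; (c≺ h) → c≺ h }
  ; misses = λ { {inA _} () ; {inB _} () ; {inC _} () }
  ; covers = λ { (inA zero) → inj₁ refl ; (inA (suc i)) → inj₂ (inA i , refl)
               ; (inB i) → inj₂ (inB i , refl) ; (inC i) → inj₂ (inC i , refl) }
  }

insertionB : Insertion {p} {q} {r} (inB zero) sucB
insertionB = record
  { σ-injective = λ { {inA _} {inA _} refl → refl ; {inB _} {inB _} refl → refl ; {inC _} {inC _} refl → refl
                    ; {inA _} {inB _} () ; {inA _} {inC _} () ; {inB _} {inA _} () ; {inB _} {inC _} ()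
                    ; {inC _} {inA _} () ; {inC _} {inB _} () }
  ; σ-monotone = λ { (a≺ h) → a≺ h ; (b≺ h) → b≺ (s≤s h) ; (c≺ h) → c≺ h }
  ; misses = λ { {inA _} () ; {inB _} () ; {inC _} () }
  ; covers = λ { (inA i) → inj₂ (inA i , refl) ; (inB zero) → inj₁ refl
               ; (inB (suc i)) → inj₂ (inB i , refl) ; (inC i) → inj₂ (inC i , refl) }
  }

insertionC : Insertion {p} {q} {r} (inC zero) sucC
insertionC = record
  { σ-injective = λ { {inA _} {inA _} refl → refl ; {inB _} {inB _} refl → refl ; {inC _} {inC _} refl → refl
                    ; {inA _} {inB _} () ; {inA _} {inC _} () ; {inB _} {inA _} () ; {inB _} {inC _} ()
                    ; {inC _} {inA _} () ; {inC _} {inB _} () }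
  ; σ-monotone = λ { (a≺ h) → a≺ h ; (b≺ h) → b≺ h ; (c≺ h) → c≺ (s≤s h) }
  ; misses = λ { {inA _} () ; {inB _} () ; {inC _} () }
  ; covers = λ { (inA i) → inj₂ (inA i , refl) ; (inB i) → inj₂ (inB i , refl)
               ; (inC zero) → inj₁ refl ; (inC (suc i)) → inj₂ (inC i , refl) }
  }

module _ {p q r p′ q′ r′ : ℕ} {x₀ : Pos p′ q′ r′} {σ : Pos p q r → Pos p′ q′ r′}
         (ins : Insertion x₀ σ) {s n : ℕ} {F : Pos p′ q′ r′ → ℕ} where

  open Insertion ins

  restrict : Numbering s (suc n) F → F x₀ ≡ s → Numbering (suc s) n (F ∘ σ)
  restrict num Fx₀≡s = record
    { injective = σ-injective ∘ injective
    ; monotone  = monotone ∘ σ-monotone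
    ; lower     = λ x → ℕₚ.≤∧≢⇒< (lower (σ x)) λ s≡Fσx → misses (injective (trans (sym s≡Fσx) (sym Fx₀≡s)))
    ; upper     = λ x → subst (F (σ x) <_) (ℕₚ.+-suc s n) (upper (σ x))
    ; onto      = onto′
    }
    where
    open Numbering num
    onto′ : ∀ v → suc s ≤ v → v < suc s + n → ∃[ x ] F (σ x) ≡ v
    onto′ v s<v v<t with onto v (ℕₚ.<⇒≤ s<v) (subst (v <_) (sym (ℕₚ.+-suc s n)) v<t)
    ... | y , Fy≡v with covers y
    ... | inj₁ refl       = contradiction (trans (sym Fx₀≡s) Fy≡v) (ℕₚ.<⇒≢ s<v)
    ... | inj₂ (x , refl) = x , Fy≡v

  extend : F x₀ ≡ s → {G : Pos p′ q′ r′ → ℕ} {H : Pos p q r → ℕ} →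
           G x₀ ≡ 0 → (∀ x → G (σ x) ≡ suc (H x)) →
           (∀ x → F (σ x) ≡ suc s + H x) → ∀ y → F y ≡ s + G y
  extend Fx₀≡s {G} {H} Gx₀≡0 Gσ Fσ y with covers y
  ... | inj₁ refl = trans Fx₀≡s (trans (sym (ℕₚ.+-identityʳ s)) (cong (s +_) (sym Gx₀≡0)))
  ... | inj₂ (x , refl) = trans (Fσ x) (trans (sym (ℕₚ.+-suc s (H x))) (cong (s +_) (sym (Gσ x))))

-- The least value `s` sits at the first position of its block, since otherwise that first position
-- would carry a smaller value. Its block is the first letter; the remaining positions are numbered
-- from s + 1.
numbering⇒word : ∀ n s {p q r} (F : Pos p q r → ℕ) → Numbering s n F →
                 ∃[ w ] (∀ x → F x ≡ s + valℕ w x)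
numbering⇒word zero s {zero} {zero} {zero} F num = [] , λ { (inA ()) ; (inB ()) ; (inC ()) }
numbering⇒word zero s {suc _} F num = ⊥-elim (ℕₚ.<⇒≱ (subst (F (inA zero) <_) (ℕₚ.+-identityʳ s) (upper (inA zero))) (lower (inA zero)))
  where open Numbering num
numbering⇒word zero s {zero} {suc _} F num = ⊥-elim (ℕₚ.<⇒≱ (subst (F (inB zero) <_) (ℕₚ.+-identityʳ s) (upper (inB zero))) (lower (inB zero)))
  where open Numbering num
numbering⇒word zero s {zero} {zero} {suc _} F num = ⊥-elim (ℕₚ.<⇒≱ (subst (F (inC zero) <_) (ℕₚ.+-identityʳ s) (upper (inC zero))) (lower (inC zero)))
  where open Numbering num
numbering⇒word (suc n) s F num
  with Numbering.onto num s ℕₚ.≤-refl (ℕₚ.m<m+n s (s≤s z≤n))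
... | inA (suc i) , refl = contradiction (Numbering.monotone num (a≺ {i = zero} (s≤s z≤n))) (ℕₚ.≤⇒≯ (Numbering.lower num (inA zero)))
... | inB (suc i) , refl = contradiction (Numbering.monotone num (b≺ {i = zero} (s≤s z≤n))) (ℕₚ.≤⇒≯ (Numbering.lower num (inB zero)))
... | inC (suc i) , refl = contradiction (Numbering.monotone num (c≺ {i = zero} (s≤s z≤n))) (ℕₚ.≤⇒≯ (Numbering.lower num (inC zero)))
... | inA zero , Fx₀≡s =
  let w , h = numbering⇒word n (suc s) (F ∘ sucA) (restrict insertionA num Fx₀≡s)
  in A w , extend insertionA {n = n} Fx₀≡s refl (λ x → cong toℕ (val-sucA w x)) h
... | inB zero , Fx₀≡s =
  let w , h = numbering⇒word n (suc s) (F ∘ sucB) (restrict insertionB num Fx₀≡s)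
  in B w , extend insertionB {n = n} Fx₀≡s refl (λ x → cong toℕ (val-sucB w x)) h
... | inC zero , Fx₀≡s =
  let w , h = numbering⇒word n (suc s) (F ∘ sucC) (restrict insertionC num Fx₀≡s)
  in C w , extend insertionC {n = n} Fx₀≡s refl (λ x → cong toℕ (val-sucC w x)) h

-- Permutations with two prescribed descents

place : Pos p q r → Fin (p + (q + r))
place {p} {q} {r} x = join p (q + r) (Sum.map₂ (join q r) x)

unplace : Fin (p + (q + r)) → Pos p q r
unplace {p} {q} i = Sum.map₂ (splitAt q) (splitAt p i)

unplace-place : (x : Pos p q r) → unplace (place x) ≡ x
unplace-place {p} {q} {r} (inA i) rewrite Finₚ.splitAt-↑ˡ p i (q + r) = refl
unplace-place {p} {q} {r} (inB i)
  rewrite Finₚ.splitAt-↑ʳ p (q + r) (i ↑ˡ r) | Finₚ.splitAt-↑ˡ q i r = refl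
unplace-place {p} {q} {r} (inC i)
  rewrite Finₚ.splitAt-↑ʳ p (q + r) (q ↑ʳ i) | Finₚ.splitAt-↑ʳ q r i = refl

place-unplace : (i : Fin (p + (q + r))) → place {p} {q} {r} (unplace i) ≡ i
place-unplace {p} {q} {r} i with splitAt p i | Finₚ.join-splitAt p (q + r) i
... | inj₁ _ | eq = eq
... | inj₂ j | eq = trans (cong (p ↑ʳ_) (Finₚ.join-splitAt q r j)) eq

index : Pos p q r → ℕ
index {p} {q} (inA i) = toℕ i
index {p} {q} (inB i) = p + toℕ i
index {p} {q} (inC i) = p + (q + toℕ i)

toℕ-place : (x : Pos p q r) → toℕ (place x) ≡ index x
toℕ-place {p} {q} {r} (inA i) = Finₚ.toℕ-↑ˡ i (q + r)
toℕ-place {p} {q} {r} (inB i) = trans (Finₚ.toℕ-↑ʳ p (i ↑ˡ r)) (cong (p +_) (Finₚ.toℕ-↑ˡ i r))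
toℕ-place {p} {q} {r} (inC i) = trans (Finₚ.toℕ-↑ʳ p (q ↑ʳ i)) (cong (p +_) (Finₚ.toℕ-↑ʳ q i))

valueAt : Permutation′ (p + (q + r)) → Pos p q r → ℕ
valueAt π x = toℕ (π ⟨$⟩ʳ place x)

valueAt-injective : (π : Permutation′ (p + (q + r))) {x y : Pos p q r} →
                    valueAt π x ≡ valueAt π y → x ≡ y
valueAt-injective π {x} {y} eq = begin
  x                                     ≡⟨ unplace-place x ⟨
  unplace (place x)                     ≡⟨ cong unplace (Perm.inverseˡ π) ⟨
  unplace (π ⟨$⟩ˡ (π ⟨$⟩ʳ place x))     ≡⟨ cong (unplace ∘ (π ⟨$⟩ˡ_)) (Finₚ.toℕ-injective eq) ⟩
  unplace (π ⟨$⟩ˡ (π ⟨$⟩ʳ place y))     ≡⟨ cong unplace (Perm.inverseˡ π) ⟩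
  unplace (place y)                     ≡⟨ unplace-place y ⟩
  y                                     ∎
  where open ≡-Reasoning

last : ∀ k → Fin (suc k)
last = Fin.fromℕ

-- The last two alternatives are the borders between blocks, where the descents will lie. As `r` may
-- be 0 here, the first position of the last block appears as some `k` with `toℕ k ≡ 0`.
consecutive : (x y : Pos (suc p) (suc q) r) → index y ≡ suc (index x) →
              x ≺ y ⊎ (x ≡ inA (last p) × y ≡ inB zero) ⊎ (x ≡ inB (last q) × ∃[ k ] y ≡ inC k × toℕ k ≡ 0)
consecutive {p} {q} (inA i) (inA j) eq = inj₁ (a≺ (ℕₚ.≤-reflexive (sym eq)))
consecutive {p} {q} (inA i) (inB zero) eq = inj₂ (inj₁ (cong inA (Finₚ.toℕ-injective
  (trans (ℕₚ.suc-injective (trans (sym eq) (ℕₚ.+-identityʳ (suc p)))) (sym (Finₚ.toℕ-fromℕ p)))) , refl))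
consecutive {p} {q} (inA i) (inB (suc j)) eq = contradiction eq
  (ℕₚ.>⇒≢ (ℕₚ.<-≤-trans (s≤s (Finₚ.toℕ<n i)) (ℕₚ.≤-trans (ℕₚ.≤-reflexive (ℕₚ.+-comm 1 (suc p))) (ℕₚ.+-monoʳ-≤ (suc p) (s≤s z≤n)))))
consecutive {p} {q} (inA i) (inC j) eq = contradiction eq
  (ℕₚ.>⇒≢ (ℕₚ.<-≤-trans (s≤s (Finₚ.toℕ<n i)) (ℕₚ.≤-trans (ℕₚ.≤-reflexive (ℕₚ.+-comm 1 (suc p))) (ℕₚ.+-monoʳ-≤ (suc p) (s≤s z≤n)))))
consecutive {p} {q} (inB i) (inA j) eq = contradiction eq
  (ℕₚ.<⇒≢ (ℕₚ.<-≤-trans (Finₚ.toℕ<n j) (ℕₚ.≤-trans (ℕₚ.m≤m+n (suc p) _) (ℕₚ.n≤1+n _))))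
consecutive {p} {q} (inB i) (inB j) eq = inj₁ (b≺ (ℕₚ.+-cancelˡ-≤ (suc p) _ _
  (ℕₚ.≤-reflexive (trans (ℕₚ.+-suc (suc p) (toℕ i)) (sym eq)))))
consecutive {p} {q} (inB i) (inC j) eq = inj₂ (inj₂ (cong (inj₂ ∘ inj₁) (Finₚ.toℕ-injective
    (trans (ℕₚ.≤-antisym (ℕₚ.≤-pred (Finₚ.toℕ<n i)) (ℕₚ.≤-trans (ℕₚ.m≤m+n q (toℕ j)) (ℕₚ.≤-reflexive q+j≡i))) (sym (Finₚ.toℕ-fromℕ q)))) , j , refl ,
    ℕₚ.n≤0⇒n≡0 (ℕₚ.+-cancelˡ-≤ q _ _ (ℕₚ.≤-trans (ℕₚ.≤-reflexive q+j≡i) (ℕₚ.≤-trans (ℕₚ.≤-pred (Finₚ.toℕ<n i)) (ℕₚ.≤-reflexive (sym (ℕₚ.+-identityʳ q))))))))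
  where
  q+j≡i : q + toℕ j ≡ toℕ i
  q+j≡i = ℕₚ.suc-injective (ℕₚ.+-cancelˡ-≡ (suc p) _ _ (trans eq (sym (ℕₚ.+-suc (suc p) (toℕ i)))))
consecutive {p} {q} (inC i) (inA j) eq = contradiction eq
  (ℕₚ.<⇒≢ (ℕₚ.<-≤-trans (Finₚ.toℕ<n j) (ℕₚ.≤-trans (ℕₚ.m≤m+n (suc p) _) (ℕₚ.n≤1+n _))))
consecutive {p} {q} (inC i) (inB j) eq = contradiction
  (ℕₚ.+-cancelˡ-≡ (suc p) _ _ (trans eq (sym (ℕₚ.+-suc (suc p) (suc q + toℕ i)))))
  (ℕₚ.<⇒≢ (ℕₚ.<-≤-trans (Finₚ.toℕ<n j) (ℕₚ.≤-trans (ℕₚ.m≤m+n (suc q) (toℕ i)) (ℕₚ.n≤1+n _))))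
consecutive {p} {q} (inC i) (inC j) eq = inj₁ (c≺ (ℕₚ.≤-reflexive (ℕₚ.+-cancelˡ-≡ (suc q) _ _ (ℕₚ.+-cancelˡ-≡ (suc p) _ _
  (trans (trans (cong (suc p +_) (ℕₚ.+-suc (suc q) (toℕ i))) (ℕₚ.+-suc (suc p) (suc q + toℕ i))) (sym eq))))))

increasing : ∀ {k} (f : Fin k → ℕ) → (∀ {i j} → toℕ j ≡ suc (toℕ i) → f i < f j) →
             ∀ {i j} → i Fin.< j → f i < f j
increasing f h {zero}  {suc zero}    _         = h refl
increasing f h {zero}  {suc (suc j)} _         =
  ℕₚ.<-trans (h {zero} {suc zero} refl) (increasing (f ∘ suc) (h ∘ cong suc) {zero} {suc j} (s≤s z≤n))
increasing f h {suc i} {suc j}       (s≤s i<j) = increasing (f ∘ suc) (h ∘ cong suc) i<j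

-- The block form of having descent set {ℓ, m}: ascents inside the blocks, descents across both
-- borders.
record Shape (Φ : Pos (suc p) (suc q) (suc r) → ℕ) : Set where
  field
    monotone : ∀ {x y} → x ≺ y → Φ x < Φ y
    descent₁ : Φ (inB zero) < Φ (inA (last p))
    descent₂ : Φ (inC zero) < Φ (inB (last q))

module _ {p q r : ℕ} (π : Permutation′ (suc p + (suc q + suc r))) where

  private
    ℓ = suc p
    m = suc p + suc q
    P = Pos (suc p) (suc q) (suc r)
    Φ : P → ℕ
    Φ = valueAt π

  isDescent : ∀ {x y j} → suc (index {suc p} {suc q} {suc r} x) ≡ j → index y ≡ j → Φ y < Φ x → IsDescent π j
  isDescent {x} {y} x↦j y↦j Φy<Φx =
    place x , place y , trans (cong suc (toℕ-place x)) x↦j , trans (toℕ-place y) y↦j , Φy<Φx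

  shape⇒descentSet : Shape Φ → HasDescentSet (ℓ ∷ m ∷ []) π
  shape⇒descentSet sh j = mk⇔ to from
    where
    open Shape sh
    to : IsDescent π j → j ∈ ℓ ∷ m ∷ []
    to (u , v , u↦j , v↦j , πv<πu) =
      go (unplace u) (unplace v) (place-unplace {suc p} {suc q} {suc r} u) (place-unplace {suc p} {suc q} {suc r} v)
      where
      go : (x y : P) → place x ≡ u → place y ≡ v → j ∈ ℓ ∷ m ∷ []
      go x y refl refl with consecutive x y
        (trans (sym (toℕ-place y)) (trans v↦j (trans (sym u↦j) (cong suc (toℕ-place x)))))
      ... | inj₁ x≺y = contradiction πv<πu (ℕₚ.<-asym (monotone x≺y))
      ... | inj₂ (inj₁ (refl , refl)) =
        here (trans (sym v↦j) (trans (toℕ-place {suc p} {suc q} {suc r} (inB zero)) (ℕₚ.+-identityʳ ℓ)))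
      ... | inj₂ (inj₂ (refl , k , refl , k≡0)) =
        there (here (trans (sym v↦j) (trans (toℕ-place {suc p} {suc q} {suc r} (inC k))
          (cong (suc p +_) (trans (cong (suc q +_) k≡0) (ℕₚ.+-identityʳ (suc q)))))))
    from : j ∈ ℓ ∷ m ∷ [] → IsDescent π j
    from (here refl) =
      isDescent {inA (last p)} {inB zero} (cong suc (Finₚ.toℕ-fromℕ p)) (ℕₚ.+-identityʳ ℓ) descent₁
    from (there (here refl)) =
      isDescent {inB (last q)} {inC zero}
        (trans (cong (λ t → suc (suc p + t)) (Finₚ.toℕ-fromℕ q)) (sym (ℕₚ.+-suc (suc p) q)))
        (cong (suc p +_) (ℕₚ.+-identityʳ (suc q))) descent₂

  descentSet⇒shape : HasDescentSet (ℓ ∷ m ∷ []) π → Shape Φ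
  descentSet⇒shape des = record
    { monotone = λ
        { (a≺ h) → increasing (Φ ∘ λ i → inA i) (λ {i} {j} eq → ascent {inA i} {inA j} eq
            (ℕₚ.<⇒≢ (Finₚ.toℕ<n j))
            (ℕₚ.<⇒≢ (ℕₚ.<-≤-trans (Finₚ.toℕ<n j) (ℕₚ.m≤m+n ℓ (suc q))))) h
        ; (b≺ h) → increasing (Φ ∘ λ i → inB i) (λ {i} {j} eq → ascent {inB i} {inB j}
            (trans (cong (suc p +_) eq) (ℕₚ.+-suc (suc p) (toℕ i)))
            (ℕₚ.>⇒≢ (ℕₚ.m<m+n ℓ (ℕₚ.≤-trans (s≤s z≤n) (ℕₚ.≤-reflexive (sym eq)))))
            (ℕₚ.<⇒≢ (ℕₚ.+-monoʳ-< ℓ (Finₚ.toℕ<n j)))) h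
        ; (c≺ h) → increasing (Φ ∘ λ i → inC i) (λ {i} {j} eq → ascent {inC i} {inC j}
            (trans (cong (λ t → suc p + (suc q + t)) eq)
              (trans (cong (suc p +_) (ℕₚ.+-suc (suc q) (toℕ i))) (ℕₚ.+-suc (suc p) (suc q + toℕ i))))
            (ℕₚ.>⇒≢ (ℕₚ.m<m+n ℓ (s≤s z≤n)))
            (ℕₚ.>⇒≢ (ℕₚ.+-monoʳ-< ℓ (ℕₚ.m<m+n (suc q) (ℕₚ.≤-trans (s≤s z≤n) (ℕₚ.≤-reflexive (sym eq))))))) h
        }
    ; descent₁ = descentAt {inA (last p)} {inB zero} (here refl)
        (cong suc (Finₚ.toℕ-fromℕ p)) (ℕₚ.+-identityʳ ℓ)
    ; descent₂ = descentAt {inB (last q)} {inC zero} (there (here refl))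
        (trans (cong (λ t → suc (suc p + t)) (Finₚ.toℕ-fromℕ q)) (sym (ℕₚ.+-suc (suc p) q)))
        (cong (suc p +_) (ℕₚ.+-identityʳ (suc q)))
    }
    where
    -- Equal values would identify the two positions, and a descent between them would belong to the
    -- descent set, hence lie at ℓ or m.
    ascent : ∀ {x y : P} → index y ≡ suc (index x) → index y ≢ ℓ → index y ≢ m → Φ x < Φ y
    ascent {x} {y} eq ≢ℓ ≢m with ℕₚ.<-cmp (Φ x) (Φ y)
    ... | tri< Φx<Φy _ _ = Φx<Φy
    ... | tri≈ _ Φx≡Φy _ with valueAt-injective π {x} {y} Φx≡Φy
    ...   | refl = contradiction eq (ℕₚ.<⇒≢ ℕₚ.≤-refl)
    ascent {x} {y} eq ≢ℓ ≢m | tri> _ _ Φy<Φx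
      with Equivalence.to (des (index y)) (isDescent {x} {y} (sym eq) refl Φy<Φx)
    ... | here ≡ℓ         = contradiction ≡ℓ ≢ℓ
    ... | there (here ≡m) = contradiction ≡m ≢m
    descentAt : ∀ {x y : P} {j} → j ∈ ℓ ∷ m ∷ [] → suc (index x) ≡ j → index y ≡ j → Φ y < Φ x
    descentAt {x} {y} j∈I x↦j y↦j with Equivalence.from (des _) j∈I
    ... | u , v , u↦j , v↦j , πv<πu = subst₂ (λ s t → π ⟨$⟩ʳ s Fin.< π ⟨$⟩ʳ t)
      (Finₚ.toℕ-injective (trans v↦j (sym (trans (toℕ-place y) y↦j))))
      (Finₚ.toℕ-injective (ℕₚ.suc-injective (trans u↦j (sym (trans (cong suc (toℕ-place x)) x↦j)))))
      πv<πu

  shape⇒numbering : Shape Φ → Numbering 0 (suc p + (suc q + suc r)) Φ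
  shape⇒numbering sh = record
    { injective = valueAt-injective π
    ; monotone  = Shape.monotone sh
    ; lower     = λ _ → z≤n
    ; upper     = λ x → Finₚ.toℕ<n (π ⟨$⟩ʳ place x)
    ; onto      = λ v _ v<n → unplace (π ⟨$⟩ˡ Fin.fromℕ< v<n)
        , trans (cong (toℕ ∘ (π ⟨$⟩ʳ_)) (place-unplace {suc p} {suc q} {suc r} (π ⟨$⟩ˡ Fin.fromℕ< v<n)))
            (trans (cong toℕ (Perm.inverseʳ π)) (Finₚ.toℕ-fromℕ< v<n))
    }

perm : Word p q r → Permutation′ (p + (q + r))
perm {p} {q} {r} w = Perm.permutation to from to-from from-to
  where
  to : Fin (p + (q + r)) → Fin (p + (q + r))
  to i = cast (size≡ w) (val w (unplace i))
  from : Fin (p + (q + r)) → Fin (p + (q + r))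
  from v = place (pos w (cast (sym (size≡ w)) v))
  to-from : ∀ v → to (from v) ≡ v
  to-from v = trans (cong (cast (size≡ w))
      (trans (cong (val w) (unplace-place (pos w _))) (val-pos w _)))
    (Finₚ.cast-involutive (size≡ w) (sym (size≡ w)) v)
  from-to : ∀ i → from (to i) ≡ i
  from-to i = trans (cong (place ∘ pos w) (Finₚ.cast-involutive (sym (size≡ w)) (size≡ w) (val w (unplace i))))
    (trans (cong place (pos-val w (unplace i))) (place-unplace {p} {q} {r} i))

valueAt-perm : (w : Word p q r) (x : Pos p q r) → valueAt (perm w) x ≡ valℕ w x
valueAt-perm w x = trans (Finₚ.toℕ-cast (size≡ w) (val w (unplace (place x)))) (cong (valℕ w) (unplace-place x))

-- There is a descent across the first border when the least value of block B is below the greatest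
-- value of block A. So the scan stops at the first B and asks whether any A is still to come; `p`
-- is the number of those left. `CbeforeB` treats the second border in the same way.
BbeforeA : Word p q r → Bool
BbeforeA []        = false
BbeforeA (A w)     = BbeforeA w
BbeforeA {p} (B w) = 0 <ᵇ p
BbeforeA (C w)     = BbeforeA w

CbeforeB : Word p q r → Bool
CbeforeB []              = false
CbeforeB (A w)           = CbeforeB w
CbeforeB (B w)           = CbeforeB w
CbeforeB {p} {q} (C w)   = 0 <ᵇ q

BbeforeA-noA : (w : Word 0 q r) → BbeforeA w ≡ false
BbeforeA-noA []    = refl
BbeforeA-noA (B w) = refl
BbeforeA-noA (C w) = BbeforeA-noA w

CbeforeB-noB : (w : Word p 0 r) → CbeforeB w ≡ false
CbeforeB-noB []    = refl
CbeforeB-noB (A w) = CbeforeB-noB w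
CbeforeB-noB (C w) = refl

BbeforeA⇒descent : (w : Word (suc p) (suc q) r) → T (BbeforeA w) →
                   valℕ w (inB zero) < valℕ w (inA (last p))
BbeforeA⇒descent {zero}  (A w) t rewrite BbeforeA-noA w = ⊥-elim t
BbeforeA⇒descent {suc p} (A w) t = s≤s (BbeforeA⇒descent w t)
BbeforeA⇒descent (B w) t = s≤s z≤n
BbeforeA⇒descent (C w) t = s≤s (BbeforeA⇒descent w t)

descent⇒BbeforeA : (w : Word (suc p) (suc q) r) →
                   valℕ w (inB zero) < valℕ w (inA (last p)) → T (BbeforeA w)
descent⇒BbeforeA {suc p} (A w) (s≤s h) = descent⇒BbeforeA w h
descent⇒BbeforeA (B w) h = _
descent⇒BbeforeA (C w) (s≤s h) = descent⇒BbeforeA w h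

CbeforeB⇒descent : (w : Word p (suc q) (suc r)) → T (CbeforeB w) →
                   valℕ w (inC zero) < valℕ w (inB (last q))
CbeforeB⇒descent (A w) t = s≤s (CbeforeB⇒descent w t)
CbeforeB⇒descent {q = zero}  (B w) t rewrite CbeforeB-noB w = ⊥-elim t
CbeforeB⇒descent {q = suc q} (B w) t = s≤s (CbeforeB⇒descent w t)
CbeforeB⇒descent (C w) t = s≤s z≤n

descent⇒CbeforeB : (w : Word p (suc q) (suc r)) →
                   valℕ w (inC zero) < valℕ w (inB (last q)) → T (CbeforeB w)
descent⇒CbeforeB (A w) (s≤s h) = descent⇒CbeforeB w h
descent⇒CbeforeB {q = suc q} (B w) (s≤s h) = descent⇒CbeforeB w h
descent⇒CbeforeB (C w) h = _

Shapely : Word p q r → Bool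
Shapely w = BbeforeA w ∧ CbeforeB w

-- Enumeration of words

words   : ∀ p q r → List (Word p q r)
words[] : ∀ p q r → List (Word p q r)
wordsA  : ∀ p q r → List (Word p q r)
wordsB  : ∀ p q r → List (Word p q r)
wordsC  : ∀ p q r → List (Word p q r)

words p q r = words[] p q r ++ wordsA p q r ++ wordsB p q r ++ wordsC p q r

words[] zero    zero    zero    = [] ∷ []
words[] zero    zero    (suc _) = []
words[] zero    (suc _) _       = []
words[] (suc _) _       _       = []

wordsA zero    q r = []
wordsA (suc p) q r = map A_ (words p q r)

wordsB p zero    r = []
wordsB p (suc q) r = map B_ (words p q r)

wordsC p q zero    = []
wordsC p q (suc r) = map C_ (words p q r)

words-complete : (w : Word p q r) → w ∈ words p q r
words-complete []    = here refl
words-complete {suc p} {q} {r} (A w) = ∈-++⁺ˡ (∈-map⁺ A_ (words-complete w))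
words-complete {p} {suc q} {r} (B w) = ∈-++⁺ʳ (words[] p (suc q) r) (∈-++⁺ʳ (wordsA p (suc q) r)
  (∈-++⁺ˡ (∈-map⁺ B_ (words-complete w))))
words-complete {p} {q} {suc r} (C w) = ∈-++⁺ʳ (words[] p q (suc r)) (∈-++⁺ʳ (wordsA p q (suc r))
  (∈-++⁺ʳ (wordsB p q (suc r)) (∈-map⁺ C_ (words-complete w))))

-- A tag that tells the four parts of `words` apart, which gives their disjointness.
head : Word p q r → Fin 4
head []    = zero
head (A _) = suc zero
head (B _) = suc (suc zero)
head (C _) = suc (suc (suc zero))

head-[] : ∀ p q r {w} → w ∈ words[] p q r → head w ≡ zero
head-[] zero zero zero (here refl) = refl

head-A : ∀ p q r {w} → w ∈ wordsA p q r → head w ≡ suc zero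
head-A (suc p) q r w∈ with _ , _ , refl ← ∈-map⁻ A_ w∈ = refl

head-B : ∀ p q r {w} → w ∈ wordsB p q r → head w ≡ suc (suc zero)
head-B p (suc q) r w∈ with _ , _ , refl ← ∈-map⁻ B_ w∈ = refl

head-C : ∀ p q r {w} → w ∈ wordsC p q r → head w ≡ suc (suc (suc zero))
head-C p q (suc r) w∈ with _ , _ , refl ← ∈-map⁻ C_ w∈ = refl

words-unique   : ∀ p q r → Unique (words p q r)
words[]-unique : ∀ p q r → Unique (words[] p q r)
wordsA-unique  : ∀ p q r → Unique (wordsA p q r)
wordsB-unique  : ∀ p q r → Unique (wordsB p q r)
wordsC-unique  : ∀ p q r → Unique (wordsC p q r)

words-unique p q r =
  Unique.++⁺ (words[]-unique p q r) (Unique.++⁺ (wordsA-unique p q r)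
    (Unique.++⁺ (wordsB-unique p q r) (wordsC-unique p q r) B#C) A#BC) []#ABC
  where
  B#C : ∀ {w} → ¬ (w ∈ wordsB p q r × w ∈ wordsC p q r)
  B#C (w∈B , w∈C) with () ← trans (sym (head-B p q r w∈B)) (head-C p q r w∈C)
  A#BC : ∀ {w} → ¬ (w ∈ wordsA p q r × w ∈ wordsB p q r ++ wordsC p q r)
  A#BC (w∈A , w∈) with ∈-++⁻ (wordsB p q r) w∈
  ... | inj₁ w∈B with () ← trans (sym (head-A p q r w∈A)) (head-B p q r w∈B)
  ... | inj₂ w∈C with () ← trans (sym (head-A p q r w∈A)) (head-C p q r w∈C)
  []#ABC : ∀ {w} → ¬ (w ∈ words[] p q r × w ∈ wordsA p q r ++ wordsB p q r ++ wordsC p q r)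
  []#ABC (w∈[] , w∈) with ∈-++⁻ (wordsA p q r) w∈
  ... | inj₁ w∈A with () ← trans (sym (head-[] p q r w∈[])) (head-A p q r w∈A)
  ... | inj₂ w∈′ with ∈-++⁻ (wordsB p q r) w∈′
  ... | inj₁ w∈B with () ← trans (sym (head-[] p q r w∈[])) (head-B p q r w∈B)
  ... | inj₂ w∈C with () ← trans (sym (head-[] p q r w∈[])) (head-C p q r w∈C)

words[]-unique zero    zero    zero    = [] ∷ []
words[]-unique zero    zero    (suc _) = []
words[]-unique zero    (suc _) _       = []
words[]-unique (suc _) _       _       = []

wordsA-unique zero    q r = []
wordsA-unique (suc p) q r = Unique.map⁺ (λ { refl → refl }) (words-unique p q r)

wordsB-unique p zero    r = []
wordsB-unique p (suc q) r = Unique.map⁺ (λ { refl → refl }) (words-unique p q r)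

wordsC-unique p q zero    = []
wordsC-unique p q (suc r) = Unique.map⁺ (λ { refl → refl }) (words-unique p q r)

# : {X : Set} → (X → Bool) → List X → ℕ
# f xs = length (filterᵇ f xs)

lookup-injective : {X : Set} {xs : List X} → Unique xs → ∀ {i j} → lookup xs i ≡ lookup xs j → i ≡ j
lookup-injective (_ ∷ _)   {zero}  {zero}  _  = refl
lookup-injective (x∉ ∷ _)  {zero}  {suc j} eq = contradiction eq (All.lookup x∉ (∈-lookup j))
lookup-injective (x∉ ∷ _)  {suc i} {zero}  eq = contradiction (sym eq) (All.lookup x∉ (∈-lookup i))
lookup-injective (_ ∷ uxs) {suc i} {suc j} eq = cong suc (lookup-injective uxs eq)

index-injective : {X : Set} {xs : List X} {x y : X} (x∈ : x ∈ xs) (y∈ : y ∈ xs) →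
                  Any.index x∈ ≡ Any.index y∈ → x ≡ y
index-injective {xs = xs} x∈ y∈ eq = trans (Anyₚ.lookup-index x∈) (trans (cong (lookup xs) eq) (sym (Anyₚ.lookup-index y∈)))

module _ (p q r : ℕ) where
  private
    ℓ = suc p
    m = suc p + suc q
    n = suc p + (suc q + suc r)
    I : List ℕ
    I = ℓ ∷ m ∷ []
    ws = filterᵇ (Shapely {suc p} {suc q} {suc r}) (words (suc p) (suc q) (suc r))

  word⇒class : (w : Word (suc p) (suc q) (suc r)) → T (Shapely w) → HasDescentSet I (perm w)
  word⇒class w t = shape⇒descentSet (perm w) record
    { monotone = λ {x} {y} x≺y → subst₂ _<_ (sym (valueAt-perm w x)) (sym (valueAt-perm w y)) (val-mono w x≺y)
    ; descent₁ = subst₂ _<_ (sym (valueAt-perm w (inB zero))) (sym (valueAt-perm w (inA (last p))))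
        (BbeforeA⇒descent w (proj₁ ts))
    ; descent₂ = subst₂ _<_ (sym (valueAt-perm w (inC zero))) (sym (valueAt-perm w (inB (last q))))
        (CbeforeB⇒descent w (proj₂ ts))
    }
    where ts = Equivalence.to (T-∧ {BbeforeA w}) t

  class⇒word : (π : Permutation′ n) → HasDescentSet I π →
               ∃[ w ] (T (Shapely {suc p} {suc q} {suc r} w) × ∀ x → valueAt π x ≡ valℕ w x)
  class⇒word π des =
    w , Equivalence.from (T-∧ {BbeforeA w})
          ( descent⇒BbeforeA w (subst₂ _<_ (h _) (h _) (Shape.descent₁ sh))
          , descent⇒CbeforeB w (subst₂ _<_ (h _) (h _) (Shape.descent₂ sh)) )
      , h
    where
    sh = descentSet⇒shape {p} {q} {r} π des
    wh = numbering⇒word n 0 (valueAt π) (shape⇒numbering {p} {q} {r} π sh)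
    w = proj₁ wh
    h = proj₂ wh

  -- Injections in both directions suffice, by antisymmetry. Members of the class are compared as
  -- functions only, so different proofs of `HasDescentSet` never have to be identified.
  descentClass-card : ∀ {N} → HasCardinality (DescentClass I n) N → N ≡ length ws
  descentClass-card {N} card = ℕₚ.≤-antisym (Finₚ.injective⇒≤ f-injective) (Finₚ.injective⇒≤ g-injective)
    where
    open Inverse {To = DescentClass I n} card using () renaming (to to class; from to class⁻¹; from-cong to class⁻¹-cong; inverseˡ to invˡ; inverseʳ to invʳ)
    wordOf : ∀ i → ∃[ w ] (T (Shapely w) × ∀ x → valueAt (proj₁ (class i)) x ≡ valℕ w x)
    wordOf i = class⇒word (proj₁ (class i)) (proj₂ (class i))
    wordOf∈ : ∀ i → proj₁ (wordOf i) ∈ ws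
    wordOf∈ i = ∈-filter⁺ (T? ∘ Shapely) (words-complete _) (proj₁ (proj₂ (wordOf i)))
    f : Fin N → Fin (length ws)
    f i = Any.index (wordOf∈ i)
    f-injective : ∀ {i j} → f i ≡ f j → i ≡ j
    f-injective {i} {j} eq = trans (sym (invʳ {i} {class i} (λ _ → refl)))
      (trans (class⁻¹-cong {class i} {class j} same) (invʳ {j} {class j} (λ _ → refl)))
      where
      w≡ : proj₁ (wordOf i) ≡ proj₁ (wordOf j)
      w≡ = index-injective (wordOf∈ i) (wordOf∈ j) eq
      same : ∀ k → proj₁ (class i) ⟨$⟩ʳ k ≡ proj₁ (class j) ⟨$⟩ʳ k
      same k = Finₚ.toℕ-injective (subst (λ k → toℕ (proj₁ (class i) ⟨$⟩ʳ k) ≡ toℕ (proj₁ (class j) ⟨$⟩ʳ k))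
        (place-unplace {suc p} {suc q} {suc r} k)
        (trans (proj₂ (proj₂ (wordOf i)) (unplace k))
          (trans (cong (λ w → valℕ w (unplace k)) w≡) (sym (proj₂ (proj₂ (wordOf j)) (unplace k))))))
    shapely : ∀ i → T (Shapely (lookup ws i))
    shapely i = proj₂ (∈-filter⁻ (T? ∘ Shapely) {xs = words (suc p) (suc q) (suc r)} (∈-lookup i))
    ρ : Fin (length ws) → Σ (Permutation′ n) (HasDescentSet I)
    ρ i = perm (lookup ws i) , word⇒class (lookup ws i) (shapely i)
    g : Fin (length ws) → Fin N
    g i = class⁻¹ (ρ i)
    g-injective : ∀ {i j} → g i ≡ g j → i ≡ j
    g-injective {i} {j} eq = lookup-injective (Unique.filter⁺ (T? ∘ Shapely) (words-unique (suc p) (suc q) (suc r)))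
      (valℕ-injective _ _ λ x → trans (sym (valueAt-perm (lookup ws i) x))
        (trans (cong toℕ (same (place x))) (valueAt-perm (lookup ws j) x)))
      where
      same : ∀ k → perm (lookup ws i) ⟨$⟩ʳ k ≡ perm (lookup ws j) ⟨$⟩ʳ k
      same k = trans (sym (invˡ {ρ i} {g i} refl k)) (invˡ {ρ j} {g i} eq k)

-- Counting words by inclusion-exclusion

module _ {X : Set} where

  #-++ : ∀ f (xs ys : List X) → # f (xs ++ ys) ≡ # f xs + # f ys
  #-++ f xs ys = trans (cong length (filter-++ (T? ∘ f) xs ys)) (length-++ (filterᵇ f xs))

  #-cong : ∀ {f g : X → Bool} (xs : List X) → (∀ x → f x ≡ g x) → # f xs ≡ # g xs
  #-cong []       f≗g = refl
  #-cong {f} {g} (x ∷ xs) f≗g with f x | g x | f≗g x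
  ... | true  | _ | refl = cong suc (#-cong xs f≗g)
  ... | false | _ | refl = #-cong xs f≗g

  #-false : ∀ (xs : List X) → # (const false) xs ≡ 0
  #-false []       = refl
  #-false (x ∷ xs) = #-false xs

  #-map : ∀ {Y : Set} f (g : Y → X) (ys : List Y) → # f (map g ys) ≡ # (f ∘ g) ys
  #-map f g []       = refl
  #-map f g (y ∷ ys) with f (g y)
  ... | true  = cong suc (#-map f g ys)
  ... | false = #-map f g ys

  #-inclusion-exclusion : ∀ (f g : X → Bool) (xs : List X) →
    # (λ x → f x ∧ g x) xs + (# (not ∘ f) xs + # (not ∘ g) xs)
      ≡ # (const true) xs + # (λ x → not (f x) ∧ not (g x)) xs
  #-inclusion-exclusion f g []       = refl
  #-inclusion-exclusion f g (x ∷ xs) with f x | g x | #-inclusion-exclusion f g xs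
  ... | true  | true  | ih = cong suc ih
  ... | true  | false | ih = trans (cong (k +_) (ℕₚ.+-suc l m)) (trans (ℕₚ.+-suc k (l + m)) (cong suc ih))
    where k = # (λ x → f x ∧ g x) xs ; l = # (not ∘ f) xs ; m = # (not ∘ g) xs
  ... | false | true  | ih = trans (ℕₚ.+-suc k (l + m)) (cong suc ih)
    where k = # (λ x → f x ∧ g x) xs ; l = # (not ∘ f) xs ; m = # (not ∘ g) xs
  -- An element with neither property counts twice on both sides.
  ... | false | false | ih = trans (shift k l m) (trans (cong (2 +_) ih) (cong suc (sym (ℕₚ.+-suc (# (const true) xs) _))))
    where
    k = # (λ x → f x ∧ g x) xs ; l = # (not ∘ f) xs ; m = # (not ∘ g) xs
    shift : ∀ k l m → k + (suc l + suc m) ≡ suc (suc (k + (l + m)))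
    shift = solve-∀

#-words : ∀ p q r {t} (f : Word p q r → Bool) → p + (q + r) ≡ suc t →
          # f (words p q r) ≡ # f (wordsA p q r) + (# f (wordsB p q r) + # f (wordsC p q r))
#-words p q r f eq = begin
  # f (words[] p q r ++ wordsA p q r ++ wordsB p q r ++ wordsC p q r)
    ≡⟨ cong (λ ws → # f (ws ++ wordsA p q r ++ wordsB p q r ++ wordsC p q r)) (noEmptyWord p q r eq) ⟩
  # f (wordsA p q r ++ wordsB p q r ++ wordsC p q r)
    ≡⟨ #-++ f (wordsA p q r) _ ⟩
  # f (wordsA p q r) + # f (wordsB p q r ++ wordsC p q r)
    ≡⟨ cong (# f (wordsA p q r) +_) (#-++ f (wordsB p q r) _) ⟩
  # f (wordsA p q r) + (# f (wordsB p q r) + # f (wordsC p q r)) ∎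
  where
  open ≡-Reasoning
  noEmptyWord : ∀ p q r {t} → p + (q + r) ≡ suc t → words[] p q r ≡ []
  noEmptyWord zero    zero    (suc _) _ = refl
  noEmptyWord zero    (suc _) _       _ = refl
  noEmptyWord (suc _) _       _       _ = refl

*-congˡ-trans : ∀ {x y D z} → x ≡ y → y * D ≡ z → x * D ≡ z
*-congˡ-trans refl eq = eq

-- The common step of the following counts: words are classified by their first letter, and the
-- three weights `u`, `v`, `w` add up to the new factor of the factorial.
distribute : ∀ x y z D u v w t {s} → s ≡ x + (y + z) →
             x * D ≡ u * t → y * D ≡ v * t → z * D ≡ w * t → s * D ≡ (u + (v + w)) * t
distribute x y z D u v w t {s} s≡ x≡ y≡ z≡ = begin
  s * D                   ≡⟨ cong (_* D) s≡ ⟩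
  (x + (y + z)) * D       ≡⟨ spread x y z D ⟩
  x * D + (y * D + z * D) ≡⟨ cong₂ _+_ x≡ (cong₂ _+_ y≡ z≡) ⟩
  u * t + (v * t + w * t) ≡⟨ spread u v w t ⟨
  (u + (v + w)) * t       ∎
  where
  open ≡-Reasoning
  spread : ∀ x y z D → (x + (y + z)) * D ≡ x * D + (y * D + z * D)
  spread = solve-∀

-- The multinomial coefficient with its denominator cleared. The words that begin with A contribute
-- p · t!, because p! = p · (p - 1)!, and likewise for B and C.
count-all : ∀ t p q r → p + (q + r) ≡ t → # (const true) (words p q r) * (p ! * (q ! * r !)) ≡ t !
count-all zero    zero zero zero refl = refl
count-all (suc t) p q r eq =
  trans (distribute (# ⊤ (wordsA p q r)) (# ⊤ (wordsB p q r)) (# ⊤ (wordsC p q r)) (p ! * (q ! * r !))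
          p q r (t !) (#-words p q r ⊤ eq) (partA p q r eq) (partB p q r eq) (partC p q r eq))
    (cong (_* t !) eq)
  where
  ⊤ : {X : Set} → X → Bool
  ⊤ _ = true
  partA : ∀ p q r → p + (q + r) ≡ suc t → # ⊤ (wordsA p q r) * (p ! * (q ! * r !)) ≡ p * t !
  partA zero    q r _  = refl
  partA (suc p) q r eq = *-congˡ-trans (#-map ⊤ A_ (words p q r))
    (trans (extract (# ⊤ (words p q r)) (suc p) (p !) (q ! * r !))
      (cong (suc p *_) (count-all t p q r (ℕₚ.suc-injective eq))))
    where
    extract : ∀ x s u v → x * ((s * u) * v) ≡ s * (x * (u * v))
    extract = solve-∀
  partB : ∀ p q r → p + (q + r) ≡ suc t → # ⊤ (wordsB p q r) * (p ! * (q ! * r !)) ≡ q * t !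
  partB p zero    r _  = refl
  partB p (suc q) r eq = *-congˡ-trans (#-map ⊤ B_ (words p q r))
    (trans (extract (# ⊤ (words p q r)) (p !) (suc q) (q !) (r !))
      (cong (suc q *_) (count-all t p q r (ℕₚ.suc-injective (trans (sym (ℕₚ.+-suc p (q + r))) eq)))))
    where
    extract : ∀ x u s v w → x * (u * ((s * v) * w)) ≡ s * (x * (u * (v * w)))
    extract = solve-∀
  partC : ∀ p q r → p + (q + r) ≡ suc t → # ⊤ (wordsC p q r) * (p ! * (q ! * r !)) ≡ r * t !
  partC p q zero    _  = refl
  partC p q (suc r) eq = *-congˡ-trans (#-map ⊤ C_ (words p q r))
    (trans (extract (# ⊤ (words p q r)) (p !) (q !) (suc r) (r !))
      (cong (suc r *_) (count-all t p q r (ℕₚ.suc-injective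
        (trans (sym (trans (cong (p +_) (ℕₚ.+-suc q r)) (ℕₚ.+-suc p (q + r)))) eq)))))
    where
    extract : ∀ x u v s w → x * (u * (v * (s * w))) ≡ s * (x * (u * (v * w)))
    extract = solve-∀

-- With no B before an A, only the places of the letters C are free. While some A is left, no such
-- word begins with B, so A takes the whole weight p + q; once no A is left, every word qualifies.
count-¬BbeforeA : ∀ t p q r → p + (q + r) ≡ t →
                  # (not ∘ BbeforeA) (words p q r) * ((p + q) ! * r !) ≡ t !
count-¬BbeforeA t zero q r eq =
  trans (cong₂ _*_ (#-cong (words 0 q r) (cong not ∘ BbeforeA-noA)) (sym (ℕₚ.*-identityˡ (q ! * r !))))
    (count-all t 0 q r eq)
count-¬BbeforeA (suc t) (suc p) q r eq =
  trans (distribute (# f (wordsA (suc p) q r)) (# f (wordsB (suc p) q r)) (# f (wordsC (suc p) q r))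
          ((suc p + q) ! * r !) (suc p + q) 0 r (t !)
          (#-words (suc p) q r f eq) partA (partB q) (partC r eq))
    (cong (_* t !) (trans (ℕₚ.+-assoc (suc p) q r) eq))
  where
  f : Word p′ q′ r′ → Bool
  f = not ∘ BbeforeA
  partA : # f (wordsA (suc p) q r) * ((suc p + q) ! * r !) ≡ (suc p + q) * t !
  partA = *-congˡ-trans (#-map f A_ (words p q r))
    (trans (extract (# f (words p q r)) (suc p + q) ((p + q) !) (r !))
      (cong ((suc p + q) *_) (count-¬BbeforeA t p q r (ℕₚ.suc-injective eq))))
    where
    extract : ∀ x s u v → x * ((s * u) * v) ≡ s * (x * (u * v))
    extract = solve-∀
  partB : ∀ q {D} → # f (wordsB (suc p) q r) * D ≡ 0
  partB zero    = refl
  partB (suc q) = *-congˡ-trans (trans (#-map f B_ (words (suc p) q r)) (#-false (words (suc p) q r))) refl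
  partC : ∀ r → suc p + (q + r) ≡ suc t → # f (wordsC (suc p) q r) * ((suc p + q) ! * r !) ≡ r * t !
  partC zero    _  = refl
  partC (suc r) eq = *-congˡ-trans (#-map f C_ (words (suc p) q r))
    (trans (extract (# f (words (suc p) q r)) ((suc p + q) !) (suc r) (r !))
      (cong (suc r *_) (count-¬BbeforeA t (suc p) q r (ℕₚ.suc-injective
        (trans (sym (trans (cong (suc p +_) (ℕₚ.+-suc q r)) (ℕₚ.+-suc (suc p) (q + r)))) eq)))))
    where
    extract : ∀ x u s v → x * (u * (s * v)) ≡ s * (x * (u * v))
    extract = solve-∀

-- Here only the places of the letters A are free: while some B is left, C cannot come first and B
-- takes the weight q + r.
count-¬CbeforeB : ∀ t p q r → p + (q + r) ≡ t →
                  # (not ∘ CbeforeB) (words p q r) * (p ! * (q + r) !) ≡ t !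
count-¬CbeforeB t p zero r eq =
  trans (cong₂ _*_ (#-cong (words p 0 r) (cong not ∘ CbeforeB-noB)) (cong (p ! *_) (sym (ℕₚ.*-identityˡ (r !)))))
    (count-all t p 0 r eq)
count-¬CbeforeB zero    zero    (suc q) r ()
count-¬CbeforeB zero    (suc p) (suc q) r ()
count-¬CbeforeB (suc t) p (suc q) r eq =
  trans (distribute (# f (wordsA p (suc q) r)) (# f (wordsB p (suc q) r)) (# f (wordsC p (suc q) r))
          (p ! * (suc q + r) !) p (suc q + r) 0 (t !)
          (#-words p (suc q) r f eq) (partA p eq) partB (partC r))
    (cong (_* t !) (trans (cong (p +_) (ℕₚ.+-identityʳ (suc q + r))) eq))
  where
  f : Word p′ q′ r′ → Bool
  f = not ∘ CbeforeB
  partA : ∀ p → p + (suc q + r) ≡ suc t → # f (wordsA p (suc q) r) * (p ! * (suc q + r) !) ≡ p * t !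
  partA zero    _  = refl
  partA (suc p) eq = *-congˡ-trans (#-map f A_ (words p (suc q) r))
    (trans (extract (# f (words p (suc q) r)) (suc p) (p !) ((suc q + r) !))
      (cong (suc p *_) (count-¬CbeforeB t p (suc q) r (ℕₚ.suc-injective eq))))
    where
    extract : ∀ x s u v → x * ((s * u) * v) ≡ s * (x * (u * v))
    extract = solve-∀
  partB : # f (wordsB p (suc q) r) * (p ! * (suc q + r) !) ≡ (suc q + r) * t !
  partB = *-congˡ-trans (#-map f B_ (words p q r))
    (trans (extract (# f (words p q r)) (p !) (suc q + r) ((q + r) !))
      (cong ((suc q + r) *_) (count-¬CbeforeB t p q r (ℕₚ.suc-injective (trans (sym (ℕₚ.+-suc p (q + r))) eq)))))
    where
    extract : ∀ x u s v → x * (u * (s * v)) ≡ s * (x * (u * v))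
    extract = solve-∀
  partC : ∀ r {D} → # f (wordsC p (suc q) r) * D ≡ 0
  partC zero    = refl
  partC (suc r) = *-congˡ-trans (trans (#-map f C_ (words p (suc q) r)) (#-false (words p (suc q) r))) refl

Sorted : Word p q r → Bool
Sorted w = not (BbeforeA w) ∧ not (CbeforeB w)

count-Sorted-C : ∀ p q r → # Sorted (wordsC p (suc q) r) ≡ 0
count-Sorted-C p q zero    = refl
count-Sorted-C p q (suc r) = trans (#-map Sorted C_ (words p (suc q) r))
  (trans (#-cong (words p (suc q) r) (λ w → ∧-zeroʳ (not (BbeforeA w)))) (#-false (words p (suc q) r)))

-- The only such word is A...AB...BC...C. The presence of a B matters: without one, the letters A
-- and C could be interleaved freely.
count-Sorted : ∀ p q r → # Sorted (words p (suc q) r) ≡ 1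
count-Sorted zero q r = begin
  # Sorted (words 0 (suc q) r)
    ≡⟨ #-words 0 (suc q) r Sorted refl ⟩
  # Sorted (map B_ (words 0 q r)) + # Sorted (wordsC 0 (suc q) r)
    ≡⟨ cong₂ _+_ (trans (#-map Sorted B_ (words 0 q r)) (partB q)) (count-Sorted-C 0 q r) ⟩
  1 ∎
  where
  open ≡-Reasoning
  onlyC : ∀ r → # (not ∘ CbeforeB) (words 0 0 r) ≡ 1
  onlyC zero    = refl
  onlyC (suc r) = trans (#-words 0 0 (suc r) (not ∘ CbeforeB) refl)
    (trans (#-map (not ∘ CbeforeB) C_ (words 0 0 r))
      (trans (#-cong (words 0 0 r) (λ w → sym (cong not (CbeforeB-noB w)))) (onlyC r)))
  partB : ∀ q → # (not ∘ CbeforeB) (words 0 q r) ≡ 1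
  partB zero    = onlyC r
  partB (suc q) = trans (#-cong (words 0 (suc q) r) (λ w → cong (λ t → not t ∧ not (CbeforeB w)) (sym (BbeforeA-noA w))))
    (count-Sorted 0 q r)
count-Sorted (suc p) q r = begin
  # Sorted (words (suc p) (suc q) r)
    ≡⟨ #-words (suc p) (suc q) r Sorted refl ⟩
  # Sorted (map A_ (words p (suc q) r)) + (# Sorted (map B_ (words (suc p) q r)) + # Sorted (wordsC (suc p) (suc q) r))
    ≡⟨ cong₂ _+_ (trans (#-map Sorted A_ (words p (suc q) r)) (count-Sorted p q r))
        (cong₂ _+_ (trans (#-map Sorted B_ (words (suc p) q r)) (#-false (words (suc p) q r)))
          (count-Sorted-C (suc p) q r)) ⟩
  1 ∎
  where open ≡-Reasoning

fall-! : ∀ j r → fall (j + r) j * r ! ≡ (j + r) !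
fall-! zero    r = ℕₚ.*-identityˡ (r !)
fall-! (suc j) r = begin
  fall (suc j + r) j * (suc j + r ℕ.∸ j) * r !
    ≡⟨ cong (λ n → fall n j * (n ℕ.∸ j) * r !) (ℕₚ.+-suc j r) ⟨
  fall (j + suc r) j * (j + suc r ℕ.∸ j) * r !
    ≡⟨ cong (λ s → fall (j + suc r) j * s * r !) (ℕₚ.m+n∸m≡n j (suc r)) ⟩
  fall (j + suc r) j * suc r * r !
    ≡⟨ ℕₚ.*-assoc (fall (j + suc r) j) (suc r) (r !) ⟩
  fall (j + suc r) j * suc r !
    ≡⟨ fall-! j (suc r) ⟩
  (j + suc r) !
    ≡⟨ cong _! (ℕₚ.+-suc j r) ⟩
  (suc j + r) ! ∎
  where open ≡-Reasoning

-- Inclusion-exclusion gives N + C(n,m) + C(n,p) = M + 1, where M is the multinomial coefficient and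
-- 1 counts the sorted word. Multiplying by p! (q + 1)! m! clears all denominators.
count-Shapely : ∀ p q r → let n = p + (suc q + r); m = p + suc q; α = p ! * suc q ! in
  # Shapely (words p (suc q) r) * (α * m !) + α * fall n m + suc q ! * m ! * fall n p
    ≡ m ! * fall n m + α * m !
count-Shapely p q₀ r = begin
  N * (α * m !) + α * fall n m + Q ! * m ! * fall n p
    ≡⟨ cong₂ (λ x y → N * (α * m !) + α * x + Q ! * m ! * y) K≡ K′≡ ⟨
  N * (α * m !) + α * (K * m !) + Q ! * m ! * (K′ * p !)
    ≡⟨ collect N K K′ (p !) (Q !) (m !) ⟩
  (N + (K + K′)) * (α * m !)
    ≡⟨ cong (_* (α * m !)) (trans (#-inclusion-exclusion BbeforeA CbeforeB (words p Q r)) (cong (M +_) (count-Sorted p q₀ r))) ⟩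
  (M + 1) * (α * m !)
    ≡⟨ expand M α (m !) ⟩
  m ! * (M * α) + α * m !
    ≡⟨ cong (λ x → m ! * x + α * m !) M≡ ⟩
  m ! * fall n m + α * m ! ∎
  where
  open ≡-Reasoning
  Q = suc q₀
  n = p + (Q + r)
  m = p + Q
  α = p ! * Q !
  N  = # Shapely (words p Q r)
  M  = # (const true) (words p Q r)
  K  = # (not ∘ BbeforeA) (words p Q r)
  K′ = # (not ∘ CbeforeB) (words p Q r)
  collect : ∀ N K K′ p q m → N * (p * q * m) + p * q * (K * m) + q * m * (K′ * p) ≡ (N + (K + K′)) * (p * q * m)
  collect = solve-∀
  expand : ∀ M α m → (M + 1) * (α * m) ≡ m * (M * α) + α * m
  expand = solve-∀
  regroup : ∀ M p q r → M * (p * q) * r ≡ M * (p * (q * r))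
  regroup = solve-∀
  n! : fall n m * r ! ≡ n !
  n! = subst (λ n → fall n m * r ! ≡ n !) (ℕₚ.+-assoc p Q r) (fall-! m r)
  M≡ : M * α ≡ fall n m
  M≡ = ℕₚ.*-cancelʳ-≡ _ _ (r !) {{r !≢0}}
    (trans (regroup M (p !) (Q !) (r !)) (trans (count-all n p Q r refl) (sym n!)))
  K≡ : K * m ! ≡ fall n m
  K≡ = ℕₚ.*-cancelʳ-≡ _ _ (r !) {{r !≢0}}
    (trans (ℕₚ.*-assoc K (m !) (r !)) (trans (count-¬BbeforeA n p Q r refl) (sym n!)))
  K′≡ : K′ * p ! ≡ fall n p
  K′≡ = ℕₚ.*-cancelʳ-≡ _ _ ((Q + r) !) {{(Q + r) !≢0}}
    (trans (ℕₚ.*-assoc K′ (p !) ((Q + r) !)) (trans (count-¬CbeforeB n p Q r refl) (sym (fall-! p (Q + r)))))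

-- The equation satisfied by a root

module ℂ-interpolation = PolynomialFunctions ℂ-commutativeRing

hornerWith : {X : Set} → (X → X → X) → (X → X → X) → X → List X → X → X
hornerWith _+_ _*_ e p z = foldr (λ a s → a + (z * s)) e p

-- `eval` and `horner` use the transparent and the opaque operations and are not convertible.
-- Abstracting the operations lets the equations between them be matched with `refl`.
hornerWith-cong : ∀ {X : Set} {_+_ _⊞_ _*_ _⊠_ : X → X → X} {e e′} → _+_ ≡ _⊞_ → _*_ ≡ _⊠_ → e ≡ e′ →
                  ∀ p z → hornerWith _+_ _*_ e p z ≡ hornerWith _⊞_ _⊠_ e′ p z
hornerWith-cong refl refl refl p z = refl

eval≡horner : ∀ p z → eval p z ≡ ℂ-interpolation.horner p z
eval≡horner = hornerWith-cong {ℂ} {_+ᶜ_} {_⊕_} {_*ᶜ_} {_⊗_} {0ᶜ} {ν 0} +ᶜ≡⊕ *ᶜ≡⊗ (ν-unfold 0)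

fallingᶜ : ℕ → ℂ → ℂ
fallingᶜ = ℂ-interpolation.falling ν ν-+ ν-* ν-inverse

-- For ℓ = p + 1 and m = p + q + 2 this is C(m,ℓ) ≥ m with denominators cleared.
fact-bound : ∀ p q → suc p ! ℕ.* suc q ! ℕ.≤ (p ℕ.+ suc q) !
fact-bound p zero    = ℕₚ.≤-reflexive (trans (ℕₚ.*-identityʳ (suc p !)) (cong _! (ℕₚ.+-comm 1 p)))
fact-bound p (suc q) = begin
  suc p ! ℕ.* (suc (suc q) ℕ.* suc q !)       ≡⟨ swap (suc p !) (suc (suc q)) (suc q !) ⟩
  suc (suc q) ℕ.* (suc p ! ℕ.* suc q !)       ≤⟨ ℕₚ.*-mono-≤ (s≤s (ℕₚ.m≤n+m (suc q) p)) (fact-bound p q) ⟩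
  suc (p ℕ.+ suc q) ℕ.* (p ℕ.+ suc q) !       ≡⟨ cong _! (ℕₚ.+-suc p (suc q)) ⟨
  (p ℕ.+ suc (suc q)) !                       ∎
  where
  open ℕₚ.≤-Reasoning
  swap : ∀ x y z → x ℕ.* (y ℕ.* z) ≡ y ℕ.* (x ℕ.* z)
  swap = solve-∀

module Coefficients (p q : ℕ) where
  -- With ℓ = p + 1 and m = m′ + 1, the quotients are β/δ = (C(m,ℓ) - 1)/m! and γ/δ = 1/ℓ!, the
  -- coefficients of the falling factorials in the formula for d.
  m′ α β γ δ : ℕ
  m′ = p ℕ.+ suc q
  α = suc p ! ℕ.* suc q !
  β = suc m′ ! ℕ.∸ α
  γ = suc q ! ℕ.* suc m′ !
  δ = α ℕ.* suc m′ !

  m′α≤β : m′ ℕ.* α ℕ.≤ β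
  m′α≤β = ℕₚ.≤-trans (ℕₚ.≤-reflexive (sym (ℕₚ.m+n∸m≡n α (m′ ℕ.* α))))
    (ℕₚ.∸-monoˡ-≤ α (ℕₚ.*-monoʳ-≤ (suc m′) (fact-bound p q)))

  α+β≡m! : α ℕ.+ β ≡ suc m′ !
  α+β≡m! = ℕₚ.m+[n∸m]≡n (ℕₚ.≤-trans (ℕₚ.m≤m+n α (m′ ℕ.* α)) (ℕₚ.*-monoʳ-≤ (suc m′) (fact-bound p q)))

  module _ (d : Polynomial) (isDescent : IsDescentPolynomial (suc p ∷ suc m′ ∷ []) d) where

    private
      below : ∀ r → max 0 (suc p ∷ suc m′ ∷ []) ℕ.< suc (suc m′) ℕ.+ r
      below r = max<v⁺ {xs = suc p ∷ suc m′ ∷ []} (s≤s z≤n)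
        (s≤s (ℕₚ.≤-trans (ℕₚ.m<m+n p (s≤s z≤n)) (ℕₚ.m≤n⇒m≤1+n (ℕₚ.m≤m+n m′ r)))
          ∷ s≤s (s≤s (ℕₚ.m≤m+n m′ r)) ∷ [])

      N : ℕ → ℕ
      N r = proj₁ (isDescent (suc (suc m′) ℕ.+ r) (below r))

      horner≃N : ∀ r → ℂ-interpolation.horner d (ν (suc (suc m′) ℕ.+ r)) ≃ ν (N r)
      horner≃N r = subst₂ _≃_
        (trans (cong (eval d) (ν-unfold n)) (eval≡horner d (ν n))) (ν-unfold (N r))
        (≈ᶜ⇒≃ {eval d (natᶜ n)} {natᶜ (N r)} (proj₂ (proj₂ (isDescent n (below r)))))
        where
        n : ℕ
        n = suc (suc m′) ℕ.+ r

      n≡ : ∀ r → suc p ℕ.+ (suc q ℕ.+ suc r) ≡ suc (suc m′) ℕ.+ r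
      n≡ r = trans (sym (ℕₚ.+-assoc (suc p) (suc q) (suc r))) (ℕₚ.+-suc (suc m′) r)

      N≡ : ∀ r → N r ≡ # Shapely (words (suc p) (suc q) (suc r))
      N≡ r = descentClass-card p q r (subst (λ n → HasCardinality (DescentClass (suc p ∷ suc m′ ∷ []) n) (N r))
        (sym (n≡ r)) (proj₁ (proj₂ (isDescent (suc (suc m′) ℕ.+ r) (below r)))))

      relation : ∀ r → let n = suc (suc m′) ℕ.+ r in
        δ ℕ.* N r ℕ.+ γ ℕ.* fall n (suc p) ≡ β ℕ.* fall n (suc m′) ℕ.+ δ
      -- `count-Shapely` has α F on the left and m! F on the right; cancelling α F leaves β F.
      relation r = ℕₚ.+-cancelˡ-≡ (α ℕ.* F) _ _ (begin
        α ℕ.* F ℕ.+ (δ ℕ.* N r ℕ.+ γ ℕ.* L)   ≡⟨ shuffle (N r) δ (α ℕ.* F) (γ ℕ.* L) ⟩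
        N r ℕ.* δ ℕ.+ α ℕ.* F ℕ.+ γ ℕ.* L     ≡⟨ counted ⟩
        suc m′ ! ℕ.* F ℕ.+ δ                  ≡⟨ cong (λ t → t ℕ.* F ℕ.+ δ) α+β≡m! ⟨
        (α ℕ.+ β) ℕ.* F ℕ.+ δ                 ≡⟨ expand α β F δ ⟩
        α ℕ.* F ℕ.+ (β ℕ.* F ℕ.+ δ)           ∎)
        where
        open ≡-Reasoning
        F L : ℕ
        F = fall (suc (suc m′) ℕ.+ r) (suc m′)
        L = fall (suc (suc m′) ℕ.+ r) (suc p)
        shuffle : ∀ N δ x y → x ℕ.+ (δ ℕ.* N ℕ.+ y) ≡ N ℕ.* δ ℕ.+ x ℕ.+ y
        shuffle = solve-∀
        expand : ∀ α β F δ → (α ℕ.+ β) ℕ.* F ℕ.+ δ ≡ α ℕ.* F ℕ.+ (β ℕ.* F ℕ.+ δ)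
        expand = solve-∀
        counted : N r ℕ.* δ ℕ.+ α ℕ.* F ℕ.+ γ ℕ.* L ≡ suc m′ ! ℕ.* F ℕ.+ δ
        counted = subst₂ (λ N n → N ℕ.* δ ℕ.+ α ℕ.* fall n (suc m′) ℕ.+ γ ℕ.* fall n (suc p)
            ≡ suc m′ ! ℕ.* fall n (suc m′) ℕ.+ δ)
          (sym (N≡ r)) (n≡ r) (count-Shapely (suc p) q (suc r))

    values : ∀ n → suc m′ ℕ.< n → ∃[ N ] (ℂ-interpolation.horner d (ν n) ≃ ν N ×
      δ ℕ.* N ℕ.+ γ ℕ.* fall n (suc p) ≡ β ℕ.* fall n (suc m′) ℕ.+ δ)
    values n m<n = subst (λ n → ∃[ N ] (ℂ-interpolation.horner d (ν n) ≃ ν N ×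
        δ ℕ.* N ℕ.+ γ ℕ.* fall n (suc p) ≡ β ℕ.* fall n (suc m′) ℕ.+ δ))
      (proj₂ decomposition) (N excess , horner≃N excess , relation excess)
      where
      decomposition = ℕₚ.m≤n⇒∃[o]m+o≡n m<n
      excess = proj₁ decomposition

    -- The formula for d(z), multiplied by δ = ℓ! (m − ℓ)! m! where m = m′ + 1.
    interpolated : ∀ z → ν δ ⊗ ℂ-interpolation.horner d z ⊕ ν γ ⊗ fallingᶜ (suc p) z
                         ≃ ν β ⊗ fallingᶜ (suc m′) z ⊕ ν δ
    interpolated = ℂ-interpolation.interpolation ν ν-+ ν-* ν-inverse d β γ δ
      (s≤s (ℕₚ.m≤m+n p (suc q))) values

-- Norm estimates

double : ℚ → ℚ
double x = x ℚ.+ x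

module NormIdentities where
  norm-* : ∀ a b c d → (a ℚ.* c ℚ.+ ℚ.- (b ℚ.* d)) ℚ.* (a ℚ.* c ℚ.+ ℚ.- (b ℚ.* d))
      ℚ.+ (a ℚ.* d ℚ.+ b ℚ.* c) ℚ.* (a ℚ.* d ℚ.+ b ℚ.* c)
    ≡ (a ℚ.* a ℚ.+ b ℚ.* b) ℚ.* (c ℚ.* c ℚ.+ d ℚ.* d)
  norm-* = solveᵣ-∀ ℚ-ring

  isolate : ∀ u v w → v ≡ u ℚ.+ ℚ.- ((u ℚ.+ ℚ.- (v ℚ.+ w)) ℚ.+ w)
  isolate = solveᵣ-∀ ℚ-ring

  square-split : ∀ u e w →
    (u ℚ.* u ℚ.+ u ℚ.* u)
      ℚ.+ (((e ℚ.* e ℚ.+ w ℚ.* w) ℚ.+ (e ℚ.* e ℚ.+ w ℚ.* w)) ℚ.+ ((e ℚ.* e ℚ.+ w ℚ.* w) ℚ.+ (e ℚ.* e ℚ.+ w ℚ.* w))) ≡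
    (u ℚ.+ ℚ.- (e ℚ.+ w)) ℚ.* (u ℚ.+ ℚ.- (e ℚ.+ w))
      ℚ.+ ((u ℚ.+ (e ℚ.+ w)) ℚ.* (u ℚ.+ (e ℚ.+ w)) ℚ.+ ((e ℚ.- w) ℚ.* (e ℚ.- w) ℚ.+ (e ℚ.- w) ℚ.* (e ℚ.- w)))
  square-split = solveᵣ-∀ ℚ-ring

  double-sum : ∀ u u′ x x′ →
    ((u ℚ.+ u) ℚ.+ ((x ℚ.+ x) ℚ.+ (x ℚ.+ x))) ℚ.+ ((u′ ℚ.+ u′) ℚ.+ ((x′ ℚ.+ x′) ℚ.+ (x′ ℚ.+ x′))) ≡
    ((u ℚ.+ u′) ℚ.+ (u ℚ.+ u′)) ℚ.+ (((x ℚ.+ x′) ℚ.+ (x ℚ.+ x′)) ℚ.+ ((x ℚ.+ x′) ℚ.+ (x ℚ.+ x′)))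
  double-sum = solveᵣ-∀ ℚ-ring

  swap : ∀ a b c d → (a ℚ.+ b) ℚ.+ (c ℚ.+ d) ≡ (a ℚ.+ c) ℚ.+ (b ℚ.+ d)
  swap = solveᵣ-∀ ℚ-ring

0≤square : ∀ x → 0ℚ ℚ.≤ x ℚ.* x
0≤square x = subst (0ℚ ℚ.≤_) (square-∣∣ x) (*-nonNeg (ℚₚ.0≤∣p∣ x) (ℚₚ.0≤∣p∣ x))
  where
  square-∣∣ : ∀ x → ℚ.∣ x ∣ ℚ.* ℚ.∣ x ∣ ≡ x ℚ.* x
  square-∣∣ x with ℚₚ.∣p∣≡p∨∣p∣≡-p x
  ... | inj₁ eq = cong₂ ℚ._*_ eq eq
  ... | inj₂ eq = trans (cong₂ ℚ._*_ eq eq) (neg*neg x)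
    where
    neg*neg : ∀ x → (ℚ.- x) ℚ.* (ℚ.- x) ≡ x ℚ.* x
    neg*neg = solveᵣ-∀ ℚ-ring

-- As v = u - (e + w), the right side exceeds v² by (u + e + w)² + 2 (e - w)². The coefficient of u²
-- must be below 3 for `dominated`.
square-split-≤ : ∀ u v w → let e = u ℚ.+ ℚ.- (v ℚ.+ w) in
  v ℚ.* v ℚ.≤ double (u ℚ.* u) ℚ.+ double (double (e ℚ.* e ℚ.+ w ℚ.* w))
square-split-≤ u v w = subst₂ ℚ._≤_
  (cong (λ t → t ℚ.* t) (sym (NormIdentities.isolate u v w)))
  (sym (NormIdentities.square-split u e w))
  (p≤p+q (ℚₚ.+-mono-≤ (0≤square (u ℚ.+ (e ℚ.+ w))) (ℚₚ.+-mono-≤ (0≤square (e ℚ.- w)) (0≤square (e ℚ.- w)))))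
  where
  e : ℚ
  e = u ℚ.+ ℚ.- (v ℚ.+ w)

p≤∣p∣ : ∀ x → x ℚ.≤ ℚ.∣ x ∣
p≤∣p∣ x with ℚₚ.≤-total 0ℚ x
... | inj₁ 0≤x = ℚₚ.≤-reflexive (sym (ℚₚ.0≤p⇒∣p∣≡p 0≤x))
... | inj₂ x≤0 = ℚₚ.≤-trans x≤0 (ℚₚ.0≤∣p∣ x)

normSq : ℂ → ℝ
normSq z = re z *ᴿ re z +ᴿ im z *ᴿ im z

normSq-null : ∀ {z} → z ≈ᶜ 0ᶜ → ∃[ K ] (∀ i → K ℕ.≤ i → seq (normSq z) i ℚ.< ½)
normSq-null {z} (re≈0 , im≈0) = proj₁ close , λ i hi → ℚₚ.≤-<-trans
  (subst (ℚ._≤ ℚ.∣ seq (normSq z) i ℚ.- 0ℚ ∣) (ℚₚ.+-identityʳ (seq (normSq z) i)) (p≤∣p∣ (seq (normSq z) i ℚ.- 0ℚ)))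
  (proj₂ close i hi)
  where
  close = +ᴿ-cong {re z *ᴿ re z} {fromℕ 0 *ᴿ fromℕ 0} {im z *ᴿ im z} {fromℕ 0 *ᴿ fromℕ 0}
    (*ᴿ-cong {re z} {fromℕ 0} {re z} {fromℕ 0} re≈0 re≈0)
    (*ᴿ-cong {im z} {fromℕ 0} {im z} {fromℕ 0} im≈0 im≈0) ½ (ℚₚ.positive⁻¹ ½)

opaque
  unfolding _≃_

  normAt : ℂ → ℕ → ℚ
  normAt z i = seq (normSq z) i

  -- The two-square identity, exact at each index because multiplication is termwise.
  normAt-⊗ : ∀ z w i → normAt (z ⊗ w) i ≡ normAt z i ℚ.* normAt w i
  normAt-⊗ z w i = NormIdentities.norm-* (seq (re z) i) (seq (im z) i) (seq (re w) i) (seq (im w) i)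

  normAt-ν : ∀ n i → normAt (ν n) i ≡ ι (n ℕ.* n)
  normAt-ν n i = trans (cong (ι n ℚ.* ι n ℚ.+_) (ℚₚ.*-zeroˡ 0ℚ)) (trans (ℚₚ.+-identityʳ _) (sym (ι-* n n)))

  0≤normAt : ∀ z i → 0ℚ ℚ.≤ normAt z i
  0≤normAt z i = ℚₚ.+-mono-≤ (0≤square (seq (re z) i)) (0≤square (seq (im z) i))

  normAt-split : ∀ u v w i → normAt v i ℚ.≤
    double (normAt u i) ℚ.+ double (double (normAt (u ⊕ ⊖ (v ⊕ w)) i ℚ.+ normAt w i))
  normAt-split u v w i = subst (normAt v i ℚ.≤_)
    (trans (NormIdentities.double-sum (re² u) (im² u) (re² e ℚ.+ re² w) (im² e ℚ.+ im² w))
      (cong (λ t → double (normAt u i) ℚ.+ double (double t)) (NormIdentities.swap (re² e) (re² w) (im² e) (im² w))))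
    (ℚₚ.+-mono-≤ (square-split-≤ (seq (re u) i) (seq (re v) i) (seq (re w) i))
                 (square-split-≤ (seq (im u) i) (seq (im v) i) (seq (im w) i)))
    where
    e : ℂ
    e = u ⊕ ⊖ (v ⊕ w)
    re² im² : ℂ → ℚ
    re² z = seq (re z) i ℚ.* seq (re z) i
    im² z = seq (im z) i ℚ.* seq (im z) i

  normAt-null : ∀ {z} → z ≃ ν 0 → ∃[ K ] (∀ i → K ℕ.≤ i → normAt z i ℚ.< ½)
  normAt-null {z} = normSq-null {z}

  normAt-distance : ∀ z k i → normAt (z ⊕ ⊖ ν k) i ≡ seq (normSq (z -ᶜ natᶜ k)) i
  normAt-distance z k i = refl

*-mono-≤ : ∀ {a b c d} → 0ℚ ℚ.≤ a → a ℚ.≤ b → 0ℚ ℚ.≤ c → c ℚ.≤ d → a ℚ.* c ℚ.≤ b ℚ.* d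
*-mono-≤ {a} {b} {c} {d} 0≤a a≤b 0≤c c≤d = ℚₚ.≤-trans
  (ℚₚ.*-monoʳ-≤-nonNeg c {{ℚ.nonNegative 0≤c}} a≤b)
  (ℚₚ.*-monoˡ-≤-nonNeg b {{ℚ.nonNegative (ℚₚ.≤-trans 0≤a a≤b)}} c≤d)

ι*-monoʳ-≤ : ∀ n {c d} → c ℚ.≤ d → ι n ℚ.* c ℚ.≤ ι n ℚ.* d
ι*-monoʳ-≤ n = ℚₚ.*-monoˡ-≤-nonNeg (ι n) {{ℚ.nonNegative (0≤ι n)}}

swap-* : ∀ a b c → a ℚ.* (b ℚ.* c) ≡ b ℚ.* (a ℚ.* c)
swap-* = solveᵣ-∀ ℚ-ring

sq : ℕ → ℕ
sq n = n ℕ.* n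

sq-* : ∀ m n → sq (m ℕ.* n) ≡ sq m ℕ.* sq n
sq-* = interleave
  where
  interleave : ∀ m n → m ℕ.* n ℕ.* (m ℕ.* n) ≡ m ℕ.* m ℕ.* (n ℕ.* n)
  interleave = solve-∀

ι-sq-* : ∀ m n → ι (sq (m ℕ.* n)) ≡ ι (sq m) ℚ.* ι (sq n)
ι-sq-* m n = trans (cong ι (sq-* m n)) (ι-* (sq m) (sq n))

sq-mono : ∀ {m n} → m ℕ.≤ n → sq m ℕ.≤ sq n
sq-mono m≤n = ℕₚ.*-mono-≤ m≤n m≤n

module Growth (z : ℂ) (i m′ : ℕ)
  (far : ∀ k → k ℕ.≤ m′ → ι (m′ ℕ.* (2 ℕ.+ m′)) ℚ.≤ normAt (z ⊕ ⊖ ν k) i) where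

  -- m² - 1 for m = m′ + 1.
  μ : ℕ
  μ = m′ ℕ.* (2 ℕ.+ m′)

  φ : ℕ → ℚ
  φ j = normAt (fallingᶜ j z) i

  φ-suc : ∀ j → φ (suc j) ≡ normAt (z ⊕ ⊖ ν j) i ℚ.* φ j
  φ-suc j = normAt-⊗ (z ⊕ ⊖ ν j) (fallingᶜ j z) i

  0≤φ : ∀ j → 0ℚ ℚ.≤ φ j
  0≤φ j = 0≤normAt (fallingᶜ j z) i

  sq≤μ : ∀ {j} → j ℕ.≤ m′ → sq j ℕ.≤ μ
  sq≤μ {j} j≤m′ = ℕₚ.*-mono-≤ j≤m′ (ℕₚ.≤-trans j≤m′ (ℕₚ.m≤n+m m′ 2))

  factor : ∀ {j} → suc j ℕ.≤ m′ → ι (sq (suc j)) ℚ.≤ normAt (z ⊕ ⊖ ν j) i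
  factor {j} j<m′ = ℚₚ.≤-trans (ι-mono-≤ (sq≤μ j<m′)) (far j (ℕₚ.<⇒≤ j<m′))

  -- The factor |z|² keeps its full bound μ, while each later |z - k|² is used only through (k +
  -- 1)²; the squares from 2² on multiply to the square of the factorial.
  φ-lower : ∀ j → suc j ℕ.≤ m′ → ι μ ℚ.* ι (sq (suc j !)) ℚ.≤ φ (suc j)
  φ-lower zero 1≤m′ = begin
    ι μ ℚ.* ι 1                       ≤⟨ *-mono-≤ (0≤ι μ) (far 0 z≤n) (0≤ι 1) ℚₚ.≤-refl ⟩
    normAt (z ⊕ ⊖ ν 0) i ℚ.* ι 1      ≡⟨ cong (normAt (z ⊕ ⊖ ν 0) i ℚ.*_) (normAt-ν 1 i) ⟨
    normAt (z ⊕ ⊖ ν 0) i ℚ.* φ 0      ≡⟨ φ-suc 0 ⟨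
    φ 1                               ∎
    where open ℚₚ.≤-Reasoning
  φ-lower (suc j) j<m′ = begin
    ι μ ℚ.* ι (sq (suc (suc j) !))
      ≡⟨ cong (ι μ ℚ.*_) (ι-sq-* (suc (suc j)) (suc j !)) ⟩
    ι μ ℚ.* (ι (sq (suc (suc j))) ℚ.* ι (sq (suc j !)))
      ≡⟨ swap-* (ι μ) (ι (sq (suc (suc j)))) (ι (sq (suc j !))) ⟩
    ι (sq (suc (suc j))) ℚ.* (ι μ ℚ.* ι (sq (suc j !)))
      ≤⟨ *-mono-≤ (0≤ι (sq (suc (suc j)))) (factor j<m′) (*-nonNeg (0≤ι μ) (0≤ι (sq (suc j !)))) (φ-lower j (ℕₚ.<⇒≤ j<m′)) ⟩
    normAt (z ⊕ ⊖ ν (suc j)) i ℚ.* φ (suc j)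
      ≡⟨ φ-suc (suc j) ⟨
    φ (suc (suc j)) ∎
    where open ℚₚ.≤-Reasoning

  -- Each new factor |z - j|² with l ≤ j < k + l is at least (j + 1)².
  φ-ratio : ∀ l k → k ℕ.+ l ℕ.≤ m′ → ι (sq ((k ℕ.+ l) !)) ℚ.* φ l ℚ.≤ ι (sq (l !)) ℚ.* φ (k ℕ.+ l)
  φ-ratio l zero    _ = ℚₚ.≤-refl
  φ-ratio l (suc k) h = begin
    ι (sq (suc (k ℕ.+ l) !)) ℚ.* φ l
      ≡⟨ trans (cong (ℚ._* φ l) (ι-sq-* (suc (k ℕ.+ l)) ((k ℕ.+ l) !))) (ℚₚ.*-assoc (ι (sq (suc (k ℕ.+ l)))) (ι (sq ((k ℕ.+ l) !))) (φ l)) ⟩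
    ι (sq (suc (k ℕ.+ l))) ℚ.* (ι (sq ((k ℕ.+ l) !)) ℚ.* φ l)
      ≤⟨ *-mono-≤ (0≤ι (sq (suc (k ℕ.+ l)))) (factor h) (*-nonNeg (0≤ι (sq ((k ℕ.+ l) !))) (0≤φ l)) (φ-ratio l k (ℕₚ.<⇒≤ h)) ⟩
    normAt (z ⊕ ⊖ ν (k ℕ.+ l)) i ℚ.* (ι (sq (l !)) ℚ.* φ (k ℕ.+ l))
      ≡⟨ swap-* (normAt (z ⊕ ⊖ ν (k ℕ.+ l)) i) (ι (sq (l !))) (φ (k ℕ.+ l)) ⟩
    ι (sq (l !)) ℚ.* (normAt (z ⊕ ⊖ ν (k ℕ.+ l)) i ℚ.* φ (k ℕ.+ l))
      ≡⟨ cong (ι (sq (l !)) ℚ.*_) (φ-suc (k ℕ.+ l)) ⟨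
    ι (sq (l !)) ℚ.* φ (suc (k ℕ.+ l)) ∎
    where open ℚₚ.≤-Reasoning

-- With m = n + 1 this reads 3 m² ≤ (m - 1)² (m² - 1), which decides the constant 3 in `dominant`.
-- At n = 2 it is 27 ≤ 32; at n = 1 it would be 12 ≤ 3, hence the separate treatment of m = 2.
μ-bound : ∀ {n} → 2 ℕ.≤ n → 3 ℕ.* sq (suc n) ℕ.≤ sq n ℕ.* (n ℕ.* (2 ℕ.+ n))
μ-bound {n} 2≤n with ℕₚ.m≤n⇒∃[o]m+o≡n 2≤n
-- For n = 2 + t the difference of the two sides is a polynomial in t with positive coefficients,
-- written here in Horner form.
... | t , refl = ℕₚ.≤-trans (ℕₚ.m≤m+n (3 ℕ.* sq (3 ℕ.+ t)) (5 ℕ.+ t ℕ.* (38 ℕ.+ t ℕ.* (33 ℕ.+ t ℕ.* (10 ℕ.+ t)))))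
  (ℕₚ.≤-reflexive (expand t))
  where
  expand : ∀ t → 3 ℕ.* ((3 ℕ.+ t) ℕ.* (3 ℕ.+ t)) ℕ.+ (5 ℕ.+ t ℕ.* (38 ℕ.+ t ℕ.* (33 ℕ.+ t ℕ.* (10 ℕ.+ t))))
    ≡ (2 ℕ.+ t) ℕ.* (2 ℕ.+ t) ℕ.* ((2 ℕ.+ t) ℕ.* (2 ℕ.+ (2 ℕ.+ t)))
  expand = solve-∀

module Estimate (p q : ℕ) (2≤m′ : 2 ℕ.≤ Coefficients.m′ p q) (z : ℂ) (i : ℕ)
  (far : ∀ k → k ℕ.≤ Coefficients.m′ p q →
    ι (Coefficients.m′ p q ℕ.* (2 ℕ.+ Coefficients.m′ p q)) ℚ.≤ normAt (z ⊕ ⊖ ν k) i) where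

  open Coefficients p q
  open Growth z i m′ far

  -- The last factor gives φ(m) ≥ μ φ(m′), and `φ-ratio` gives φ(m′) ≥ (m′!/ℓ!)² φ(ℓ). With β ≥ m′ α
  -- = m′ ℓ! (m - ℓ)! and γ = (m - ℓ)! m m′!, the claim comes down to m′² μ ≥ 3 m².
  dominant : ι 3 ℚ.* normAt (ν γ ⊗ fallingᶜ (suc p) z) i ℚ.≤ normAt (ν β ⊗ fallingᶜ (suc m′) z) i
  dominant = begin
    ι 3 ℚ.* normAt (ν γ ⊗ fallingᶜ (suc p) z) i
      ≡⟨ cong (ι 3 ℚ.*_) (trans (normAt-⊗ (ν γ) (fallingᶜ (suc p) z) i) (cong (ℚ._* φ (suc p)) (normAt-ν γ i))) ⟩
    ι 3 ℚ.* (ι (sq γ) ℚ.* φ (suc p))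
      ≡⟨ trans (sym (ℚₚ.*-assoc (ι 3) (ι (sq γ)) (φ (suc p)))) (cong (ℚ._* φ (suc p)) (trans (sym (ι-* 3 (sq γ)))
           (trans (cong ι (γ² (suc q !) (suc m′) (m′ !))) (ι-* x (sq (m′ !)))))) ⟩
    ι x ℚ.* ι (sq (m′ !)) ℚ.* φ (suc p)
      ≡⟨ ℚₚ.*-assoc (ι x) (ι (sq (m′ !))) (φ (suc p)) ⟩
    ι x ℚ.* (ι (sq (m′ !)) ℚ.* φ (suc p))
      ≤⟨ ι*-monoʳ-≤ x ratio ⟩
    ι x ℚ.* (ι (sq (suc p !)) ℚ.* φ m′)
      ≡⟨ trans (sym (ℚₚ.*-assoc (ι x) (ι (sq (suc p !))) (φ m′))) (cong (ℚ._* φ m′) (trans (sym (ι-* x (sq (suc p !))))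
           (cong ι (α² (suc q !) (suc m′) (suc p !))))) ⟩
    ι (3 ℕ.* sq (suc m′) ℕ.* sq α) ℚ.* φ m′
      ≤⟨ *-mono-≤ (0≤ι (3 ℕ.* sq (suc m′) ℕ.* sq α)) (ι-mono-≤ (ℕₚ.*-monoˡ-≤ (sq α) (μ-bound 2≤m′))) (0≤φ m′) ℚₚ.≤-refl ⟩
    ι (sq m′ ℕ.* μ ℕ.* sq α) ℚ.* φ m′
      ≡⟨ trans (cong (λ n → ι n ℚ.* φ m′) (m′α² m′ μ α)) (trans (cong (ℚ._* φ m′) (ι-* (sq (m′ ℕ.* α)) μ)) (ℚₚ.*-assoc (ι (sq (m′ ℕ.* α))) (ι μ) (φ m′))) ⟩
    ι (sq (m′ ℕ.* α)) ℚ.* (ι μ ℚ.* φ m′)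
      ≤⟨ *-mono-≤ (0≤ι (sq (m′ ℕ.* α))) (ι-mono-≤ (sq-mono m′α≤β)) (*-nonNeg (0≤ι μ) (0≤φ m′))
           (*-mono-≤ (0≤ι μ) (far m′ ℕₚ.≤-refl) (0≤φ m′) ℚₚ.≤-refl) ⟩
    ι (sq β) ℚ.* (normAt (z ⊕ ⊖ ν m′) i ℚ.* φ m′)
      ≡⟨ cong₂ ℚ._*_ (normAt-ν β i) (φ-suc m′) ⟨
    normAt (ν β) i ℚ.* φ (suc m′)
      ≡⟨ normAt-⊗ (ν β) (fallingᶜ (suc m′) z) i ⟨
    normAt (ν β ⊗ fallingᶜ (suc m′) z) i ∎
    where
    open ℚₚ.≤-Reasoning
    x : ℕ
    x = 3 ℕ.* (sq (suc q !) ℕ.* sq (suc m′))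
    γ² : ∀ a b c → 3 ℕ.* (a ℕ.* (b ℕ.* c) ℕ.* (a ℕ.* (b ℕ.* c))) ≡ 3 ℕ.* (a ℕ.* a ℕ.* (b ℕ.* b)) ℕ.* (c ℕ.* c)
    γ² = solve-∀
    α² : ∀ a b c → 3 ℕ.* (a ℕ.* a ℕ.* (b ℕ.* b)) ℕ.* (c ℕ.* c) ≡ 3 ℕ.* (b ℕ.* b) ℕ.* (c ℕ.* a ℕ.* (c ℕ.* a))
    α² = solve-∀
    m′α² : ∀ a b c → a ℕ.* a ℕ.* b ℕ.* (c ℕ.* c) ≡ a ℕ.* c ℕ.* (a ℕ.* c) ℕ.* b
    m′α² = solve-∀
    q+l≡m′ : q ℕ.+ suc p ≡ m′
    q+l≡m′ = trans (ℕₚ.+-comm q (suc p)) (sym (ℕₚ.+-suc p q))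
    ratio : ι (sq (m′ !)) ℚ.* φ (suc p) ℚ.≤ ι (sq (suc p !)) ℚ.* φ m′
    ratio = subst (λ m → ι (sq (m !)) ℚ.* φ (suc p) ℚ.≤ ι (sq (suc p !)) ℚ.* φ m) q+l≡m′
      (φ-ratio (suc p) q (ℕₚ.≤-reflexive q+l≡m′))

  -- Since δ = ℓ! γ, it suffices that φ(ℓ) ≥ 8 (ℓ!)². This is `φ-lower` with μ = m′ (m′ + 2) ≥ 2 ·
  -- 4.
  constant-small : ι 8 ℚ.* normAt (ν δ) i ℚ.≤ normAt (ν γ ⊗ fallingᶜ (suc p) z) i
  constant-small = begin
    ι 8 ℚ.* normAt (ν δ) i
      ≡⟨ cong (ι 8 ℚ.*_) (trans (normAt-ν δ i) (trans (cong ι (δ² (suc p !) (suc q !) (suc m′ !))) (ι-* (sq γ) (sq (suc p !))))) ⟩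
    ι 8 ℚ.* (ι (sq γ) ℚ.* ι (sq (suc p !)))
      ≡⟨ swap-* (ι 8) (ι (sq γ)) (ι (sq (suc p !))) ⟩
    ι (sq γ) ℚ.* (ι 8 ℚ.* ι (sq (suc p !)))
      ≤⟨ ι*-monoʳ-≤ (sq γ) (ℚₚ.≤-trans
           (*-mono-≤ (0≤ι 8) (ι-mono-≤ (ℕₚ.*-mono-≤ 2≤m′ (ℕₚ.+-monoʳ-≤ 2 2≤m′))) (0≤ι (sq (suc p !))) ℚₚ.≤-refl)
           (φ-lower p (ℕₚ.m<m+n p (s≤s z≤n)))) ⟩
    ι (sq γ) ℚ.* φ (suc p)
      ≡⟨ trans (normAt-⊗ (ν γ) (fallingᶜ (suc p) z) i) (cong (ℚ._* φ (suc p)) (normAt-ν γ i)) ⟨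
    normAt (ν γ ⊗ fallingᶜ (suc p) z) i ∎
    where
    open ℚₚ.≤-Reasoning
    δ² : ∀ a b c → a ℕ.* b ℕ.* c ℕ.* (a ℕ.* b ℕ.* c) ≡ b ℕ.* c ℕ.* (b ℕ.* c) ℕ.* (a ℕ.* a)
    δ² = solve-∀

private module ℂR = CommutativeRing ℂ-commutativeRing

double-mono-< : ∀ {x y} → x ℚ.< y → double x ℚ.< double y
double-mono-< x<y = ℚₚ.+-mono-< x<y x<y

ι*-double : ∀ n x → ι (n ℕ.+ n) ℚ.* x ≡ double (ι n ℚ.* x)
ι*-double n x = trans (cong (ℚ._* x) (ι-+ n n)) (ℚₚ.*-distribʳ-+ x (ι n) (ι n))

ι3* : ∀ x → ι 3 ℚ.* x ≡ double x ℚ.+ x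
ι3* x = trans (cong (ℚ._* x) (ι-+ 2 1)) (trans (ℚₚ.*-distribʳ-+ x (ι 2) (ι 1))
  (cong₂ ℚ._+_ (trans (ι*-double 1 x) (cong double (ℚₚ.*-identityˡ x))) (ℚₚ.*-identityˡ x)))

ι8* : ∀ x → ι 8 ℚ.* x ≡ double (double (double x))
ι8* x = trans (ι*-double 4 x) (cong double (trans (ι*-double 2 x)
  (cong double (trans (ι*-double 1 x) (cong double (ℚₚ.*-identityˡ x))))))

+-cancelˡ-≤ : ∀ r {p q} → r ℚ.+ p ℚ.≤ r ℚ.+ q → p ℚ.≤ q
+-cancelˡ-≤ r {p} {q} h = subst₂ ℚ._≤_ (cancel r p) (cancel r q) (ℚₚ.+-monoʳ-≤ (ℚ.- r) h)
  where
  cancel : ∀ r p → (ℚ.- r) ℚ.+ (r ℚ.+ p) ≡ p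
  cancel = solveᵣ-∀ ℚ-ring

-- Two of the three copies of |u|² cancel against `normAt-split`. In the applications u = v + w
-- holds in ℂ, and u - (v + w) is its defect at index `i`.
dominated : ∀ u v w i → ι 3 ℚ.* normAt u i ℚ.≤ normAt v i →
  normAt u i ℚ.≤ double (double (normAt (u ⊕ ⊖ (v ⊕ w)) i ℚ.+ normAt w i))
dominated u v w i 3u≤v = +-cancelˡ-≤ (double (normAt u i)) (ℚₚ.≤-trans
  (subst (ℚ._≤ normAt v i) (ι3* (normAt u i)) 3u≤v) (normAt-split u v w i))

module _ {p q : ℕ} {d : Polynomial} (isDescent : IsDescentPolynomial (suc p ∷ suc (Coefficients.m′ p q) ∷ []) d)
         {z : ℂ} (root : IsRoot d z) where

  open Coefficients p q
  open import Relation.Binary.Reasoning.Setoid ℂR.setoid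

  root-equation : ν γ ⊗ fallingᶜ (suc p) z ≃ ν β ⊗ fallingᶜ (suc m′) z ⊕ ν δ
  root-equation = begin
    ν γ ⊗ fallingᶜ (suc p) z
      ≈⟨ ℂR.+-identityˡ _ ⟨
    ν 0 ⊕ ν γ ⊗ fallingᶜ (suc p) z
      ≈⟨ ℂR.+-congʳ (ℂR.zeroʳ (ν δ)) ⟨
    ν δ ⊗ ν 0 ⊕ ν γ ⊗ fallingᶜ (suc p) z
      ≈⟨ ℂR.+-congʳ (ℂR.*-congˡ horner≃0) ⟨
    ν δ ⊗ ℂ-interpolation.horner d z ⊕ ν γ ⊗ fallingᶜ (suc p) z
      ≈⟨ interpolated d isDescent z ⟩
    ν β ⊗ fallingᶜ (suc m′) z ⊕ ν δ ∎
    where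
    horner≃0 : ℂ-interpolation.horner d z ≃ ν 0
    horner≃0 = subst₂ _≃_ (eval≡horner d z) (ν-unfold 0) (≈ᶜ⇒≃ {eval d z} {0ᶜ} root)

x≃y⇒x⊖y≃0 : ∀ {x y} → x ≃ y → x ⊕ ⊖ y ≃ ν 0
x≃y⇒x⊖y≃0 {x} {y} x≃y = ℂR.trans (ℂR.+-congʳ x≃y) (ℂR.-‿inverseʳ y)

AllFar : ℕ → ℂ → ℕ → Set
AllFar m′ z i = ∀ k → k ℕ.≤ m′ → ι (m′ ℕ.* (2 ℕ.+ m′)) ℚ.≤ normAt (z ⊕ ⊖ ν k) i

module _ (p q : ℕ) (z : ℂ) where
  open Coefficients p q

  -- With defect e the estimates give 8 |δ|² ≤ |u|² ≤ 4 (|e|² + |δ|²), hence |δ|² ≤ |e|²; but |e|²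
  -- is eventually below 1/2, and δ is a positive integer.
  not-all-far : 2 ℕ.≤ m′ → ν γ ⊗ fallingᶜ (suc p) z ≃ ν β ⊗ fallingᶜ (suc m′) z ⊕ ν δ →
                ∃[ K ] (∀ i → K ℕ.≤ i → AllFar m′ z i → ⊥)
  not-all-far 2≤m′ equation = proj₁ null , λ i K≤i far →
    let open Estimate p q 2≤m′ z i far in
    ℚₚ.<-irrefl refl (ℚₚ.≤-<-trans
      (ℚₚ.≤-trans (subst (ℚ._≤ normAt u i) (ι8* (normAt (ν δ) i)) constant-small) (dominated u v (ν δ) i dominant))
      (double-mono-< (double-mono-< (ℚₚ.+-monoˡ-< (normAt (ν δ) i) (ℚₚ.<-≤-trans (proj₂ null i K≤i) (½≤δ² i))))))
    where
    u v : ℂ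
    u = ν γ ⊗ fallingᶜ (suc p) z
    v = ν β ⊗ fallingᶜ (suc m′) z
    null = normAt-null (x≃y⇒x⊖y≃0 equation)
    1≤! : ∀ n → 1 ℕ.≤ n !
    1≤! n = ℕₚ.n≢0⇒n>0 (ℕ.≢-nonZero⁻¹ (n !) {{n !≢0}})
    ½≤δ² : ∀ i → ½ ℚ.≤ normAt (ν δ) i
    ½≤δ² i = subst (½ ℚ.≤_) (sym (normAt-ν δ i)) (ℚₚ.≤-trans (from-yes (½ ℚₚ.≤? ι 1))
      (ι-mono-≤ (sq-mono {1} {δ} (ℕₚ.*-mono-≤ (ℕₚ.*-mono-≤ (1≤! (suc p)) (1≤! (suc q))) (1≤! (suc m′))))))

-- For ℓ = 1 and m = 2 the polynomial is (z − 1)(z − 2)/2, that is (w² − w)/2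
-- in terms of w = z − 1.
module _ (z : ℂ) where
  open import Relation.Binary.Reasoning.Setoid ℂR.setoid
  open import Algebra.Properties.Group ℂR.+-group using (∙-cancelʳ)

  private
    w : ℂ
    w = z ⊕ ⊖ ν 1

  -- Substituting z = w + 1 turns the equation into 2 (w + 1) = w (w + 1) + 2. The summand `ν 0`
  -- brings the result to the form u = v + w treated by `dominated`.
  idempotent : ν 2 ⊗ fallingᶜ 1 z ≃ ν 1 ⊗ fallingᶜ 2 z ⊕ ν 2 → w ≃ w ⊗ w ⊕ ν 0
  idempotent equation = ℂR.trans (∙-cancelʳ (w ⊕ ν 2) w (w ⊗ w) (begin
    w ⊕ (w ⊕ ν 2)                     ≈⟨ ℂR.+-congˡ (ℂR.+-congˡ (ν-+ 1 1)) ⟩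
    w ⊕ (w ⊕ (ν 1 ⊕ ν 1))             ≈⟨ regroup w (ν 1) ⟩
    (w ⊕ ν 1) ⊕ (w ⊕ ν 1)             ≈⟨ ℂR.+-cong (ℂR.*-identityˡ _) (ℂR.*-identityˡ _) ⟨
    ν 1 ⊗ (w ⊕ ν 1) ⊕ ν 1 ⊗ (w ⊕ ν 1) ≈⟨ ℂR.distribʳ (w ⊕ ν 1) (ν 1) (ν 1) ⟨
    (ν 1 ⊕ ν 1) ⊗ (w ⊕ ν 1)           ≈⟨ ℂR.*-cong (ν-+ 1 1) linear ⟨
    ν 2 ⊗ fallingᶜ 1 z                ≈⟨ equation ⟩
    ν 1 ⊗ (w ⊗ fallingᶜ 1 z) ⊕ ν 2    ≈⟨ ℂR.+-congʳ (ℂR.*-identityˡ _) ⟩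
    w ⊗ fallingᶜ 1 z ⊕ ν 2            ≈⟨ ℂR.+-congʳ (ℂR.*-congˡ linear) ⟩
    w ⊗ (w ⊕ ν 1) ⊕ ν 2               ≈⟨ ℂR.+-congʳ (ℂR.trans (ℂR.distribˡ w w (ν 1)) (ℂR.+-congˡ (ℂR.*-identityʳ w))) ⟩
    (w ⊗ w ⊕ w) ⊕ ν 2                 ≈⟨ ℂR.+-assoc _ _ _ ⟩
    w ⊗ w ⊕ (w ⊕ ν 2)                 ∎)) (ℂR.sym (ℂR.+-identityʳ (w ⊗ w)))
    where
    regroup : ∀ x y → x ⊕ (x ⊕ (y ⊕ y)) ≃ (x ⊕ y) ⊕ (x ⊕ y)
    regroup x y = ℂR.trans (ℂR.+-congˡ (ℂR.trans (ℂR.sym (ℂR.+-assoc x y y)) (ℂR.+-comm (x ⊕ y) y))) (ℂR.sym (ℂR.+-assoc x y (x ⊕ y)))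
    linear : fallingᶜ 1 z ≃ w ⊕ ν 1
    linear = begin
      (z ⊕ ⊖ ν 0) ⊗ ν 1       ≈⟨ ℂR.*-identityʳ _ ⟩
      z ⊕ ⊖ ν 0               ≈⟨ ℂR.+-congˡ -0#≈0# ⟩
      z ⊕ ν 0                 ≈⟨ ℂR.+-congˡ (ℂR.-‿inverseˡ (ν 1)) ⟨
      z ⊕ (⊖ ν 1 ⊕ ν 1)       ≈⟨ ℂR.+-assoc _ _ _ ⟨
      w ⊕ ν 1                 ∎
      where open import Algebra.Properties.Ring ℂR.ring using (-0#≈0#)

  -- For m = 2 the bound is |w|² ≥ 3, so |w²|² ≥ 3 |w|² and `dominated` yields |w|² ≤ 4 |e|² < 2, a
  -- contradiction.
  not-all-far-quadratic : ν 2 ⊗ fallingᶜ 1 z ≃ ν 1 ⊗ fallingᶜ 2 z ⊕ ν 2 →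
                          ∃[ K ] (∀ i → K ℕ.≤ i → AllFar 1 z i → ⊥)
  not-all-far-quadratic equation = proj₁ null , λ i K≤i far → ℚₚ.<-irrefl refl
    (ℚₚ.<-≤-trans (ℚₚ.≤-<-trans
        (ℚₚ.≤-trans (far 1 ℕₚ.≤-refl) (dominated w (w ⊗ w) (ν 0) i (square i (far 1 ℕₚ.≤-refl))))
        (double-mono-< (double-mono-< (subst (λ t → normAt e i ℚ.+ t ℚ.< ½ ℚ.+ 0ℚ) (sym (normAt-ν 0 i))
          (ℚₚ.+-monoˡ-< 0ℚ (proj₂ null i K≤i))))))
      (from-yes (double (double (½ ℚ.+ 0ℚ)) ℚₚ.≤? ι 3)))
    where
    e : ℂ
    e = w ⊕ ⊖ (w ⊗ w ⊕ ν 0)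
    null : ∃[ K ] (∀ i → K ℕ.≤ i → normAt e i ℚ.< ½)
    null = normAt-null (x≃y⇒x⊖y≃0 (idempotent equation))
    square : ∀ i → ι 3 ℚ.≤ normAt w i → ι 3 ℚ.* normAt w i ℚ.≤ normAt (w ⊗ w) i
    square i 3≤w = subst (ι 3 ℚ.* normAt w i ℚ.≤_) (sym (normAt-⊗ w w i))
      (*-mono-≤ (0≤ι 3) 3≤w (0≤normAt w i) ℚₚ.≤-refl)

-- The search for a disc

-- From the index K on, the sequence varies by less than 1/2, so one rational comparison of its K-th
-- term with u + 1/2 decides.
cotransitivity : ∀ (x : ℝ) u →
  ∃[ K ] (∀ i → K ℕ.≤ i → seq x i ℚ.≤ u ℚ.+ 1ℚ) ⊎ ∃[ K ] (∀ i → K ℕ.≤ i → u ℚ.≤ seq x i)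
cotransitivity x u = decide (ℚₚ.≤-total (seq x K) (u ℚ.+ ½))
  where
  half-cauchy = cauchy x ½ (ℚₚ.positive⁻¹ ½)
  K : ℕ
  K = proj₁ half-cauchy
  near : ∀ i j → K ℕ.≤ i → K ℕ.≤ j → seq x i ℚ.≤ seq x j ℚ.+ ½
  near i j hi hj = ℚₚ.≤-trans (ℚₚ.≤-reflexive (add-diff (seq x i) (seq x j)))
    (ℚₚ.+-monoʳ-≤ (seq x j) (ℚₚ.≤-trans (p≤∣p∣ (seq x i ℚ.- seq x j)) (ℚₚ.<⇒≤ (proj₂ half-cauchy i j hi hj))))
  decide : seq x K ℚ.≤ u ℚ.+ ½ ⊎ u ℚ.+ ½ ℚ.≤ seq x K → _
  decide (inj₁ xK≤) = inj₁ (K , λ i hi → ℚₚ.≤-trans (near i K hi ℕₚ.≤-refl)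
    (ℚₚ.≤-trans (ℚₚ.+-monoˡ-≤ ½ xK≤) (ℚₚ.≤-reflexive (ℚₚ.+-assoc u ½ ½))))
  decide (inj₂ ≤xK) = inj₂ (K , λ i hi → +-cancelˡ-≤ ½
    (subst₂ ℚ._≤_ (ℚₚ.+-comm u ½) (ℚₚ.+-comm (seq x i) ½) (ℚₚ.≤-trans ≤xK (near K i ℕₚ.≤-refl hi))))

-- An approximate root of at least m + ε would have a square of at least m² + ε², while `√≈-lower`
-- keeps that square below the approximated number.
close⇒𝒟 : ∀ m k z K → (∀ i → K ℕ.≤ i → seq (normSq (z -ᶜ natᶜ k)) i ℚ.≤ ι (sq m)) → 𝒟 m k z
close⇒𝒟 m k z K close ε 0<ε = K , λ i hi → ℚₚ.≰⇒> λ m+ε≤s → ℚₚ.<-irrefl refl (begin-strict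
    ι (sq m)
      ≡⟨ trans (ι-* m m) (sym (ℚₚ.+-identityʳ (ι m ℚ.* ι m))) ⟩
    ι m ℚ.* ι m ℚ.+ 0ℚ
      <⟨ ℚₚ.+-monoʳ-< (ι m ℚ.* ι m) (*-pos 0<ε 0<ε) ⟩
    ι m ℚ.* ι m ℚ.+ ε ℚ.* ε
      ≤⟨ p≤p+q (ℚₚ.+-mono-≤ (*-nonNeg (0≤ι m) (ℚₚ.<⇒≤ 0<ε)) (*-nonNeg (0≤ι m) (ℚₚ.<⇒≤ 0<ε))) ⟩
    ι m ℚ.* ι m ℚ.+ ε ℚ.* ε ℚ.+ (ι m ℚ.* ε ℚ.+ ι m ℚ.* ε)
      ≡⟨ square-sum (ι m) ε ⟩
    (ι m ℚ.+ ε) ℚ.* (ι m ℚ.+ ε)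
      ≤⟨ square-mono-≤ (ℚₚ.+-mono-≤ (0≤ι m) (ℚₚ.<⇒≤ 0<ε)) m+ε≤s ⟩
    √≈ (x i) i ℚ.* √≈ (x i) i
      ≤⟨ √≈-lower (x i) i ⟩
    ℚ.∣ x i ∣
      ≡⟨ ℚₚ.0≤p⇒∣p∣≡p (ℚₚ.+-mono-≤ (0≤square (seq (re (z -ᶜ natᶜ k)) i)) (0≤square (seq (im (z -ᶜ natᶜ k)) i))) ⟩
    x i
      ≤⟨ close i hi ⟩
    ι (sq m) ∎)
  where
  open ℚₚ.≤-Reasoning
  x : ℕ → ℚ
  x = seq (normSq (z -ᶜ natᶜ k))
  square-sum : ∀ a e → a ℚ.* a ℚ.+ e ℚ.* e ℚ.+ (a ℚ.* e ℚ.+ a ℚ.* e) ≡ (a ℚ.+ e) ℚ.* (a ℚ.+ e)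
  square-sum = solveᵣ-∀ ℚ-ring

-- The thresholds depend on k; their maximum serves all k < j at once, so that a single index can be
-- inspected.
find-or-all : ∀ {P : ℕ → Set} {Q : ℕ → ℕ → Set} →
  (∀ k → P k ⊎ ∃[ K ] (∀ i → K ℕ.≤ i → Q k i)) →
  ∀ j → ∃[ k ] (k ℕ.< j × P k) ⊎ ∃[ K ] (∀ i → K ℕ.≤ i → ∀ k → k ℕ.< j → Q k i)
find-or-all P∨Q zero    = inj₂ (0 , λ _ _ _ ())
find-or-all P∨Q (suc j) with find-or-all P∨Q j | P∨Q j
... | inj₁ (k , k<j , Pk) | _            = inj₁ (k , ℕₚ.m<n⇒m<1+n k<j , Pk)
... | inj₂ _              | inj₁ Pj      = inj₁ (j , ℕₚ.≤-refl , Pj)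
... | inj₂ (K , Q<j)      | inj₂ (L , Qj) = inj₂ (K ℕ.⊔ L , λ i hi k k<1+j →
  Sum.[ Q<j i (ℕₚ.m⊔n≤o⇒m≤o K L hi) k , (λ { refl → Qj i (ℕₚ.m⊔n≤o⇒n≤o K L hi) }) ]′
    (ℕₚ.m≤n⇒m<n∨m≡n (ℕₚ.≤-pred k<1+j)))

module _ (m′ : ℕ) (z : ℂ) where

  private
    μ : ℕ
    μ = m′ ℕ.* (2 ℕ.+ m′)

    μ+1≡m² : ι μ ℚ.+ 1ℚ ≡ ι (sq (suc m′))
    μ+1≡m² = trans (sym (ι-+ μ 1)) (cong ι (square-suc m′))
      where
      square-suc : ∀ n → n ℕ.* (2 ℕ.+ n) ℕ.+ 1 ≡ suc n ℕ.* suc n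
      square-suc = solve-∀

  disc-or-far : ∀ k → 𝒟 (suc m′) k z ⊎ ∃[ K ] (∀ i → K ℕ.≤ i → ι μ ℚ.≤ normAt (z ⊕ ⊖ ν k) i)
  disc-or-far k = Sum.map
    (λ (K , close) → close⇒𝒟 (suc m′) k z K λ i hi → ℚₚ.≤-trans (close i hi) (ℚₚ.≤-reflexive μ+1≡m²))
    (λ (K , far) → K , λ i hi → subst (ι μ ℚ.≤_) (sym (normAt-distance z k i)) (far i hi))
    (cotransitivity (normSq (z -ᶜ natᶜ k)) (ι μ))

  some-disc : ∃[ K ] (∀ i → K ℕ.≤ i → AllFar m′ z i → ⊥) → ∃[ k ] (k ℕ.< suc m′ × 𝒟 (suc m′) k z)
  some-disc (K , ¬allFar) = Sum.fromInj₁
    (λ (L , allFar) → ⊥-elim (¬allFar (K ℕ.⊔ L) (ℕₚ.m≤m⊔n K L)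
      λ k k≤m′ → allFar (K ℕ.⊔ L) (ℕₚ.m≤n⊔m K L) k (s≤s k≤m′)))
    (find-or-all {λ k → 𝒟 (suc m′) k z} {λ k i → ι μ ℚ.≤ normAt (z ⊕ ⊖ ν k) i} disc-or-far (suc m′))

-- Here ℓ = p + 1 and m - ℓ = q + 1. Only p = q = 0 gives m = 2; in all other cases m′ ≥ 2 and the
-- general estimates apply.
root-in-disc : ∀ p q d → IsDescentPolynomial (suc p ∷ suc (p ℕ.+ suc q) ∷ []) d → ∀ z → IsRoot d z →
  ∃[ k ] (k ℕ.< suc (p ℕ.+ suc q) × 𝒟 (suc (p ℕ.+ suc q)) k z)
root-in-disc zero    zero    d isD z root = some-disc 1 z (not-all-far-quadratic z (root-equation {zero} {zero} {d} isD {z} root))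
root-in-disc zero    (suc q) d isD z root = some-disc (suc (suc q)) z
  (not-all-far zero (suc q) z (s≤s (s≤s z≤n)) (root-equation {zero} {suc q} {d} isD {z} root))
root-in-disc (suc p) q       d isD z root = some-disc (suc p ℕ.+ suc q) z
  (not-all-far (suc p) q z (s≤s (ℕₚ.≤-trans (s≤s z≤n) (ℕₚ.m≤n+m (suc q) p))) (root-equation {suc p} {q} {d} isD {z} root))

theorem4p10 : ∀ (ℓ m : ℕ) → 1 ≤ ℓ → ℓ < m →
    ∀ (d : Polynomial) → IsDescentPolynomial (ℓ ∷ m ∷ []) d →
    ∀ (z : ℂ) → IsRoot d z →
    ∃[ k ] (k < m × 𝒟 m k z)
theorem4p10 (suc p) m _ ℓ<m =
  subst (λ m → ∀ d → IsDescentPolynomial (suc p ∷ m ∷ []) d → ∀ z → IsRoot d z → ∃[ k ] (k < m × 𝒟 m k z))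
    (trans (cong suc (ℕₚ.+-suc p (proj₁ decomposition))) (proj₂ decomposition))
    (root-in-disc p (proj₁ decomposition))
  where
  decomposition = ℕₚ.m≤n⇒∃[o]m+o≡n ℓ<m
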